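{- Let $f\in\mathbb{Z}[X]$ be a monic irreducible polynomial of degree $d\geq 2$ which is even, i.e. $f(-X)=f(X)$. For integers $N\geq1$ put $\ell_f(N)=\operatorname{rad}\operatorname{lcm}\{f(1),\ldots,f(N)\}$ (equivalently, the product of the distinct primes dividing $f(1)f(2)\cdots f(N)$). Then there is a constant $C>0$ depending only on $f$ such that for all integers $N\geq 2$, \[ \log \ell_f(N)\;\geq\;\frac{8(d-1)}{d(3d-2)}\,N\log N - C N . \]
   Context: $\operatorname{rad}(m)$ denotes the product of the distinct primes dividing the nonzero integer $m$. -}

module Defs where

open import Data.Nat as ℕ using (ℕ; zero; suc; _∸_)
open import Data.Nat.Divisibility using (_∣?_)
open import Data.Nat.Primality using (prime?)
open import Data.Integer as ℤ using (ℤ; +_; -_; ∣_∣)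
open import Data.List using (List; []; _∷_; filter; upTo; map; foldr)
open import Data.Nat.ListAction using (product)
open import Data.Product using (_×_)
open import Data.Sum using (_⊎_)
open import Relation.Nullary using (¬_)
open import Relation.Nullary.Decidable using (_×-dec_)
open import Relation.Binary.PropositionalEquality using (_≡_)

-- A polynomial in ℤ[X] is its list of coefficients, constant term first.
Poly : Set
Poly = List ℤ

coeff : Poly → ℕ → ℤ
coeff []      n       = + 0
coeff (a ∷ p) zero    = a
coeff (a ∷ p) (suc n) = coeff p n

eval : Poly → ℤ → ℤ
eval []      x = + 0
eval (a ∷ p) x = a ℤ.+ x ℤ.* eval p x

sumℤ : List ℤ → ℤ
sumℤ = foldr ℤ._+_ (+ 0)

mulCoeff : Poly → Poly → ℕ → ℤ
mulCoeff g h n = sumℤ (map (λ i → coeff g i ℤ.* coeff h (n ∸ i)) (upTo (suc n)))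

IsZero : Poly → Set
IsZero p = ∀ n → coeff p n ≡ + 0

IsUnit : Poly → Set
IsUnit p = (coeff p 0 ≡ + 1 ⊎ coeff p 0 ≡ - (+ 1)) × (∀ n → coeff p (suc n) ≡ + 0)

Irreducible : Poly → Set
Irreducible f = ¬ IsZero f × ¬ IsUnit f ×
  (∀ g h → (∀ n → coeff f n ≡ mulCoeff g h n) → IsUnit g ⊎ IsUnit h)

MonicOfDegree : Poly → ℕ → Set
MonicOfDegree f d = Data.List.length f ≡ suc d × coeff f d ≡ + 1
  where import Data.List

-- f(-X) = f(X), compared coefficientwise: coeff of X^n in f(-X) is (-1)^n a_n.
IsEven : Poly → Set
IsEven f = ∀ n → (- (+ 1)) ℤ.^ n ℤ.* coeff f n ≡ coeff f n

-- rad m = product of the distinct primes dividing m (rad 0 = 1 by this definition; unused).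
rad : ℕ → ℕ
rad m = product (filter (λ p → prime? p ×-dec p ∣? m) (upTo (suc m)))

prodℤ : List ℤ → ℤ
prodℤ = foldr ℤ._*_ (+ 1)

ℓ : Poly → ℕ → ℕ
ℓ f N = rad ∣ prodℤ (map (λ n → eval f (+ suc n)) (upTo N)) ∣

{-# OPTIONS --safe #-}

-- Write d = 2e and h(n) = |f(n)|. By N^N ≤ 4^N N!, the product of the h(n) for n ≤ N is at least N^(dN) up to a
-- factor C^N; the primes p ≤ cN and p > cN are treated separately.
--
-- Small primes. For a polynomial x ≠ 0 of degree < d, the primes p with a root r of f modulo p such that p ∣ x(r)
-- have product at most the norm of x, which is O(X^d) if the coefficients of x are at most X. Apply this to all
-- differences of two elements of a box of N ≈ X^d polynomials: by Cauchy–Schwarz at least N²/p of the pairs are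
-- congruent modulo each (p, r), whence ∑ ρ(p) log p / p ≤ log N + O(1), where ρ(p) is the number of roots modulo p.
-- Prime powers contribute a factor C^N only, since a f + b f′ = c ≠ 0 separates the roots of f modulo p^l. So the
-- small primes account for at most N^N C^N.
--
-- Large primes. Write f(n) = g(n²). If p^l divides f(n₁), …, f(n_k) with p > cN, then p^l divides the divided
-- difference of g at n₁², …, n_k², which is positive and O(N^(2(e−k+1))); hence l + 2k ≤ 2e + 1. Summing over l,
-- p divides the product of the values at most e² times, so that N^((d−1)N) ≤ C^N ℓ(N)^(e²), and 8e² ≤ d(3d−2).
module Submission where

open import Algebra.Bundles using (AbelianGroup)
open import Data.Empty using (⊥; ⊥-elim)
open import Data.Integer as ℤ using (ℤ; -[1+_]; ∣_∣) renaming (+_ to pos)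
import Data.Integer.Divisibility.Signed as ℤ∣
import Data.Integer.Properties as ℤ
open import Data.Integer.Tactic.RingSolver using () renaming (solve-∀ to ℤ-solve-∀)
open import Data.List using (List; []; _∷_; _++_; map; filter; length; replicate; reverse; downFrom; cartesianProduct; cartesianProductWith; applyDownFrom; applyUpTo; upTo)
open import Data.List.Membership.Propositional using (_∈_)
open import Data.List.Membership.Propositional.Properties
open import Data.List.Properties using (length-++; length-map; length-downFrom; length-applyDownFrom; length-removeAt′; map-id; map-upTo; ∷-injective; ≡-dec; reverse-downFrom; downFrom-∷ʳ)
open import Data.List.Relation.Binary.Permutation.Propositional using (_↭_)
open import Data.List.Relation.Binary.Permutation.Propositional.Properties using (↭-reverse) renaming (map⁺ to ↭-map⁺)
open import Data.List.Relation.Binary.Pointwise using (Pointwise; []; _∷_)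
open import Data.List.Relation.Unary.All using (All; []; _∷_)
import Data.List.Relation.Unary.All as All
import Data.List.Relation.Unary.All.Properties as All
open import Data.List.Relation.Unary.AllPairs using (AllPairs; []; _∷_)
open import Data.List.Relation.Unary.Any using (here; there)
import Data.List.Relation.Unary.Any as Any
open import Data.List.Relation.Unary.Unique.Propositional using (Unique)
import Data.List.Relation.Unary.Unique.Propositional.Properties as Unique
open import Data.Nat
open import Data.Nat.Combinatorics using (nCn≡1; nCk≡nC[n∸k]; k>n⇒nCk≡0; nCk+nC[k+1]≡[n+1]C[k+1]; nCk≡n!/k![n-k]!; k![n∸k]!∣n!) renaming (_C_ to _choose_)
open import Data.Nat.Coprimality using (Coprime; coprime-divisor; prime⇒coprime)
open import Data.Nat.DivMod
open import Data.Nat.Divisibility hiding (∣-reflexive)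
open import Data.Nat.ListAction using (sum; product)
open import Data.Nat.ListAction.Properties using (product-↭)
open import Data.Nat.Primality hiding (Irreducible)
open import Data.Nat.Primality.Factorisation using (PrimeFactorisation; factorise)
open import Data.Nat.Properties
open import Data.Nat.Tactic.RingSolver using (solve-∀)
open import Data.Product using (∃-syntax; _×_; _,_; proj₁; proj₂)
open import Data.Sum using (_⊎_; inj₁; inj₂)
open import Function using (_∘_; id; const)
open import Relation.Binary.PropositionalEquality
open import Relation.Nullary using (¬_; Dec; yes; no; contradiction)
open import Relation.Nullary.Decidable using (_×-dec_)
open import Relation.Unary using (Decidable)
open import Defs

-- There are no logarithms: a bound on a sum of terms a log p is stated as a bound on the product of
-- the p ^ a, and an error O(N) is a factor K ^ N. The small primes need only an upper bound for the
-- average of ρ(p), the half of the prime ideal theorem that counting can reach. A box with X^d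
-- points is the right test set because its size and the norms of its differences have the same
-- order X^d; hence the main term is log N with coefficient 1. This coefficient decides the result:
-- the trivial ρ(p) ≤ d would give d log N for the small primes and leave nothing for the large
-- ones. Norms enter only as the index of an ideal, which the pigeonhole principle bounds without
-- resultants or complex embeddings. Evenness makes the squares the nodes of interpolation: each
-- further common root costs a factor of order N², not N, and the admissible pairs (l, k) then form
-- a staircase of area e + 2((e - 1) + ... + 1) = e².

-- Finite sums and products

private variable
  α β : Set

∑ : List α → (α → ℕ) → ℕ
∑ xs g = sum (map g xs)

∏ : List α → (α → ℕ) → ℕ
∏ xs g = product (map g xs)

∑-mono : (xs : List α) {g h : α → ℕ} → (∀ x → x ∈ xs → g x ≤ h x) → ∑ xs g ≤ ∑ xs h
∑-mono []       g≤h = z≤n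
∑-mono (x ∷ xs) g≤h = +-mono-≤ (g≤h x (here refl)) (∑-mono xs (λ y → g≤h y ∘ there))

∏-mono : (xs : List α) {g h : α → ℕ} → (∀ x → x ∈ xs → g x ≤ h x) → ∏ xs g ≤ ∏ xs h
∏-mono []       g≤h = ≤-refl
∏-mono (x ∷ xs) g≤h = *-mono-≤ (g≤h x (here refl)) (∏-mono xs (λ y → g≤h y ∘ there))

∑-cong : (xs : List α) {g h : α → ℕ} → (∀ x → x ∈ xs → g x ≡ h x) → ∑ xs g ≡ ∑ xs h
∑-cong []       g≡h = refl
∑-cong (x ∷ xs) g≡h = cong₂ _+_ (g≡h x (here refl)) (∑-cong xs (λ y → g≡h y ∘ there))

∏-cong : (xs : List α) {g h : α → ℕ} → (∀ x → x ∈ xs → g x ≡ h x) → ∏ xs g ≡ ∏ xs h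
∏-cong []       g≡h = refl
∏-cong (x ∷ xs) g≡h = cong₂ _*_ (g≡h x (here refl)) (∏-cong xs (λ y → g≡h y ∘ there))

private
  interchange+ : ∀ a b c d → a + b + (c + d) ≡ a + c + (b + d)
  interchange+ = solve-∀

  interchange* : ∀ a b c d → a * b * (c * d) ≡ a * c * (b * d)
  interchange* = solve-∀

∑-+ : (xs : List α) (g h : α → ℕ) → ∑ xs (λ x → g x + h x) ≡ ∑ xs g + ∑ xs h
∑-+ []       g h = refl
∑-+ (x ∷ xs) g h rewrite ∑-+ xs g h = interchange+ (g x) (h x) (∑ xs g) (∑ xs h)

∏-* : (xs : List α) (g h : α → ℕ) → ∏ xs (λ x → g x * h x) ≡ ∏ xs g * ∏ xs h
∏-* []       g h = refl
∏-* (x ∷ xs) g h rewrite ∏-* xs g h = interchange* (g x) (h x) (∏ xs g) (∏ xs h)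

∑-*ˡ : (xs : List α) (k : ℕ) (g : α → ℕ) → ∑ xs (λ x → k * g x) ≡ k * ∑ xs g
∑-*ˡ []       k g = sym (*-zeroʳ k)
∑-*ˡ (x ∷ xs) k g rewrite ∑-*ˡ xs k g = sym (*-distribˡ-+ k (g x) (∑ xs g))

∑-const : (xs : List α) (k : ℕ) → ∑ xs (λ _ → k) ≡ length xs * k
∑-const []       k = refl
∑-const (x ∷ xs) k = cong (k +_) (∑-const xs k)

∏-const : (xs : List α) (k : ℕ) → ∏ xs (λ _ → k) ≡ k ^ length xs
∏-const []       k = refl
∏-const (x ∷ xs) k = cong (k *_) (∏-const xs k)

∏-one : (xs : List α) → ∏ xs (λ _ → 1) ≡ 1
∏-one []       = refl
∏-one (x ∷ xs) = trans (*-identityˡ _) (∏-one xs)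

∏≥1 : (xs : List α) {g : α → ℕ} → (∀ x → x ∈ xs → 1 ≤ g x) → 1 ≤ ∏ xs g
∏≥1 xs {g} g≥1 = subst (_≤ ∏ xs g) (∏-one xs) (∏-mono xs g≥1)

∑-zero : (xs : List α) → ∑ xs (λ _ → 0) ≡ 0
∑-zero []       = refl
∑-zero (x ∷ xs) = ∑-zero xs

∑-swap : (xs : List α) (ys : List β) (g : α → β → ℕ) →
         ∑ xs (λ x → ∑ ys (g x)) ≡ ∑ ys (λ y → ∑ xs (λ x → g x y))
∑-swap []       ys g = sym (∑-zero ys)
∑-swap (x ∷ xs) ys g = trans (cong (∑ ys (g x) +_) (∑-swap xs ys g))
  (sym (∑-+ ys (g x) (λ y → ∑ xs (λ x → g x y))))

∏-swap : (xs : List α) (ys : List β) (g : α → β → ℕ) →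
         ∏ xs (λ x → ∏ ys (g x)) ≡ ∏ ys (λ y → ∏ xs (λ x → g x y))
∏-swap []       ys g = sym (∏-one ys)
∏-swap (x ∷ xs) ys g = trans (cong (∏ ys (g x) *_) (∏-swap xs ys g))
  (sym (∏-* ys (g x) (λ y → ∏ xs (λ x → g x y))))

^-distribʳ-* : ∀ k a b → (a * b) ^ k ≡ a ^ k * b ^ k
^-distribʳ-* zero    a b = refl
^-distribʳ-* (suc k) a b rewrite ^-distribʳ-* k a b = interchange* a b (a ^ k) (b ^ k)

∏-^ : (xs : List α) (g : α → ℕ) (k : ℕ) → ∏ xs (λ x → g x ^ k) ≡ ∏ xs g ^ k
∏-^ []       g k = sym (^-zeroˡ k)
∏-^ (x ∷ xs) g k rewrite ∏-^ xs g k = sym (^-distribʳ-* k (g x) (∏ xs g))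

^-∑ : (xs : List α) (b : ℕ) (a : α → ℕ) → b ^ ∑ xs a ≡ ∏ xs (λ x → b ^ a x)
^-∑ []       b a = refl
^-∑ (x ∷ xs) b a = trans (^-distribˡ-+-* b (a x) (∑ xs a)) (cong (b ^ a x *_) (^-∑ xs b a))

∏-++ : (xs ys : List α) (g : α → ℕ) → ∏ (xs ++ ys) g ≡ ∏ xs g * ∏ ys g
∏-++ []       ys g = sym (*-identityˡ _)
∏-++ (x ∷ xs) ys g rewrite ∏-++ xs ys g = sym (*-assoc (g x) (∏ xs g) (∏ ys g))

∏-map : (k : α → β) (xs : List α) (g : β → ℕ) → ∏ (map k xs) g ≡ ∏ xs (g ∘ k)
∏-map k []       g = refl
∏-map k (x ∷ xs) g = cong (g (k x) *_) (∏-map k xs g)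

length-cartesianProductWith : {C : Set} (k : α → β → C) (xs : List α) (ys : List β) →
                              length (cartesianProductWith k xs ys) ≡ length xs * length ys
length-cartesianProductWith k []       ys = refl
length-cartesianProductWith k (x ∷ xs) ys =
  trans (length-++ (map (k x) ys))
        (cong₂ _+_ (length-map (k x) ys) (length-cartesianProductWith k xs ys))

-- As a summand it counts; as an exponent it switches a factor between `b` and `1`, which moves a
-- condition out of the range of a product.
ι : {P : Set} → Dec P → ℕ
ι (yes _) = 1
ι (no  _) = 0

ι-yes : {P : Set} (d : Dec P) → P → ι d ≡ 1
ι-yes (yes _) p = refl
ι-yes (no ¬p) p = contradiction p ¬p

ι-no : {P : Set} (d : Dec P) → ¬ P → ι d ≡ 0
ι-no (yes p) ¬p = contradiction p ¬p
ι-no (no _)  ¬p = refl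

ι≤1 : {P : Set} (d : Dec P) → ι d ≤ 1
ι≤1 (yes _) = ≤-refl
ι≤1 (no  _) = z≤n

ι-mono : {P Q : Set} (d : Dec P) (e : Dec Q) → (P → Q) → ι d ≤ ι e
ι-mono (yes p) e P→Q = ≤-reflexive (sym (ι-yes e (P→Q p)))
ι-mono (no _)  e P→Q = z≤n

length-filter≡∑ : {P : α → Set} (P? : Decidable P) (xs : List α) → length (filter P? xs) ≡ ∑ xs (ι ∘ P?)
length-filter≡∑ P? [] = refl
length-filter≡∑ P? (x ∷ xs) with P? x
... | yes _ = cong suc (length-filter≡∑ P? xs)
... | no  _ = length-filter≡∑ P? xs

∏-filter : {P : α → Set} (P? : Decidable P) (xs : List α) (g : α → ℕ) →
           ∏ (filter P? xs) g ≡ ∏ xs (λ x → g x ^ ι (P? x))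
∏-filter P? [] g = refl
∏-filter P? (x ∷ xs) g with P? x
... | yes _ = cong₂ _*_ (sym (*-identityʳ (g x))) (∏-filter P? xs g)
... | no  _ = trans (∏-filter P? xs g) (sym (*-identityˡ _))

∈-─ : {x y : α} (xs : List α) (i : x ∈ xs) → y ∈ xs → ¬ y ≡ x → y ∈ (xs Any.─ i)
∈-─ (_ ∷ xs) (here refl) (here refl) y≢x = contradiction refl y≢x
∈-─ (_ ∷ xs) (here refl) (there j)   y≢x = j
∈-─ (_ ∷ xs) (there i)   (here refl) y≢x = here refl
∈-─ (_ ∷ xs) (there i)   (there j)   y≢x = there (∈-─ xs i j y≢x)

-- Each image is deleted from `ys` once it is used; injectivity on `xs` keeps the images of the
-- remaining entries in the shortened list.
pigeonhole : (xs : List α) (ys : List β) (k : α → β) → Unique xs → (∀ x → x ∈ xs → k x ∈ ys) →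
             (∀ x y → x ∈ xs → y ∈ xs → k x ≡ k y → x ≡ y) → length xs ≤ length ys
pigeonhole []       ys k _            into inj = z≤n
pigeonhole (x ∷ xs) ys k (x∉xs ∷ uniq) into inj =
  subst (suc (length xs) ≤_) (sym (length-removeAt′ ys (Any.index i))) (s≤s (pigeonhole xs (ys Any.─ i) k uniq
    (λ y y∈ → ∈-─ ys i (into y (there y∈))
      (λ ky≡kx → All.lookup x∉xs y∈ (sym (inj y x (there y∈) (here refl) ky≡kx))))
    (λ y z y∈ z∈ → inj y z (there y∈) (there z∈))))
  where i = into x (here refl)

-- Chebyshev estimates

oneTo : ℕ → List ℕ
oneTo = applyDownFrom suc

∈-oneTo⁺ : ∀ {n i} → 1 ≤ i → i ≤ n → i ∈ oneTo n
∈-oneTo⁺ {i = suc i} _ i<n = ∈-applyDownFrom⁺ suc i<n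

∈-oneTo⁻ : ∀ {n i} → i ∈ oneTo n → 1 ≤ i × i ≤ n
∈-oneTo⁻ i∈ with ∈-applyDownFrom⁻ suc i∈
... | _ , j<n , refl = s≤s z≤n , j<n

oneTo-unique : ∀ n → Unique (oneTo n)
oneTo-unique n = Unique.applyDownFrom⁺₁ suc n (λ j<i _ eq → <⇒≢ j<i (sym (suc-injective eq)))

length-oneTo : ∀ n → length (oneTo n) ≡ n
length-oneTo = length-applyDownFrom suc

prime≥2 : ∀ {p} → Prime p → 2 ≤ p
prime≥2 p-prime = nonTrivial⇒n>1 _ {{prime⇒nonTrivial p-prime}}

prime-∣-prime : ∀ {p q} → Prime p → Prime q → p ∣ q → p ≡ q
prime-∣-prime p-prime q-prime p∣q with prime⇒irreducible q-prime p∣q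
... | inj₁ refl = contradiction p-prime ¬prime[1]
... | inj₂ p≡q  = p≡q

-- Divide `x` by the first prime. Any later prime still divides the quotient, since by Euclid's
-- lemma it would otherwise equal the first one.
product-primes-∣ : ∀ {xs x} → Unique xs → All Prime xs → All (_∣ x) xs → product xs ∣ x
product-primes-∣ {x = x} [] [] [] = 1∣ x
product-primes-∣ {p ∷ xs} {x} (p∉xs ∷ uniq) (p-prime ∷ primes) (divides q refl ∷ ∣x) =
  subst (p * product xs ∣_) (*-comm p q)
    (*-monoʳ-∣ p (product-primes-∣ uniq primes (All.tabulate step)))
  where
  step : ∀ {r} → r ∈ xs → r ∣ q
  step {r} r∈ with euclidsLemma q p (All.lookup primes r∈) (All.lookup ∣x r∈)
  ... | inj₁ r∣q = r∣q
  ... | inj₂ r∣p = contradiction (sym (prime-∣-prime (All.lookup primes r∈) p-prime r∣p))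
                                 (All.lookup p∉xs r∈)

prime-∣! : ∀ {p} m → Prime p → p ∣ m ! → p ≤ m
prime-∣! zero    p-prime p∣ = contradiction (∣1⇒≡1 p∣) (λ { refl → ¬prime[1] p-prime })
prime-∣! (suc m) p-prime p∣ with euclidsLemma (suc m) (m !) p-prime p∣
... | inj₁ p∣m+1 = ∣⇒≤ p∣m+1
... | inj₂ p∣m!  = m≤n⇒m≤1+n (prime-∣! m p-prime p∣m!)

binomial≤2^n : ∀ n k → n choose k ≤ 2 ^ n
binomial≤2^n n       zero    = subst (_≤ 2 ^ n) (sym (nCk≡1 n)) (m^n>0 2 n)
  where
  nCk≡1 : ∀ n → n choose 0 ≡ 1
  nCk≡1 n = trans (nCk≡nC[n∸k] {0} {n} z≤n) (nCn≡1 n)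
binomial≤2^n zero    (suc k) = subst (_≤ 1) (sym (k>n⇒nCk≡0 {0} {suc k} (s≤s z≤n))) z≤n
binomial≤2^n (suc n) (suc k) = begin
  suc n choose suc k  ≡⟨ nCk+nC[k+1]≡[n+1]C[k+1] n k ⟨
  n choose k + n choose (suc k) ≤⟨ +-mono-≤ (binomial≤2^n n k) (binomial≤2^n n (suc k)) ⟩
  2 ^ n + 2 ^ n  ≡⟨ cong (2 ^ n +_) (+-identityʳ (2 ^ n)) ⟨
  2 ^ suc n  ∎
  where open ≤-Reasoning

central-binomial : ∀ m → ((m + m) choose m) * (m ! * m !) ≡ (m + m) !
central-binomial m = begin
  ((m + m) choose m) * (m ! * m !)  ≡⟨ cong (λ k → ((m + m) choose m) * (m ! * k !)) (m+n∸m≡n m m) ⟨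
  ((m + m) choose m) * (m ! * (m + m ∸ m) !)  ≡⟨ cong (_* (m ! * (m + m ∸ m) !)) (nCk≡n!/k![n-k]! m≤2m) ⟩
  ((m + m) ! / (m ! * (m + m ∸ m) !)) * (m ! * (m + m ∸ m) !)
                                         ≡⟨ m/n*n≡m (k![n∸k]!∣n! m≤2m) ⟩
  (m + m) !  ∎
  where
  open ≡-Reasoning
  m≤2m = m≤m+n m m
  instance _ = m !* (m + m ∸ m) !≢0

suc≤2^ : ∀ n → suc n ≤ 2 ^ n
suc≤2^ zero    = ≤-refl
suc≤2^ (suc n) = subst (suc (suc n) ≤_) (cong (2 ^ n +_) (sym (+-identityʳ (2 ^ n))))
  (+-mono-≤ (m^n>0 2 n) (suc≤2^ n))

^-swap : ∀ a m n → (a ^ m) ^ n ≡ (a ^ n) ^ m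
^-swap a m n = trans (^-*-assoc a m n) (trans (cong (a ^_) (*-comm m n)) (sym (^-*-assoc a n m)))

-- Composite arguments give 1, so that a product over a full interval runs effectively over its
-- primes.
prime^ : ℕ → ℕ
prime^ p = p ^ ι (prime? p)

prime^≥1 : ∀ p → 1 ≤ p → 1 ≤ prime^ p
prime^≥1 (suc p) _ = m^n>0 (suc p) (ι (prime? (suc p)))

prime^≢0 : ∀ {n p} → p ∈ oneTo n → NonZero (prime^ p)
prime^≢0 {p = p} i = >-nonZero (prime^≥1 p (proj₁ (∈-oneTo⁻ i)))

-- The primorial, the exponential of Chebyshev's function ϑ.
θ : ℕ → ℕ
θ n = ∏ (oneTo n) prime^

half : ∀ n → ∃[ m ] (n ≡ m + m ⊎ n ≡ suc (m + m))
half zero = 0 , inj₁ refl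
half (suc n) with half n
... | m , inj₁ refl = m , inj₂ refl
... | m , inj₂ refl = suc m , inj₁ (cong suc (sym (+-suc m m)))

private
  interval : ℕ → ℕ → List ℕ
  interval m = applyDownFrom (λ i → m + suc i)

  θ-+ : ∀ m k → θ (m + k) ≡ ∏ (interval m k) prime^ * θ m
  θ-+ m zero    rewrite +-identityʳ m = sym (*-identityˡ (θ m))
  θ-+ m (suc k) rewrite +-suc m k | θ-+ m k = sym (*-assoc (prime^ (suc (m + k))) _ _)

  -- A prime in (m, 2m] divides (2m)! but not m!, whose prime factors are at most m; so it must
  -- divide the remaining factor, the binomial coefficient.
  interval-∣-binomial : ∀ m → ∏ (interval m m) prime^ ∣ (m + m) choose m
  interval-∣-binomial m = subst (_∣ (m + m) choose m) eq
    (product-primes-∣ (Unique.filter⁺ prime? uniq) (All.tabulate primes) (All.tabulate divs))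
    where
    xs = interval m m
    uniq : Unique xs
    uniq = Unique.applyDownFrom⁺₁ _ m (λ j<i _ eq → <⇒≢ j<i (sym (suc-injective (+-cancelˡ-≡ m _ _ eq))))
    eq : product (filter prime? xs) ≡ ∏ xs prime^
    eq = trans (cong product (sym (map-id (filter prime? xs)))) (∏-filter prime? xs id)
    primes : ∀ {p} → p ∈ filter prime? xs → Prime p
    primes p∈ = proj₂ (∈-filter⁻ prime? {xs = xs} p∈)
    divs : ∀ {p} → p ∈ filter prime? xs → p ∣ (m + m) choose m
    divs {p} p∈ with ∈-filter⁻ prime? {xs = xs} p∈
    ... | p∈xs , p-prime with ∈-applyDownFrom⁻ (λ i → m + suc i) {n = m} p∈xs
    ... | i , i<m , refl with euclidsLemma ((m + m) choose m) (m ! * m !) p-prime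
                           (subst (p ∣_) (sym (central-binomial m)) p∣[2m]!)
      where
      p∣[2m]! : m + suc i ∣ (m + m) !
      p∣[2m]! = ∣-trans (subst (λ k → m + suc i ∣ k !) (sym (+-suc m i))
                          (subst (_∣ suc (m + i) !) (sym (+-suc m i)) (m∣m*n ((m + i) !))))
                        (m≤n⇒m!∣n! (+-monoʳ-≤ m i<m))
    ... | inj₁ p∣C = p∣C
    ... | inj₂ p∣m!m! = ⊥-elim (m+1+n≰m m (case (euclidsLemma (m !) (m !) p-prime p∣m!m!)))
      where
      case : _ ⊎ _ → m + suc i ≤ m
      case (inj₁ d) = prime-∣! m p-prime d
      case (inj₂ d) = prime-∣! m p-prime d

  θ-double : ∀ m → θ m ≤ 16 ^ m → θ (m + m) ≤ 16 ^ m * 2 ^ (m + m)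
  θ-double m ih = begin
    θ (m + m)  ≡⟨ θ-+ m m ⟩
    ∏ (interval m m) prime^ * θ m  ≤⟨ *-mono-≤ (∣⇒≤ {{binomial≢0}} (interval-∣-binomial m)) ih ⟩
    ((m + m) choose m) * 16 ^ m  ≡⟨ *-comm _ (16 ^ m) ⟩
    16 ^ m * ((m + m) choose m)  ≤⟨ *-monoʳ-≤ (16 ^ m) (binomial≤2^n (m + m) m) ⟩
    16 ^ m * 2 ^ (m + m)  ∎
    where
    open ≤-Reasoning
    binomial≢0 : NonZero ((m + m) choose m)
    binomial≢0 = ≢-nonZero λ C≡0 → ≢-nonZero⁻¹ _ {{(m + m) !≢0}}
      (trans (sym (central-binomial m)) (cong (_* (m ! * m !)) C≡0))

  2^[m+m]≡4^m : ∀ m → 2 ^ (m + m) ≡ 4 ^ m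
  2^[m+m]≡4^m m = trans (^-distribˡ-+-* 2 m m) (sym (^-distribʳ-* m 2 2))

  16^m*4^m*4^m : ∀ m → 16 ^ m * 4 ^ m * 4 ^ m ≡ 16 ^ (m + m)
  16^m*4^m*4^m m = trans (*-assoc (16 ^ m) _ _)
    (trans (cong (16 ^ m *_) (sym (^-distribʳ-* m 4 4))) (sym (^-distribˡ-+-* 16 m m)))

  -- Strong induction with fuel `k`. Doubling the argument costs only `4 ^ m` out of the available
  -- `16 ^ m`; the other `4 ^ m` pays for the single number 2m + 1 when the argument is odd.
  θ≤16^-aux : ∀ k n → n ≤ k → θ n ≤ 16 ^ n
  θ≤16^-aux k zero n≤k = ≤-refl
  θ≤16^-aux (suc k) (suc n) (s≤s n≤k) with half n
  ... | m , inj₁ refl = begin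
    prime^ (suc (m + m)) * θ (m + m) ≤⟨ *-mono-≤ prime^≤ (θ-double m (θ≤16^-aux k m (≤-trans (m≤m+n m m) n≤k))) ⟩
    2 ^ (m + m) * (16 ^ m * 2 ^ (m + m)) ≡⟨ cong (λ z → z * (16 ^ m * z)) (2^[m+m]≡4^m m) ⟩
    4 ^ m * (16 ^ m * 4 ^ m)  ≡⟨ *-comm (4 ^ m) _ ⟩
    16 ^ m * 4 ^ m * 4 ^ m  ≡⟨ 16^m*4^m*4^m m ⟩
    16 ^ (m + m)  ≤⟨ m≤m+n _ _ ⟩
    16 ^ suc (m + m)  ∎
    where
    open ≤-Reasoning
    prime^≤ : prime^ (suc (m + m)) ≤ 2 ^ (m + m)
    prime^≤ with prime? (suc (m + m))
    ... | yes _ = subst (_≤ 2 ^ (m + m)) (sym (*-identityʳ (suc (m + m)))) (suc≤2^ (m + m))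
    ... | no  _ = m^n>0 2 (m + m)
  ... | m , inj₂ refl = subst (λ z → θ z ≤ 16 ^ z) (cong suc (+-suc m m)) (begin
    θ (suc m + suc m)  ≤⟨ θ-double (suc m) (θ≤16^-aux k (suc m) (≤-trans (s≤s (m≤m+n m m)) n≤k)) ⟩
    16 ^ suc m * 2 ^ (suc m + suc m) ≡⟨ cong (16 ^ suc m *_) (2^[m+m]≡4^m (suc m)) ⟩
    16 ^ suc m * 4 ^ suc m  ≤⟨ m≤m*n _ (4 ^ suc m) {{m^n≢0 4 (suc m)}} ⟩
    16 ^ suc m * 4 ^ suc m * 4 ^ suc m ≡⟨ 16^m*4^m*4^m (suc m) ⟩
    16 ^ (suc m + suc m)  ∎)
    where open ≤-Reasoning

θ≤16^ : ∀ n → θ n ≤ 16 ^ n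
θ≤16^ n = θ≤16^-aux n n ≤-refl

-- Abel summation: an antitone exponent turns the bound on θ into a bound on the weighted product.
∏-antitone : ∀ (a : ℕ → ℕ) → (∀ m → a (2 + m) ≤ a (1 + m)) → ∀ M →
             ∏ (oneTo M) (λ p → prime^ p ^ a p) ≤ 16 ^ ∑ (oneTo M) a
∏-antitone a anti zero = ≤-refl
∏-antitone a anti (suc M) = subst₂ _≤_ lhs rhs (abel M 0 z≤n)
  where
  P : ℕ → ℕ
  P M = ∏ (oneTo M) (λ p → prime^ p ^ a p)
  S : ℕ → ℕ
  S M = ∑ (oneTo M) a
  lhs : P (suc M) * 16 ^ (suc M * 0) ≡ P (suc M)
  lhs = trans (cong (λ z → P (suc M) * 16 ^ z) (*-zeroʳ M)) (*-identityʳ _)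
  rhs : 16 ^ S (suc M) * θ (suc M) ^ 0 ≡ 16 ^ S (suc M)
  rhs = *-identityʳ _
  open ≤-Reasoning
  rearrange : ∀ a b c d e → a * b * (c * d * e) ≡ a * (b * c) * (d * e)
  rearrange = solve-∀
  -- Divided by `θ (suc M) ^ b`, this is the claim for the reduced exponents a(p) - b, which are
  -- nonnegative because `a` is antitone. The claim itself is the case b = 0.
  abel : ∀ M b → b ≤ a (suc M) → P (suc M) * 16 ^ (suc M * b) ≤ 16 ^ S (suc M) * θ (suc M) ^ b
  prev : ∀ M b → b ≤ a (suc M) → P M * 16 ^ (M * b) ≤ 16 ^ S M * θ M ^ b
  prev zero    b b≤ = subst (1 ≤_) (sym (trans (*-identityˡ _) (^-zeroˡ b))) ≤-refl
  prev (suc M) b b≤ = abel M b (≤-trans b≤ (anti M))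
  abel M b b≤ with a (suc M) in eq | m≤n⇒∃[o]m+o≡n b≤
  ... | _ | c , refl = *-cancelʳ-≤ _ _ (16 ^ (suc M * c)) {{m^n≢0 16 (suc M * c)}} (begin
    q ^ (b + c) * P M * 16 ^ (suc M * b) * 16 ^ (suc M * c)
      ≡⟨ trans (*-assoc (q ^ (b + c) * P M) _ _) (cong (q ^ (b + c) * P M *_)
           (trans (sym (^-distribˡ-+-* 16 (suc M * b) (suc M * c)))
             (cong (16 ^_) (trans (sym (*-distribˡ-+ (suc M) b c)) refl)))) ⟩
    q ^ (b + c) * P M * 16 ^ ((b + c) + M * (b + c))
      ≡⟨ cong (q ^ (b + c) * P M *_) (^-distribˡ-+-* 16 (b + c) (M * (b + c))) ⟩
    q ^ (b + c) * P M * (16 ^ (b + c) * 16 ^ (M * (b + c)))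
      ≡⟨ shuffle (q ^ (b + c)) (P M) (16 ^ (b + c)) (16 ^ (M * (b + c))) ⟩
    16 ^ (b + c) * q ^ (b + c) * (P M * 16 ^ (M * (b + c)))
      ≤⟨ *-monoʳ-≤ (16 ^ (b + c) * q ^ (b + c)) (prev M (b + c) (≤-reflexive (sym eq))) ⟩
    16 ^ (b + c) * q ^ (b + c) * (16 ^ S M * θ M ^ (b + c))
      ≡⟨ shuffle′ (16 ^ (b + c)) (q ^ (b + c)) (16 ^ S M) (θ M ^ (b + c)) ⟩
    16 ^ (b + c) * 16 ^ S M * (q ^ (b + c) * θ M ^ (b + c))
      ≡⟨ cong₂ _*_ (sym (^-distribˡ-+-* 16 (b + c) (S M))) (sym (^-distribʳ-* (b + c) q (θ M))) ⟩
    16 ^ (b + c + S M) * θ (suc M) ^ (b + c)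
      ≡⟨ cong (16 ^ (b + c + S M) *_) (^-distribˡ-+-* (θ (suc M)) b c) ⟩
    16 ^ (b + c + S M) * (θ (suc M) ^ b * θ (suc M) ^ c)
      ≤⟨ *-monoʳ-≤ (16 ^ (b + c + S M)) (*-monoʳ-≤ (θ (suc M) ^ b)
           (≤-trans (^-monoˡ-≤ c (θ≤16^ (suc M))) (≤-reflexive (^-*-assoc 16 (suc M) c)))) ⟩
    16 ^ (b + c + S M) * (θ (suc M) ^ b * 16 ^ (suc M * c))
      ≡⟨ *-assoc (16 ^ (b + c + S M)) _ _ ⟨
    16 ^ (b + c + S M) * θ (suc M) ^ b * 16 ^ (suc M * c) ∎)
    where
    q = prime^ (suc M)
    shuffle : ∀ x y z w → x * y * (z * w) ≡ z * x * (y * w)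
    shuffle = solve-∀
    shuffle′ : ∀ x y z w → x * y * (z * w) ≡ x * z * (y * w)
    shuffle′ = solve-∀

-- Truncated division and convergent sums

infixl 7 _÷_

-- The default 0 for the divisor 0 lets `÷-÷` hold for all divisors and keeps side conditions out of
-- exponents.
_÷_ : ℕ → ℕ → ℕ
a ÷ zero  = 0
a ÷ suc b = a / suc b

÷-*-≤ : ∀ a b → (a ÷ b) * b ≤ a
÷-*-≤ a zero    = z≤n
÷-*-≤ a (suc b) = m/n*n≤m a (suc b)

<-suc÷-* : ∀ a b → 1 ≤ b → a < suc (a ÷ b) * b
<-suc÷-* a (suc b) _ = begin-strict
  a  ≡⟨ m≡m%n+[m/n]*n a (suc b) ⟩
  a % suc b + (a / suc b) * suc b  <⟨ +-monoˡ-< _ (m%n<n a (suc b)) ⟩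
  suc b + (a / suc b) * suc b  ∎
  where open ≤-Reasoning

÷-÷ : ∀ a b c → a ÷ b ÷ c ≡ a ÷ (b * c)
÷-÷ a zero    zero    = refl
÷-÷ a zero    (suc c) = 0/n≡0 (suc c)
÷-÷ a (suc b) zero    rewrite *-zeroʳ b = refl
÷-÷ a (suc b) (suc c) = m/n/o≡m/[n*o] a (suc b) (suc c)

÷-monoˡ : ∀ {a b} c → a ≤ b → a ÷ c ≤ b ÷ c
÷-monoˡ zero    a≤b = z≤n
÷-monoˡ (suc c) a≤b = /-monoˡ-≤ (suc c) a≤b

÷-anti : ∀ a {b c} → 1 ≤ b → b ≤ c → a ÷ c ≤ a ÷ b
÷-anti a {suc b} {suc c} _ b≤c = /-monoʳ-≤ a b≤c

÷-twice : ∀ a b → 2 ≤ b → a ÷ b + a ÷ b ≤ a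
÷-twice a b 2≤b = begin
  a ÷ b + a ÷ b  ≡⟨ cong (a ÷ b +_) (+-identityʳ _) ⟨
  2 * (a ÷ b)  ≤⟨ *-monoˡ-≤ (a ÷ b) 2≤b ⟩
  b * (a ÷ b)  ≡⟨ *-comm b _ ⟩
  a ÷ b * b  ≤⟨ ÷-*-≤ a b ⟩
  a  ∎
  where open ≤-Reasoning

∑-oneTo-suc : ∀ L (g : ℕ → ℕ) → ∑ (oneTo (suc L)) g ≡ g 1 + ∑ (oneTo L) (g ∘ suc)
∑-oneTo-suc zero    g = refl
∑-oneTo-suc (suc L) g rewrite ∑-oneTo-suc L g = lemma (g (suc (suc L))) (g 1) _
  where
  lemma : ∀ a b c → a + (b + c) ≡ b + (a + c)
  lemma = solve-∀

∑-geometric : ∀ L U p → 2 ≤ p → ∑ (oneTo L) (λ l → U ÷ p ^ l) ≤ U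
∑-geometric zero    U p 2≤p = z≤n
∑-geometric (suc L) U p 2≤p = begin
  ∑ (oneTo (suc L)) (λ l → U ÷ p ^ l)  ≡⟨ ∑-oneTo-suc L _ ⟩
  U ÷ (p * 1) + ∑ (oneTo L) (λ l → U ÷ (p * p ^ l))
    ≡⟨ cong₂ _+_ (cong (U ÷_) (*-identityʳ p)) (∑-cong (oneTo L) (λ l _ → sym (÷-÷ U p (p ^ l)))) ⟩
  U ÷ p + ∑ (oneTo L) (λ l → U ÷ p ÷ p ^ l)  ≤⟨ +-monoʳ-≤ (U ÷ p) (∑-geometric L (U ÷ p) p 2≤p) ⟩
  U ÷ p + U ÷ p  ≤⟨ ÷-twice U p 2≤p ⟩
  U  ∎
  where open ≤-Reasoning

∑-geometric-from-2 : ∀ L U p → 2 ≤ p → ∑ (oneTo L) (λ l → U ÷ p ^ suc l) ≤ 2 * (U ÷ (p * p))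
∑-geometric-from-2 zero    U p 2≤p = z≤n
∑-geometric-from-2 (suc L) U p 2≤p = begin
  ∑ (oneTo (suc L)) (λ l → U ÷ p ^ suc l)
    ≡⟨ ∑-oneTo-suc L _ ⟩
  U ÷ (p * (p * 1)) + ∑ (oneTo L) (λ l → U ÷ (p * (p * p ^ l)))
    ≡⟨ cong₂ _+_ (cong (λ z → U ÷ (p * z)) (*-identityʳ p))
         (∑-cong (oneTo L) (λ l _ → trans (cong (U ÷_) (sym (*-assoc p p (p ^ l)))) (sym (÷-÷ U (p * p) (p ^ l))))) ⟩
  U ÷ (p * p) + ∑ (oneTo L) (λ l → U ÷ (p * p) ÷ p ^ l)
    ≤⟨ +-monoʳ-≤ (U ÷ (p * p)) (∑-geometric L (U ÷ (p * p)) p 2≤p) ⟩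
  U ÷ (p * p) + U ÷ (p * p)
    ≡⟨ cong (U ÷ (p * p) +_) (sym (+-identityʳ _)) ⟩
  2 * (U ÷ (p * p)) ∎
  where open ≤-Reasoning

∑-inverse-squares : ∀ M U → ∑ (oneTo M) (λ m → U ÷ (m * m)) ≤ 2 * U
∑-inverse-squares zero    U = z≤n
∑-inverse-squares (suc M) U = *-cancelʳ-≤ _ _ (suc M) (≤-trans (m≤m+n _ U) (sharp M))
  where
  open ≤-Reasoning
  S : ℕ → ℕ
  S M = ∑ (oneTo M) (λ m → U ÷ (m * m))
  -- The induction needs the stronger bound 2U - U/m for the sum up to m. It telescopes, since 1/(m
  -- + 1)² ≤ 1/m - 1/(m + 1).
  sharp : ∀ M → S (suc M) * suc M + U ≤ 2 * U * suc M
  sharp zero = ≤-reflexive (trans (cong (λ z → (z + 0) * 1 + U) (n/1≡n U)) (lemma U))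
    where
    lemma : ∀ U → (U + 0) * 1 + U ≡ 2 * U * 1
    lemma = solve-∀
  sharp (suc M) = *-cancelʳ-≤ _ _ m (begin
    ((q + S m) * suc m + U) * m  ≡⟨ expand q (S m) m U ⟩
    S m * m * suc m + U * m + q * (m * suc m)  ≤⟨ +-monoʳ-≤ _ (≤-trans (*-monoʳ-≤ q (*-monoˡ-≤ (suc m) (n≤1+n m))) (÷-*-≤ U (suc m * suc m))) ⟩
    S m * m * suc m + U * m + U  ≡⟨ collect (S m) m U ⟩
    (S m * m + U) * suc m  ≤⟨ *-monoˡ-≤ (suc m) (sharp M) ⟩
    2 * U * m * suc m  ≡⟨ swap U m ⟩
    2 * U * suc m * m  ∎)
    where
    m = suc M
    q = U ÷ (suc m * suc m)
    expand : ∀ q s m U → ((q + s) * suc m + U) * m ≡ s * m * suc m + U * m + q * (m * suc m)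
    expand = solve-∀
    collect : ∀ s m U → s * m * suc m + U * m + U ≡ (s * m + U) * suc m
    collect = solve-∀
    swap : ∀ U m → 2 * U * m * suc m ≡ 2 * U * suc m * m
    swap = solve-∀

∏-prime-squares : ∀ M U → ∏ (oneTo M) (λ p → prime^ p ^ (U ÷ (p * p))) ≤ 16 ^ (2 * U)
∏-prime-squares M U = ≤-trans
  (∏-antitone (λ m → U ÷ (m * m)) (λ m → ÷-anti U (s≤s z≤n) (*-mono-≤ (n≤1+n (suc m)) (n≤1+n (suc m)))) M)
  (^-monoʳ-≤ 16 (∑-inverse-squares M U))

-- Each of the n factors of (2n)! / n! is at least n, and the central binomial coefficient is at
-- most 4^n. This is the substitute for Stirling's formula.
n^n≤4^n*n! : ∀ n → n ^ n ≤ 4 ^ n * n !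
n^n≤4^n*n! n = *-cancelʳ-≤ _ _ (n !) {{n !≢0}} (begin
  n ^ n * n !  ≤⟨ rising n ⟩
  (n + n) !  ≡⟨ central-binomial n ⟨
  ((n + n) choose n) * (n ! * n !)  ≤⟨ *-monoˡ-≤ (n ! * n !) (binomial≤2^n (n + n) n) ⟩
  2 ^ (n + n) * (n ! * n !)  ≡⟨ cong (_* (n ! * n !)) (trans (^-distribˡ-+-* 2 n n) (sym (^-distribʳ-* n 2 2))) ⟩
  4 ^ n * (n ! * n !)  ≡⟨ *-assoc (4 ^ n) _ _ ⟨
  4 ^ n * n ! * n !  ∎)
  where
  open ≤-Reasoning
  rising : ∀ k → n ^ k * n ! ≤ (n + k) !
  rising zero    = ≤-reflexive (trans (*-identityˡ (n !)) (cong _! (sym (+-identityʳ n))))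
  rising (suc k) = begin
    n * n ^ k * n !  ≡⟨ *-assoc n _ _ ⟩
    n * (n ^ k * n !)  ≤⟨ *-mono-≤ (≤-trans (m≤m+n n k) (n≤1+n _)) (rising k) ⟩
    suc (n + k) * (n + k) !  ≡⟨ cong _! (sym (+-suc n k)) ⟩
    (n + suc k) !  ∎

floor-sqrt : ∀ n → ∃[ s ] (s * s ≤ n × n < suc s * suc s)
floor-sqrt zero = 0 , z≤n , s≤s z≤n
floor-sqrt (suc n) with floor-sqrt n
... | s , s²≤n , n<[s+1]² with suc n ≟ suc s * suc s
... | yes n+1≡ = suc s , ≤-reflexive (sym n+1≡) , subst (_< suc (suc s) * suc (suc s)) (sym n+1≡)
                   (*-mono-< (n<1+n (suc s)) (n<1+n (suc s)))
... | no  n+1≢ = s , m≤n⇒m≤1+n s²≤n , ≤∧≢⇒< n<[s+1]² n+1≢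

∑-ι-≤ : ∀ s Y → ∑ (oneTo Y) (λ p → ι (p ≤? s)) ≤ s
∑-ι-≤ s Y = subst₂ _≤_ (length-filter≡∑ (_≤? s) (oneTo Y)) (length-oneTo s)
  (pigeonhole (filter (_≤? s) (oneTo Y)) (oneTo s) id (Unique.filter⁺ (_≤? s) (oneTo-unique Y))
    (λ p p∈ → let p∈oneTo , p≤s = ∈-filter⁻ (_≤? s) {xs = oneTo Y} p∈ in ∈-oneTo⁺ (proj₁ (∈-oneTo⁻ p∈oneTo)) p≤s)
    (λ x y _ _ eq → eq))

π : ℕ → ℕ
π Y = ∑ (oneTo Y) (ι ∘ prime?)

-- Let s be the integer part of √Y. A prime above s satisfies Y ≤ p², so these primes cost at most
-- θ(Y)² ≤ 256^Y. At most s indices are left, and each costs Y ≤ 4^s, in total 4^(s²) ≤ 4^Y.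
Y^π≤1024^Y : ∀ Y → Y ^ π Y ≤ 1024 ^ Y
Y^π≤1024^Y Y with floor-sqrt Y
... | s , s²≤Y , Y<[s+1]² = begin
  Y ^ π Y  ≡⟨ ^-∑ (oneTo Y) Y (ι ∘ prime?) ⟩
  ∏ (oneTo Y) (λ p → Y ^ ι (prime? p))  ≤⟨ ∏-mono (oneTo Y) factor ⟩
  ∏ (oneTo Y) (λ p → prime^ p ^ 2 * (4 ^ s) ^ ι (p ≤? s))
    ≡⟨ ∏-* (oneTo Y) _ _ ⟩
  ∏ (oneTo Y) (λ p → prime^ p ^ 2) * ∏ (oneTo Y) (λ p → (4 ^ s) ^ ι (p ≤? s))
    ≡⟨ cong₂ _*_ (∏-^ (oneTo Y) prime^ 2) (sym (^-∑ (oneTo Y) (4 ^ s) _)) ⟩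
  θ Y ^ 2 * (4 ^ s) ^ ∑ (oneTo Y) (λ p → ι (p ≤? s))
    ≤⟨ *-mono-≤ (^-monoˡ-≤ 2 (θ≤16^ Y)) (^-monoʳ-≤ (4 ^ s) {{m^n≢0 4 s}} (∑-ι-≤ s Y)) ⟩
  (16 ^ Y) ^ 2 * (4 ^ s) ^ s  ≡⟨ cong₂ _*_ (^-swap 16 Y 2) (^-*-assoc 4 s s) ⟩
  256 ^ Y * 4 ^ (s * s)  ≤⟨ *-monoʳ-≤ (256 ^ Y) (^-monoʳ-≤ 4 s²≤Y) ⟩
  256 ^ Y * 4 ^ Y  ≡⟨ ^-distribʳ-* Y 256 4 ⟨
  1024 ^ Y  ∎
  where
  open ≤-Reasoning
  Y≤4^s : Y ≤ 4 ^ s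
  Y≤4^s = ≤-trans (<⇒≤ Y<[s+1]²) (≤-trans (*-mono-≤ (suc≤2^ s) (suc≤2^ s)) (≤-reflexive (sym (^-distribʳ-* s 2 2))))
  factor : ∀ p → p ∈ oneTo Y → Y ^ ι (prime? p) ≤ prime^ p ^ 2 * (4 ^ s) ^ ι (p ≤? s)
  factor p p∈ with prime? p | p ≤? s
  ... | no _  | p≤?s = *-mono-≤ (≤-reflexive (sym (^-zeroˡ 2))) (m^n>0 (4 ^ s) {{m^n≢0 4 s}} (ι p≤?s))
  ... | yes _ | yes p≤s = ≤-trans (≤-reflexive (^-identityʳ Y)) (≤-trans Y≤4^s
          (≤-trans (≤-reflexive (sym (^-identityʳ (4 ^ s))))
            (m≤n*m ((4 ^ s) ^ 1) ((p ^ 1) ^ 2) {{m^n≢0 (p ^ 1) 2 {{m^n≢0 p 1 {{>-nonZero (proj₁ (∈-oneTo⁻ p∈))}}}}}})))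
  ... | yes _ | no p≰s = begin
          Y ^ 1  ≡⟨ ^-identityʳ Y ⟩
          Y  ≤⟨ <⇒≤ Y<[s+1]² ⟩
          suc s * suc s  ≤⟨ *-mono-≤ (≰⇒> p≰s) (≰⇒> p≰s) ⟩
          p * p  ≡⟨ lemma p ⟩
          (p ^ 1) ^ 2 * 1  ∎
    where
    lemma : ∀ p → p * p ≡ p * 1 * (p * 1 * 1) * 1
    lemma = solve-∀

-- Integer polynomials

infix 4 _∣ℤ_

_∣ℤ_ : ℤ → ℤ → Set
_∣ℤ_ = ℤ∣._∣_

0ℤ : ℤ
0ℤ = pos 0

zeros : Poly → Poly
zeros = map (const 0ℤ)

eval-zeros : ∀ cs t → eval (zeros cs) t ≡ 0ℤ
eval-zeros []       t = refl
eval-zeros (c ∷ cs) t rewrite eval-zeros cs t = trans (ℤ.+-identityˡ _) (ℤ.*-zeroʳ t)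

snoc : Poly → ℤ → Poly
snoc cs l = cs ++ l ∷ []

addP : Poly → Poly → Poly
addP []      q       = q
addP (a ∷ p) []      = a ∷ p
addP (a ∷ p) (b ∷ q) = a ℤ.+ b ∷ addP p q

scaleP : ℤ → Poly → Poly
scaleP c = map (c ℤ.*_)

mulP : Poly → Poly → Poly
mulP []      q = []
mulP (a ∷ p) q = addP (scaleP a q) (0ℤ ∷ mulP p q)

eval-addP : ∀ p q t → eval (addP p q) t ≡ eval p t ℤ.+ eval q t
eval-addP []      q       t = sym (ℤ.+-identityˡ _)
eval-addP (a ∷ p) []      t = sym (ℤ.+-identityʳ _)
eval-addP (a ∷ p) (b ∷ q) t rewrite eval-addP p q t = lemma a b t (eval p t) (eval q t)
  where
  lemma : ∀ a b t x y → a ℤ.+ b ℤ.+ t ℤ.* (x ℤ.+ y) ≡ a ℤ.+ t ℤ.* x ℤ.+ (b ℤ.+ t ℤ.* y)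
  lemma = ℤ-solve-∀

eval-scaleP : ∀ c p t → eval (scaleP c p) t ≡ c ℤ.* eval p t
eval-scaleP c []      t = sym (ℤ.*-zeroʳ c)
eval-scaleP c (a ∷ p) t rewrite eval-scaleP c p t = lemma c a t (eval p t)
  where
  lemma : ∀ c a t x → c ℤ.* a ℤ.+ t ℤ.* (c ℤ.* x) ≡ c ℤ.* (a ℤ.+ t ℤ.* x)
  lemma = ℤ-solve-∀

eval-mulP : ∀ p q t → eval (mulP p q) t ≡ eval p t ℤ.* eval q t
eval-mulP []      q t = sym (ℤ.*-zeroˡ (eval q t))
eval-mulP (a ∷ p) q t
  rewrite eval-addP (scaleP a q) (0ℤ ∷ mulP p q) t | eval-scaleP a q t | eval-mulP p q t
  = lemma a t (eval p t) (eval q t)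
  where
  lemma : ∀ a t x y → a ℤ.* y ℤ.+ (0ℤ ℤ.+ t ℤ.* (x ℤ.* y)) ≡ (a ℤ.+ t ℤ.* x) ℤ.* y
  lemma = ℤ-solve-∀

eval-snoc : ∀ cs l t → eval (snoc cs l) t ≡ eval cs t ℤ.+ t ℤ.^ length cs ℤ.* l
eval-snoc []       l t = lemma l t
  where
  lemma : ∀ l t → l ℤ.+ t ℤ.* 0ℤ ≡ 0ℤ ℤ.+ pos 1 ℤ.* l
  lemma = ℤ-solve-∀
eval-snoc (c ∷ cs) l t rewrite eval-snoc cs l t = lemma c t (eval cs t) (t ℤ.^ length cs) l
  where
  lemma : ∀ c t x y l → c ℤ.+ t ℤ.* (x ℤ.+ y ℤ.* l) ≡ c ℤ.+ t ℤ.* x ℤ.+ t ℤ.* y ℤ.* l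
  lemma = ℤ-solve-∀

coeff-addP : ∀ p q n → coeff (addP p q) n ≡ coeff p n ℤ.+ coeff q n
coeff-addP []      q       n       = sym (ℤ.+-identityˡ _)
coeff-addP (a ∷ p) []      n       = sym (ℤ.+-identityʳ _)
coeff-addP (a ∷ p) (b ∷ q) zero    = refl
coeff-addP (a ∷ p) (b ∷ q) (suc n) = coeff-addP p q n

coeff-scaleP : ∀ c p n → coeff (scaleP c p) n ≡ c ℤ.* coeff p n
coeff-scaleP c []      n       = sym (ℤ.*-zeroʳ c)
coeff-scaleP c (a ∷ p) zero    = refl
coeff-scaleP c (a ∷ p) (suc n) = coeff-scaleP c p n

coeff-snoc : ∀ cs l → coeff (snoc cs l) (length cs) ≡ l
coeff-snoc []       l = refl
coeff-snoc (c ∷ cs) l = coeff-snoc cs l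

coeff-≥length : ∀ p {n} → length p ≤ n → coeff p n ≡ 0ℤ
coeff-≥length []      le       = refl
coeff-≥length (a ∷ p) (s≤s le) = coeff-≥length p le

length-snoc : ∀ (cs : Poly) l → length (snoc cs l) ≡ suc (length cs)
length-snoc []       l = refl
length-snoc (c ∷ cs) l = cong suc (length-snoc cs l)

coeff-mulP : ∀ p q n → coeff (mulP p q) n ≡ mulCoeff p q n
coeff-mulP [] q n = sym (all-zero (upTo (suc n)))
  where
  all-zero : ∀ xs → sumℤ (map (λ i → 0ℤ ℤ.* coeff q (n ∸ i)) xs) ≡ 0ℤ
  all-zero []       = refl
  all-zero (x ∷ xs) rewrite all-zero xs = refl
coeff-mulP (a ∷ p) q n = begin
  coeff (addP (scaleP a q) (0ℤ ∷ mulP p q)) n  ≡⟨ coeff-addP (scaleP a q) _ n ⟩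
  coeff (scaleP a q) n ℤ.+ coeff (0ℤ ∷ mulP p q) n  ≡⟨ cong₂ ℤ._+_ (coeff-scaleP a q n) (tail n) ⟩
  a ℤ.* coeff q n ℤ.+ sumℤ (applyUpTo (term ∘ suc) n)  ≡⟨ cong sumℤ (map-upTo term (suc n)) ⟨
  mulCoeff (a ∷ p) q n  ∎
  where
  open ≡-Reasoning
  term : ℕ → ℤ
  term i = coeff (a ∷ p) i ℤ.* coeff q (n ∸ i)
  tail : ∀ n → coeff (0ℤ ∷ mulP p q) n ≡ sumℤ (applyUpTo (λ i → coeff p i ℤ.* coeff q (n ∸ suc i)) n)
  tail zero    = refl
  tail (suc n) = trans (coeff-mulP p q n) (cong sumℤ (map-upTo (λ i → coeff p i ℤ.* coeff q (n ∸ i)) (suc n)))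

-- A constant coefficient divisible by arbitrarily large t vanishes, so the coefficients can be peeled off one by one.
eval-vanishes⇒coeff≡0 : ∀ p t₀ → (∀ t → t₀ ≤ t → eval p (pos t) ≡ 0ℤ) → ∀ n → coeff p n ≡ 0ℤ
eval-vanishes⇒coeff≡0 []      t₀ z n = refl
eval-vanishes⇒coeff≡0 (a ∷ p) t₀ z = λ { zero → a≡0 ; (suc n) → eval-vanishes⇒coeff≡0 p (suc t₀) tail n }
  where
  a≡-te : ∀ t → t₀ ≤ t → ∣ a ∣ ≡ t * ∣ eval p (pos t) ∣
  a≡-te t t₀≤t = begin
    ∣ a ∣  ≡⟨ cong ∣_∣ (solve-for a (pos t ℤ.* eval p (pos t)) (z t t₀≤t)) ⟩
    ∣ ℤ.- (pos t ℤ.* eval p (pos t)) ∣ ≡⟨ ℤ.∣-i∣≡∣i∣ (pos t ℤ.* eval p (pos t)) ⟩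
    ∣ pos t ℤ.* eval p (pos t) ∣  ≡⟨ ℤ.abs-* (pos t) (eval p (pos t)) ⟩
    t * ∣ eval p (pos t) ∣  ∎
    where
    open ≡-Reasoning
    solve-for : ∀ x y → x ℤ.+ y ≡ 0ℤ → x ≡ ℤ.- y
    solve-for x y eq = trans (lemma x y) (trans (cong (ℤ._- y) eq) (ℤ.+-identityˡ (ℤ.- y)))
      where
      lemma : ∀ x y → x ≡ x ℤ.+ y ℤ.- y
      lemma = ℤ-solve-∀
  T = suc (∣ a ∣ + t₀)
  a≡0 : a ≡ 0ℤ
  a≡0 = ℤ.∣i∣≡0⇒i≡0 (multiple (a≡-te T (m≤n⇒m≤1+n (m≤n+m t₀ ∣ a ∣))))
    where
    multiple : ∣ a ∣ ≡ T * ∣ eval p (pos T) ∣ → ∣ a ∣ ≡ 0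
    multiple eq with ∣ eval p (pos T) ∣
    ... | zero  = trans eq (*-zeroʳ T)
    ... | suc k = contradiction (≤-trans (m≤m*n T (suc k)) (≤-reflexive (sym eq))) (<⇒≱ (s≤s (m≤m+n ∣ a ∣ t₀)))
  tail : ∀ t → suc t₀ ≤ t → eval p (pos t) ≡ 0ℤ
  tail (suc t) t₀<t with m*n≡0⇒m≡0∨n≡0 (suc t) (trans (sym (a≡-te (suc t) (<⇒≤ t₀<t))) (cong ∣_∣ a≡0))
  ... | inj₂ e≡0 = ℤ.∣i∣≡0⇒i≡0 e≡0

infix 4 _≈_

-- Coefficient lists of one polynomial may differ in trailing zeros. Equality of values ignores
-- these and is what the ring solver proves; `≈⇒coeff` recovers the coefficients.
_≈_ : Poly → Poly → Set
p ≈ q = ∀ t → eval p t ≡ eval q t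

≈⇒coeff : ∀ p q → p ≈ q → ∀ n → coeff p n ≡ coeff q n
≈⇒coeff p q p≈q n = ℤ.i-j≡0⇒i≡j _ _ (begin
  coeff p n ℤ.- coeff q n  ≡⟨ cong (ℤ._+_ (coeff p n)) (trans (sym (ℤ.-1*i≡-i (coeff q n))) (sym (coeff-scaleP (ℤ.- pos 1) q n))) ⟩
  coeff p n ℤ.+ coeff (scaleP (ℤ.- pos 1) q) n ≡⟨ coeff-addP p _ n ⟨
  coeff (addP p (scaleP (ℤ.- pos 1) q)) n  ≡⟨ eval-vanishes⇒coeff≡0 (addP p (scaleP (ℤ.- pos 1) q)) 0 (λ t _ → vanish (pos t)) n ⟩
  0ℤ  ∎)
  where
  open ≡-Reasoning
  vanish : ∀ t → eval (addP p (scaleP (ℤ.- pos 1) q)) t ≡ 0ℤ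
  vanish t rewrite eval-addP p (scaleP (ℤ.- pos 1) q) t | eval-scaleP (ℤ.- pos 1) q t | p≈q t | ℤ.-1*i≡-i (eval q t) = ℤ.+-inverseʳ (eval q t)

coeff≡0⇒eval≡0 : ∀ p → (∀ n → coeff p n ≡ 0ℤ) → ∀ t → eval p t ≡ 0ℤ
coeff≡0⇒eval≡0 []      z t = refl
coeff≡0⇒eval≡0 (a ∷ p) z t rewrite z 0 | coeff≡0⇒eval≡0 p (z ∘ suc) t = trans (ℤ.+-identityˡ _) (ℤ.*-zeroʳ t)

Divides : ℕ → Poly → Set
Divides p xs = ∀ n → pos p ∣ℤ coeff xs n

Divides-∷ : ∀ {p a xs} → pos p ∣ℤ a → Divides p xs → Divides p (a ∷ xs)
Divides-∷ a xs zero    = a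
Divides-∷ a xs (suc n) = xs n

Divides-≈ : ∀ {p} xs ys → xs ≈ ys → Divides p xs → Divides p ys
Divides-≈ {p} xs ys eq d n = subst (pos p ∣ℤ_) (≈⇒coeff xs ys eq n) (d n)

Divides-addP-cancelˡ : ∀ {p} xs ys → Divides p xs → Divides p (addP xs ys) → Divides p ys
Divides-addP-cancelˡ {p} xs ys dx d n =
  ℤ∣.∣m+n∣m⇒∣n (subst (pos p ∣ℤ_) (coeff-addP xs ys n) (d n)) (dx n)

Divides-scaleP : ∀ {p c} xs → pos p ∣ℤ c → Divides p (scaleP c xs)
Divides-scaleP {p} {c} xs d n = subst (pos p ∣ℤ_) (sym (coeff-scaleP c xs n)) (ℤ∣.∣m⇒∣m*n (coeff xs n) d)

euclidℤ : ∀ {p} → Prime p → ∀ a b → pos p ∣ℤ a ℤ.* b → pos p ∣ℤ a ⊎ pos p ∣ℤ b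
euclidℤ {p} p-prime a b d with euclidsLemma ∣ a ∣ ∣ b ∣ p-prime (subst (p ∣_) (ℤ.abs-* a b) (ℤ∣.∣⇒∣ᵤ d))
... | inj₁ x = inj₁ (ℤ∣.∣ᵤ⇒∣ x)
... | inj₂ y = inj₂ (ℤ∣.∣ᵤ⇒∣ y)

-- A constant term divisible by p can be removed from its factor without losing the hypothesis. If
-- neither constant term is divisible by p, then neither is their product, the constant term of the
-- product polynomial.
gauss : ∀ {p} → Prime p → ∀ q x → Divides p (mulP q x) → Divides p q ⊎ Divides p x
gauss p-prime []      x       d = inj₁ (λ n → ℤ∣.divides 0ℤ refl)
gauss p-prime (a ∷ q) []      d = inj₂ (λ n → ℤ∣.divides 0ℤ refl)
gauss {p} p-prime (a ∷ q) (b ∷ x) d =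
  cases (pos p ℤ∣.∣? a) (pos p ℤ∣.∣? b)
    (λ p∣a → gauss p-prime q (b ∷ x) (q-rest p∣a)) (λ p∣b → gauss p-prime (a ∷ q) x (x-rest p∣b))
  where
  q-rest : pos p ∣ℤ a → Divides p (mulP q (b ∷ x))
  q-rest p∣a = Divides-addP-cancelˡ (scaleP a (b ∷ x)) (0ℤ ∷ mulP q (b ∷ x)) (Divides-scaleP (b ∷ x) p∣a) d ∘ suc
  x-rest : pos p ∣ℤ b → Divides p (mulP (a ∷ q) x)
  x-rest p∣b = Divides-addP-cancelˡ (scaleP b (a ∷ q)) (0ℤ ∷ mulP (a ∷ q) x) (Divides-scaleP (a ∷ q) p∣b)
    (Divides-≈ (mulP (a ∷ q) (b ∷ x)) (addP (scaleP b (a ∷ q)) (0ℤ ∷ mulP (a ∷ q) x)) comm d) ∘ suc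
    where
    comm : mulP (a ∷ q) (b ∷ x) ≈ addP (scaleP b (a ∷ q)) (0ℤ ∷ mulP (a ∷ q) x)
    comm t rewrite eval-mulP (a ∷ q) (b ∷ x) t | eval-addP (scaleP b (a ∷ q)) (0ℤ ∷ mulP (a ∷ q) x) t
                 | eval-scaleP b (a ∷ q) t | eval-mulP (a ∷ q) x t = lemma (eval (a ∷ q) t) b t (eval x t)
      where
      lemma : ∀ u b t v → u ℤ.* (b ℤ.+ t ℤ.* v) ≡ b ℤ.* u ℤ.+ (0ℤ ℤ.+ t ℤ.* (u ℤ.* v))
      lemma = ℤ-solve-∀
  cases : Dec (pos p ∣ℤ a) → Dec (pos p ∣ℤ b) →
          (pos p ∣ℤ a → Divides p q ⊎ Divides p (b ∷ x)) →
          (pos p ∣ℤ b → Divides p (a ∷ q) ⊎ Divides p x) → Divides p (a ∷ q) ⊎ Divides p (b ∷ x)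
  cases (yes p∣a) _ rec-q _ with rec-q p∣a
  ... | inj₁ p∣q = inj₁ (Divides-∷ {xs = q} p∣a p∣q)
  ... | inj₂ p∣x = inj₂ p∣x
  cases (no _) (yes p∣b) _ rec-x with rec-x p∣b
  ... | inj₁ p∣q = inj₁ p∣q
  ... | inj₂ p∣x = inj₂ (Divides-∷ {xs = x} p∣b p∣x)
  cases (no p∤a) (no p∤b) _ _ with euclidℤ p-prime a b (subst (pos p ∣ℤ_) (ℤ.+-identityʳ (a ℤ.* b)) (d 0))
  ... | inj₁ p∣a = contradiction p∣a p∤a
  ... | inj₂ p∣b = contradiction p∣b p∤b

quotientP : ∀ {p} xs → Divides p xs → ∃[ ys ] ∀ t → eval xs t ≡ pos p ℤ.* eval ys t
quotientP {p} []       d = [] , λ t → sym (ℤ.*-zeroʳ (pos p))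
quotientP {p} (x ∷ xs) d with d 0 | quotientP xs (d ∘ suc)
... | ℤ∣.divides y refl | ys , eq = y ∷ ys , λ t → trans (cong (λ z → y ℤ.* pos p ℤ.+ t ℤ.* z) (eq t)) (lemma y (pos p) t (eval ys t))
  where
  lemma : ∀ y p t v → y ℤ.* p ℤ.+ t ℤ.* (p ℤ.* v) ≡ p ℤ.* (y ℤ.+ t ℤ.* v)
  lemma = ℤ-solve-∀

-- One step of pseudo-division of a + t·rs by cs with leading coefficient l appended; v is the coefficient to be killed.
step : ℤ → ℤ → ℤ → Poly → Poly → Poly
step l v a (r ∷ rs) (c ∷ cs) = l ℤ.* a ℤ.- v ℤ.* c ∷ step l v r rs cs
step l v a _        _        = []

-- The last entry of `a ∷ rs`, hence the coefficient of degree `length rs` in a + t·rs, which `step`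
-- eliminates.
carry : ℤ → Poly → ℤ
carry a []       = a
carry a (r ∷ rs) = carry r rs

length-step : ∀ l v a rs cs → length rs ≡ length cs → length (step l v a rs cs) ≡ length cs
length-step l v a []       []       eq = refl
length-step l v a (r ∷ rs) (c ∷ cs) eq = cong suc (length-step l v r rs cs (suc-injective eq))

private
  eval-step-aux : ∀ l v a rs cs t → length rs ≡ length cs →
    eval (step l v a rs cs) t ℤ.+ t ℤ.^ length cs ℤ.* (l ℤ.* carry a rs) ≡
    l ℤ.* (a ℤ.+ t ℤ.* eval rs t) ℤ.- v ℤ.* eval cs t
  eval-step-aux l v a [] [] t eq = lemma l v a t
    where
    lemma : ∀ l v a t → 0ℤ ℤ.+ pos 1 ℤ.* (l ℤ.* a) ≡ l ℤ.* (a ℤ.+ t ℤ.* 0ℤ) ℤ.- v ℤ.* 0ℤ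
    lemma = ℤ-solve-∀
  eval-step-aux l v a (r ∷ rs) (c ∷ cs) t eq = begin
    l ℤ.* a ℤ.- v ℤ.* c ℤ.+ t ℤ.* E ℤ.+ t ℤ.* T ℤ.* K  ≡⟨ lemma l a v c t E T K ⟩
    l ℤ.* a ℤ.- v ℤ.* c ℤ.+ t ℤ.* (E ℤ.+ T ℤ.* K)  ≡⟨ cong (λ z → l ℤ.* a ℤ.- v ℤ.* c ℤ.+ t ℤ.* z) (eval-step-aux l v r rs cs t (suc-injective eq)) ⟩
    l ℤ.* a ℤ.- v ℤ.* c ℤ.+ t ℤ.* (l ℤ.* (r ℤ.+ t ℤ.* eval rs t) ℤ.- v ℤ.* eval cs t)
                                                          ≡⟨ lemma′ l a v c t r (eval rs t) (eval cs t) ⟩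
    l ℤ.* (a ℤ.+ t ℤ.* (r ℤ.+ t ℤ.* eval rs t)) ℤ.- v ℤ.* (c ℤ.+ t ℤ.* eval cs t) ∎
    where
    open ≡-Reasoning
    E = eval (step l v r rs cs) t
    T = t ℤ.^ length cs
    K = l ℤ.* carry r rs
    lemma : ∀ l a v c t E T K → l ℤ.* a ℤ.- v ℤ.* c ℤ.+ t ℤ.* E ℤ.+ t ℤ.* T ℤ.* K ≡ l ℤ.* a ℤ.- v ℤ.* c ℤ.+ t ℤ.* (E ℤ.+ T ℤ.* K)
    lemma = ℤ-solve-∀
    lemma′ : ∀ l a v c t r x y → l ℤ.* a ℤ.- v ℤ.* c ℤ.+ t ℤ.* (l ℤ.* (r ℤ.+ t ℤ.* x) ℤ.- v ℤ.* y) ≡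
             l ℤ.* (a ℤ.+ t ℤ.* (r ℤ.+ t ℤ.* x)) ℤ.- v ℤ.* (c ℤ.+ t ℤ.* y)
    lemma′ = ℤ-solve-∀

eval-step : ∀ l a rs cs t → length rs ≡ length cs →
  eval (step l (carry a rs) a rs cs) t ≡
  l ℤ.* (a ℤ.+ t ℤ.* eval rs t) ℤ.- carry a rs ℤ.* eval (snoc cs l) t
eval-step l a rs cs t eq = begin
  E  ≡⟨ lemma E T l v (eval cs t) ⟩
  E ℤ.+ T ℤ.* (l ℤ.* v) ℤ.- v ℤ.* (T ℤ.* l)  ≡⟨ cong (ℤ._- v ℤ.* (T ℤ.* l)) (eval-step-aux l v a rs cs t eq) ⟩
  X ℤ.- v ℤ.* eval cs t ℤ.- v ℤ.* (T ℤ.* l)  ≡⟨ lemma′ X v (eval cs t) (T ℤ.* l) ⟩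
  X ℤ.- v ℤ.* (eval cs t ℤ.+ T ℤ.* l)  ≡⟨ cong (λ z → X ℤ.- v ℤ.* z) (eval-snoc cs l t) ⟨
  X ℤ.- v ℤ.* eval (snoc cs l) t  ∎
  where
  open ≡-Reasoning
  v = carry a rs
  E = eval (step l v a rs cs) t
  T = t ℤ.^ length cs
  X = l ℤ.* (a ℤ.+ t ℤ.* eval rs t)
  lemma : ∀ E T l v y → E ≡ E ℤ.+ T ℤ.* (l ℤ.* v) ℤ.- v ℤ.* (T ℤ.* l)
  lemma = ℤ-solve-∀
  lemma′ : ∀ X v y z → X ℤ.- v ℤ.* y ℤ.- v ℤ.* z ≡ X ℤ.- v ℤ.* (y ℤ.+ z)
  lemma′ = ℤ-solve-∀

*-nonzero : ∀ {a b} → ¬ a ≡ 0ℤ → ¬ b ≡ 0ℤ → ¬ a ℤ.* b ≡ 0ℤ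
*-nonzero {a} a≢0 b≢0 ab≡0 with ℤ.i*j≡0⇒i≡0∨j≡0 a ab≡0
... | inj₁ a≡0 = a≢0 a≡0
... | inj₂ b≡0 = b≢0 b≡0

-- Horner's scheme: the remainder of `a ∷ f` arises from that of `f` by a shift and one elimination.
-- Multiplying by `l` at each step avoids fractions, and so `c` is a power of `l`.
pseudo-division : ∀ cs l → ¬ l ≡ 0ℤ → ∀ f → ∃[ c ] ∃[ q ] ∃[ r ]
  (¬ c ≡ 0ℤ × length r ≡ length cs × (∀ t → c ℤ.* eval f t ≡ eval q t ℤ.* eval (snoc cs l) t ℤ.+ eval r t))
pseudo-division cs l l≢0 [] = pos 1 , [] , zeros cs , (λ ()) , length-map (const 0ℤ) cs ,
  λ t → sym (trans (ℤ.+-identityˡ _) (eval-zeros cs t))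
pseudo-division cs l l≢0 (a ∷ f) with pseudo-division cs l l≢0 f
... | c , q , r , c≢0 , len , eq = l ℤ.* c , v ∷ scaleP l q , step l v (c ℤ.* a) r cs , *-nonzero l≢0 c≢0 ,
      length-step l v (c ℤ.* a) r cs len , λ t → (begin
      l ℤ.* c ℤ.* (a ℤ.+ t ℤ.* eval f t)  ≡⟨ lemma l c a t (eval f t) ⟩
      l ℤ.* (c ℤ.* a ℤ.+ t ℤ.* (c ℤ.* eval f t))  ≡⟨ cong (λ z → l ℤ.* (c ℤ.* a ℤ.+ t ℤ.* z)) (eq t) ⟩
      l ℤ.* (c ℤ.* a ℤ.+ t ℤ.* (eval q t ℤ.* X t ℤ.+ eval r t)) ≡⟨ lemma′ l (c ℤ.* a) t (eval q t) (X t) (eval r t) v ⟩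
      (v ℤ.+ t ℤ.* (l ℤ.* eval q t)) ℤ.* X t ℤ.+ (l ℤ.* (c ℤ.* a ℤ.+ t ℤ.* eval r t) ℤ.- v ℤ.* X t)
        ≡⟨ cong₂ (λ y z → (v ℤ.+ t ℤ.* y) ℤ.* X t ℤ.+ z) (sym (eval-scaleP l q t)) (sym (eval-step l (c ℤ.* a) r cs t len)) ⟩
      eval (v ∷ scaleP l q) t ℤ.* X t ℤ.+ eval (step l v (c ℤ.* a) r cs) t ∎)
  where
  open ≡-Reasoning
  v = carry (c ℤ.* a) r
  X = eval (snoc cs l)
  lemma : ∀ l c a t x → l ℤ.* c ℤ.* (a ℤ.+ t ℤ.* x) ≡ l ℤ.* (c ℤ.* a ℤ.+ t ℤ.* (c ℤ.* x))
  lemma = ℤ-solve-∀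
  lemma′ : ∀ l a t q X r v → l ℤ.* (a ℤ.+ t ℤ.* (q ℤ.* X ℤ.+ r)) ≡
           (v ℤ.+ t ℤ.* (l ℤ.* q)) ℤ.* X ℤ.+ (l ℤ.* (a ℤ.+ t ℤ.* r) ℤ.- v ℤ.* X)
  lemma′ = ℤ-solve-∀

normalise : ∀ r → (∀ t → eval r t ≡ 0ℤ) ⊎ ∃[ cs ] ∃[ l ] (¬ l ≡ 0ℤ × length cs < length r × r ≈ snoc cs l)
normalise [] = inj₁ (λ t → refl)
normalise (a ∷ r) with normalise r
... | inj₂ (cs , l , l≢0 , len , eq) = inj₂ (a ∷ cs , l , l≢0 , s≤s len , λ t → cong (λ z → a ℤ.+ t ℤ.* z) (eq t))
... | inj₁ r≡0 with a ℤ.≟ 0ℤ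
... | yes refl = inj₁ (λ t → trans (cong (λ z → 0ℤ ℤ.+ t ℤ.* z) (r≡0 t)) (trans (ℤ.+-identityˡ _) (ℤ.*-zeroʳ t)))
... | no a≢0   = inj₂ ([] , a , a≢0 , s≤s z≤n , λ t → cong (λ z → a ℤ.+ t ℤ.* z) (r≡0 t))

IsUnit⇒constant : ∀ u → IsUnit u → ∃[ e ] (¬ e ≡ 0ℤ × ∀ t → eval u t ≡ e)
IsUnit⇒constant []      (inj₁ () , _)
IsUnit⇒constant []      (inj₂ () , _)
IsUnit⇒constant (a ∷ u) (a≡±1 , rest) = a , a≢0 a≡±1 , λ t →
  trans (cong (λ z → a ℤ.+ t ℤ.* z) (coeff≡0⇒eval≡0 u rest t)) (trans (cong (ℤ._+_ a) (ℤ.*-zeroʳ t)) (ℤ.+-identityʳ a))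
  where
  a≢0 : a ≡ pos 1 ⊎ a ≡ ℤ.- pos 1 → ¬ a ≡ 0ℤ
  a≢0 (inj₁ refl) ()
  a≢0 (inj₂ refl) ()

height : Poly → ℕ
height p = ∑ p ∣_∣

∣eval∣≤height : ∀ p t k → 1 ≤ t → length p ≤ suc k → ∣ eval p (pos t) ∣ ≤ height p * t ^ k
∣eval∣≤height []          t k       1≤t len = z≤n
∣eval∣≤height (a ∷ [])    t k       1≤t len = begin
  ∣ a ℤ.+ pos t ℤ.* 0ℤ ∣  ≡⟨ cong ∣_∣ (trans (cong (ℤ._+_ a) (ℤ.*-zeroʳ (pos t))) (ℤ.+-identityʳ a)) ⟩
  ∣ a ∣  ≤⟨ m≤m+n ∣ a ∣ 0 ⟩
  ∣ a ∣ + 0  ≤⟨ m≤m*n _ (t ^ k) {{m^n≢0 t k {{>-nonZero 1≤t}}}} ⟩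
  (∣ a ∣ + 0) * t ^ k  ∎
  where open ≤-Reasoning
∣eval∣≤height (a ∷ b ∷ p) t (suc k) 1≤t (s≤s len) = begin
  ∣ a ℤ.+ pos t ℤ.* e ∣  ≤⟨ ℤ.∣i+j∣≤∣i∣+∣j∣ a (pos t ℤ.* e) ⟩
  ∣ a ∣ + ∣ pos t ℤ.* e ∣  ≡⟨ cong (λ z → ∣ a ∣ + z) (ℤ.abs-* (pos t) e) ⟩
  ∣ a ∣ + t * ∣ e ∣  ≤⟨ +-mono-≤ (m≤m*n ∣ a ∣ (t ^ suc k) {{m^n≢0 t (suc k) {{>-nonZero 1≤t}}}})
                                                (*-monoʳ-≤ t (∣eval∣≤height (b ∷ p) t k 1≤t len)) ⟩
  ∣ a ∣ * t ^ suc k + t * (height (b ∷ p) * t ^ k)  ≡⟨ lemma ∣ a ∣ t (height (b ∷ p)) (t ^ k) ⟩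
  (∣ a ∣ + height (b ∷ p)) * t ^ suc k  ∎
  where
  open ≤-Reasoning
  e = eval (b ∷ p) (pos t)
  lemma : ∀ a t h u → a * (t * u) + t * (h * u) ≡ (a + h) * (t * u)
  lemma = solve-∀

pos-^ : ∀ a n → pos (a ^ n) ≡ pos a ℤ.^ n
pos-^ a zero    = refl
pos-^ a (suc n) = trans (ℤ.pos-* a (a ^ n)) (cong (ℤ._*_ (pos a)) (pos-^ a n))

derivative : Poly → Poly
derivative []          = []
derivative (a ∷ [])    = []
derivative (a ∷ b ∷ p) = addP (b ∷ p) (0ℤ ∷ derivative (b ∷ p))

coeff-derivative : ∀ p n → coeff (derivative p) n ≡ pos (suc n) ℤ.* coeff p (suc n)
coeff-derivative []      n = sym (ℤ.*-zeroʳ (pos (suc n)))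
coeff-derivative (a ∷ []) n = sym (ℤ.*-zeroʳ (pos (suc n)))
coeff-derivative (a ∷ p@(_ ∷ _)) zero =
  trans (coeff-addP p (0ℤ ∷ derivative p) 0) (trans (ℤ.+-identityʳ _) (sym (ℤ.*-identityˡ _)))
coeff-derivative (a ∷ p@(_ ∷ _)) (suc n) = begin
  coeff (addP p (0ℤ ∷ derivative p)) (suc n)  ≡⟨ coeff-addP p (0ℤ ∷ derivative p) (suc n) ⟩
  coeff p (suc n) ℤ.+ coeff (derivative p) n  ≡⟨ cong (ℤ._+_ (coeff p (suc n))) (coeff-derivative p n) ⟩
  coeff p (suc n) ℤ.+ pos (suc n) ℤ.* coeff p (suc n)  ≡⟨ lemma (pos (suc n)) (coeff p (suc n)) ⟩
  (pos 1 ℤ.+ pos (suc n)) ℤ.* coeff p (suc n)  ∎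
  where
  open ≡-Reasoning
  lemma : ∀ n c → c ℤ.+ n ℤ.* c ≡ (pos 1 ℤ.+ n) ℤ.* c
  lemma = ℤ-solve-∀

length-derivative : ∀ a p → length (derivative (a ∷ p)) ≡ length p
length-derivative a []      = refl
length-derivative a (b ∷ p) = cong suc (trans (length-addP p (derivative (b ∷ p))) (trans (cong (length p ⊔_) (length-derivative b p)) (⊔-idem (length p))))
  where
  length-addP : ∀ p q → length (addP p q) ≡ length p ⊔ length q
  length-addP []      q       = refl
  length-addP (a ∷ p) []      = refl
  length-addP (a ∷ p) (b ∷ q) = cong suc (length-addP p q)

taylor : ∀ p n u → ∃[ h ] eval p (n ℤ.+ u) ≡ eval p n ℤ.+ u ℤ.* eval (derivative p) n ℤ.+ u ℤ.* u ℤ.* h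
taylor []      n u = 0ℤ , lemma u
  where
  lemma : ∀ u → 0ℤ ≡ 0ℤ ℤ.+ u ℤ.* 0ℤ ℤ.+ u ℤ.* u ℤ.* 0ℤ
  lemma = ℤ-solve-∀
taylor (a ∷ []) n u = 0ℤ , lemma a n u
  where
  lemma : ∀ a n u → a ℤ.+ (n ℤ.+ u) ℤ.* 0ℤ ≡ a ℤ.+ n ℤ.* 0ℤ ℤ.+ u ℤ.* 0ℤ ℤ.+ u ℤ.* u ℤ.* 0ℤ
  lemma = ℤ-solve-∀
taylor (a ∷ p@(_ ∷ _)) n u with taylor p n u
... | h , eq = eval (derivative p) n ℤ.+ (n ℤ.+ u) ℤ.* h , (begin
  a ℤ.+ (n ℤ.+ u) ℤ.* eval p (n ℤ.+ u)  ≡⟨ cong (λ z → a ℤ.+ (n ℤ.+ u) ℤ.* z) eq ⟩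
  a ℤ.+ (n ℤ.+ u) ℤ.* (P ℤ.+ u ℤ.* P′ ℤ.+ u ℤ.* u ℤ.* h)
                                                 ≡⟨ lemma a n u P P′ h ⟩
  a ℤ.+ n ℤ.* P ℤ.+ u ℤ.* (P ℤ.+ (0ℤ ℤ.+ n ℤ.* P′)) ℤ.+ u ℤ.* u ℤ.* (P′ ℤ.+ (n ℤ.+ u) ℤ.* h)
    ≡⟨ cong (λ z → a ℤ.+ n ℤ.* P ℤ.+ u ℤ.* z ℤ.+ u ℤ.* u ℤ.* (P′ ℤ.+ (n ℤ.+ u) ℤ.* h)) (sym (eval-addP p (0ℤ ∷ derivative p) n)) ⟩
  a ℤ.+ n ℤ.* P ℤ.+ u ℤ.* eval (derivative (a ∷ p)) n ℤ.+ u ℤ.* u ℤ.* (P′ ℤ.+ (n ℤ.+ u) ℤ.* h) ∎)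
  where
  open ≡-Reasoning
  P  = eval p n
  P′ = eval (derivative p) n
  lemma : ∀ a n u P P′ h → a ℤ.+ (n ℤ.+ u) ℤ.* (P ℤ.+ u ℤ.* P′ ℤ.+ u ℤ.* u ℤ.* h) ≡
          a ℤ.+ n ℤ.* P ℤ.+ u ℤ.* (P ℤ.+ (0ℤ ℤ.+ n ℤ.* P′)) ℤ.+ u ℤ.* u ℤ.* (P′ ℤ.+ (n ℤ.+ u) ℤ.* h)
  lemma = ℤ-solve-∀

-- Consequences of irreducibility

module MonicIrreducible (fs : Poly) (irreducible : Irreducible (snoc fs (pos 1))) where

  f : Poly
  f = snoc fs (pos 1)

  d : ℕ
  d = length fs

  -- The primes of the constant are divided out one at a time, each from a factor that it divides by
  -- `gauss`. The scalar `e` records what `x` has lost, so that the degree of `x′` can still be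
  -- compared with that of `x`.
  gauss-factor : ∀ ps → All Prime ps → ∀ q x → (∀ t → pos (product ps) ℤ.* eval f t ≡ eval q t ℤ.* eval x t) →
    ∃[ q′ ] ∃[ x′ ] ∃[ e ] (¬ e ≡ 0ℤ × (∀ t → eval f t ≡ eval q′ t ℤ.* eval x′ t) × (∀ t → eval x t ≡ e ℤ.* eval x′ t))
  gauss-factor [] [] q x eq = q , x , pos 1 , (λ ()) , (λ t → trans (sym (ℤ.*-identityˡ _)) (eq t)) , λ t → sym (ℤ.*-identityˡ _)
  gauss-factor (p ∷ ps) (p-prime ∷ primes) q x eq with gauss p-prime q x p∣qx
    where
    c = pos (p * product ps)
    p∣qx : Divides p (mulP q x)
    p∣qx n = subst (pos p ∣ℤ_) (≈⇒coeff (scaleP c f) (mulP q x) (λ t → trans (eval-scaleP c f t) (trans (eq t) (sym (eval-mulP q x t)))) n)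
      (Divides-scaleP {c = c} f (ℤ∣.∣ᵤ⇒∣ (m∣m*n (product ps))) n)
  ... | inj₁ p∣q = let q₁ , q≡ = quotientP q p∣q in gauss-factor ps primes q₁ x λ t →
    ℤ.*-cancelˡ-≡ (pos p) _ _ {{p≢0}} (begin
      pos p ℤ.* (pos (product ps) ℤ.* eval f t)  ≡⟨ ℤ.*-assoc (pos p) _ _ ⟨
      pos p ℤ.* pos (product ps) ℤ.* eval f t  ≡⟨ cong (ℤ._* eval f t) (ℤ.pos-* p (product ps)) ⟨
      pos (p * product ps) ℤ.* eval f t  ≡⟨ eq t ⟩
      eval q t ℤ.* eval x t  ≡⟨ cong (ℤ._* eval x t) (q≡ t) ⟩
      pos p ℤ.* eval q₁ t ℤ.* eval x t  ≡⟨ ℤ.*-assoc (pos p) _ _ ⟩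
      pos p ℤ.* (eval q₁ t ℤ.* eval x t)  ∎)
    where
    open ≡-Reasoning
    p≢0 = prime⇒nonZero p-prime
  ... | inj₂ p∣x with quotientP x p∣x
  ...   | x₁ , x≡ with gauss-factor ps primes q x₁ (λ t → ℤ.*-cancelˡ-≡ (pos p) _ _ {{prime⇒nonZero p-prime}} (begin
      pos p ℤ.* (pos (product ps) ℤ.* eval f t)  ≡⟨ ℤ.*-assoc (pos p) _ _ ⟨
      pos p ℤ.* pos (product ps) ℤ.* eval f t  ≡⟨ cong (ℤ._* eval f t) (ℤ.pos-* p (product ps)) ⟨
      pos (p * product ps) ℤ.* eval f t  ≡⟨ eq t ⟩
      eval q t ℤ.* eval x t  ≡⟨ cong (ℤ._*_ (eval q t)) (x≡ t) ⟩
      eval q t ℤ.* (pos p ℤ.* eval x₁ t)  ≡⟨ lemma (eval q t) (pos p) (eval x₁ t) ⟩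
      pos p ℤ.* (eval q t ℤ.* eval x₁ t)  ∎))
    where
    open ≡-Reasoning
    lemma : ∀ a b c → a ℤ.* (b ℤ.* c) ≡ b ℤ.* (a ℤ.* c)
    lemma = ℤ-solve-∀
  ...     | q′ , x′ , e , e≢0 , f≡ , x₁≡ = q′ , x′ , pos p ℤ.* e , *-nonzero p≢0 e≢0 , f≡ ,
            λ t → trans (x≡ t) (trans (cong (ℤ._*_ (pos p)) (x₁≡ t)) (sym (ℤ.*-assoc (pos p) e _)))
    where
    p≢0 : ¬ pos p ≡ 0ℤ
    p≢0 eq = ≢-nonZero⁻¹ p {{prime⇒nonZero p-prime}} (ℤ.+-injective eq)

  -- A factorisation over ℚ becomes one over ℤ by `gauss-factor`, and irreducibility makes one
  -- factor a unit. A unit `x′` would make `snoc cs l` constant; a unit `q′` would make a nonzero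
  -- multiple of `f` equal to a polynomial of degree less than d.
  no-proper-factor : ∀ cs l q c → ¬ l ≡ 0ℤ → ¬ c ≡ 0ℤ → 1 ≤ length cs → length cs < d →
                     ¬ (∀ t → c ℤ.* eval f t ≡ eval q t ℤ.* eval (snoc cs l) t)
  no-proper-factor cs l q c l≢0 c≢0 1≤ <d eq = conclude (ℤ.+∣i∣≡i⊎+∣i∣≡-i c)
    where
    X = snoc cs l
    X-degree : ∀ {e} → ¬ (∀ t → eval X t ≡ e)
    X-degree {e} X≡e = l≢0 (trans (sym (coeff-snoc cs l)) (trans
      (≈⇒coeff X (e ∷ []) (λ t → trans (X≡e t) (sym (trans (cong (ℤ._+_ e) (ℤ.*-zeroʳ t)) (ℤ.+-identityʳ e)))) (length cs))
      (coeff-≥length (e ∷ []) 1≤)))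
    factor : PrimeFactorisation ∣ c ∣
    factor = factorise ∣ c ∣ {{≢-nonZero (c≢0 ∘ ℤ.∣i∣≡0⇒i≡0)}}
    ps = PrimeFactorisation.factors factor
    absurd : ∀ q → (∀ t → pos ∣ c ∣ ℤ.* eval f t ≡ eval q t ℤ.* eval X t) → ⊥
    absurd q eq with gauss-factor ps (PrimeFactorisation.factorsPrime factor) q X
      (subst (λ z → ∀ t → pos z ℤ.* eval f t ≡ eval q t ℤ.* eval X t) (PrimeFactorisation.isFactorisation factor) eq)
    ... | q′ , x′ , e , e≢0 , f≡ , X≡ with proj₂ (proj₂ irreducible) q′ x′
            (λ n → trans (≈⇒coeff f (mulP q′ x′) (λ t → trans (f≡ t) (sym (eval-mulP q′ x′ t))) n) (coeff-mulP q′ x′ n))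
    ... | inj₂ x′-unit with IsUnit⇒constant x′ x′-unit
    ...   | u , _ , x′≡u = X-degree (λ t → trans (X≡ t) (cong (ℤ._*_ e) (x′≡u t)))
    absurd q eq | q′ , x′ , e , e≢0 , f≡ , X≡ | inj₁ q′-unit with IsUnit⇒constant q′ q′-unit
    ...   | u , _ , q′≡u = e≢0 (begin
      e  ≡⟨ ℤ.*-identityʳ e ⟨
      e ℤ.* pos 1  ≡⟨ cong (ℤ._*_ e) (coeff-snoc fs (pos 1)) ⟨
      e ℤ.* coeff f d  ≡⟨ coeff-scaleP e f d ⟨
      coeff (scaleP e f) d  ≡⟨ ≈⇒coeff (scaleP e f) (scaleP u X) same d ⟩
      coeff (scaleP u X) d  ≡⟨ coeff-scaleP u X d ⟩
      u ℤ.* coeff X d  ≡⟨ cong (ℤ._*_ u) (coeff-≥length X (subst (_≤ d) (sym (length-snoc cs l)) <d)) ⟩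
      u ℤ.* 0ℤ  ≡⟨ ℤ.*-zeroʳ u ⟩
      0ℤ  ∎)
      where
      open ≡-Reasoning
      lemma : ∀ e u x → e ℤ.* (u ℤ.* x) ≡ u ℤ.* (e ℤ.* x)
      lemma = ℤ-solve-∀
      same : scaleP e f ≈ scaleP u X
      same t rewrite eval-scaleP e f t | eval-scaleP u X t | f≡ t | q′≡u t | X≡ t = lemma e u (eval x′ t)
    conclude : pos ∣ c ∣ ≡ c ⊎ pos ∣ c ∣ ≡ ℤ.- c → ⊥
    conclude (inj₁ eq₁) = absurd q (λ t → trans (cong (ℤ._* eval f t) eq₁) (eq t))
    conclude (inj₂ eq₁) = absurd (scaleP (ℤ.- pos 1) q) (λ t → begin
      pos ∣ c ∣ ℤ.* eval f t  ≡⟨ cong (ℤ._* eval f t) eq₁ ⟩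
      ℤ.- c ℤ.* eval f t  ≡⟨ lemma c (eval f t) ⟩
      ℤ.- pos 1 ℤ.* (c ℤ.* eval f t)  ≡⟨ cong (ℤ._*_ (ℤ.- pos 1)) (eq t) ⟩
      ℤ.- pos 1 ℤ.* (eval q t ℤ.* eval X t)  ≡⟨ ℤ.*-assoc (ℤ.- pos 1) (eval q t) (eval X t) ⟨
      ℤ.- pos 1 ℤ.* eval q t ℤ.* eval X t  ≡⟨ cong (ℤ._* eval X t) (eval-scaleP (ℤ.- pos 1) q t) ⟨
      eval (scaleP (ℤ.- pos 1) q) t ℤ.* eval X t  ∎)
      where
      open ≡-Reasoning
      lemma : ∀ c x → ℤ.- c ℤ.* x ≡ ℤ.- pos 1 ℤ.* (c ℤ.* x)
      lemma = ℤ-solve-∀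

  -- The constant `c` is uniform, but the cofactors are mere integers for each `t`: every
  -- application evaluates the identity at a point.
  Bézout : Poly → Set
  Bézout x = ∃[ c ] (¬ c ≡ 0ℤ × ∀ t → ∃[ a ] ∃[ b ] c ≡ a ℤ.* eval f t ℤ.+ b ℤ.* eval x t)

  -- A variant of Euclid's algorithm that divides `f` itself by each successive remainder. A zero
  -- remainder would be a proper factor of a multiple of `f`; otherwise the degree drops until a
  -- nonzero constant is left. `k` is fuel.
  bézout : ∀ k cs l → length cs ≤ k → ¬ l ≡ 0ℤ → length cs < d → Bézout (snoc cs l)
  bézout k [] l _ l≢0 _ = l , l≢0 , λ t → 0ℤ , pos 1 , lemma l t (eval f t)
    where
    lemma : ∀ l t x → l ≡ 0ℤ ℤ.* x ℤ.+ pos 1 ℤ.* (l ℤ.+ t ℤ.* 0ℤ)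
    lemma = ℤ-solve-∀
  bézout (suc k) cs@(_ ∷ _) l (s≤s len) l≢0 <d with pseudo-division cs l l≢0 f
  ... | c , q , r , c≢0 , len-r , div with normalise r
  ... | inj₁ r≡0 = contradiction
          (λ t → trans (div t) (trans (cong (ℤ._+_ (eval q t ℤ.* eval (snoc cs l) t)) (r≡0 t)) (ℤ.+-identityʳ _)))
          (no-proper-factor cs l q c l≢0 c≢0 (s≤s z≤n) <d)
  ... | inj₂ (cs′ , l′ , l′≢0 , len′ , r≈) with bézout k cs′ l′ (≤-trans (s≤s⁻¹ (subst (length cs′ <_) len-r len′)) len) l′≢0
                                                (<-trans (subst (length cs′ <_) len-r len′) <d)
  ... | m , m≢0 , comb = m , m≢0 , λ t → let a , b , eq = comb t in
        a ℤ.+ b ℤ.* c , ℤ.- (b ℤ.* eval q t) , (begin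
          m  ≡⟨ eq ⟩
          a ℤ.* eval f t ℤ.+ b ℤ.* eval (snoc cs′ l′) t  ≡⟨ cong (λ z → a ℤ.* eval f t ℤ.+ b ℤ.* z) (r≈ t) ⟨
          a ℤ.* eval f t ℤ.+ b ℤ.* eval r t  ≡⟨ lemma a (eval f t) b (eval r t) (eval q t) (eval (snoc cs l) t) ⟩
          a ℤ.* eval f t ℤ.+ b ℤ.* (eval q t ℤ.* eval (snoc cs l) t ℤ.+ eval r t) ℤ.- b ℤ.* eval q t ℤ.* eval (snoc cs l) t
            ≡⟨ cong (λ z → a ℤ.* eval f t ℤ.+ b ℤ.* z ℤ.- b ℤ.* eval q t ℤ.* eval (snoc cs l) t) (div t) ⟨
          a ℤ.* eval f t ℤ.+ b ℤ.* (c ℤ.* eval f t) ℤ.- b ℤ.* eval q t ℤ.* eval (snoc cs l) t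
            ≡⟨ lemma′ a (eval f t) b c (eval q t) (eval (snoc cs l) t) ⟩
          (a ℤ.+ b ℤ.* c) ℤ.* eval f t ℤ.+ ℤ.- (b ℤ.* eval q t) ℤ.* eval (snoc cs l) t ∎)
    where
    open ≡-Reasoning
    lemma : ∀ a f b r q x → a ℤ.* f ℤ.+ b ℤ.* r ≡ a ℤ.* f ℤ.+ b ℤ.* (q ℤ.* x ℤ.+ r) ℤ.- b ℤ.* q ℤ.* x
    lemma = ℤ-solve-∀
    lemma′ : ∀ a f b c q x → a ℤ.* f ℤ.+ b ℤ.* (c ℤ.* f) ℤ.- b ℤ.* q ℤ.* x ≡ (a ℤ.+ b ℤ.* c) ℤ.* f ℤ.+ ℤ.- (b ℤ.* q) ℤ.* x
    lemma′ = ℤ-solve-∀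

  Bézout-nonzero : ∀ x → length x ≤ d → ¬ (∀ t → eval x t ≡ 0ℤ) → Bézout x
  Bézout-nonzero x len x≢0 with normalise x
  ... | inj₁ x≡0 = contradiction x≡0 x≢0
  ... | inj₂ (cs , l , l≢0 , len′ , x≈) with bézout (length cs) cs l ≤-refl l≢0 (<-≤-trans len′ len)
  ... | c , c≢0 , comb = c , c≢0 , λ t → let a , b , eq = comb t in
        a , b , trans eq (cong (λ z → a ℤ.* eval f t ℤ.+ b ℤ.* z) (sym (x≈ t)))

  -- X - n has degree 1 < d, and at a common root n its Bézout identity would read c = 0.
  no-root : 2 ≤ d → ∀ n → ¬ eval f n ≡ 0ℤ
  no-root 2≤d n f[n]≡0 with bézout 1 (ℤ.- n ∷ []) (pos 1) ≤-refl (λ ()) 2≤d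
  ... | c , c≢0 , comb with comb n
  ... | a , b , eq = c≢0 (trans eq (trans (cong (λ z → a ℤ.* z ℤ.+ b ℤ.* (ℤ.- n ℤ.+ n ℤ.* (pos 1 ℤ.+ n ℤ.* 0ℤ))) f[n]≡0) (lemma a b n)))
    where
    lemma : ∀ a b n → a ℤ.* 0ℤ ℤ.+ b ℤ.* (ℤ.- n ℤ.+ n ℤ.* (pos 1 ℤ.+ n ℤ.* 0ℤ)) ≡ 0ℤ
    lemma = ℤ-solve-∀

  Bézout-derivative : 1 ≤ d → Bézout (derivative f)
  Bézout-derivative 1≤d = Bézout-nonzero (derivative f) (≤-reflexive len)
    (λ z → f′≢0 (trans (sym (coeff-derivative f (pred d))) (eval-vanishes⇒coeff≡0 (derivative f) 0 (λ t _ → z (pos t)) (pred d))))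
    where
    len : length (derivative f) ≡ d
    len = aux fs
      where
      aux : ∀ cs → length (derivative (snoc cs (pos 1))) ≡ length cs
      aux []       = refl
      aux (c ∷ cs) = trans (length-derivative c (snoc cs (pos 1))) (length-snoc cs (pos 1))
    suc-pred-d : suc (pred d) ≡ d
    suc-pred-d = suc-pred d {{>-nonZero 1≤d}}
    f′≢0 : ¬ pos (suc (pred d)) ℤ.* coeff f (suc (pred d)) ≡ 0ℤ
    f′≢0 eq with trans (sym eq) (cong (ℤ._*_ (pos (suc (pred d)))) (trans (cong (coeff f) suc-pred-d) (coeff-snoc fs (pos 1))))
    ... | ()

  -- f dominates every polynomial of smaller degree at large arguments.
  multiple-of-smaller-degree : ∀ P → length P ≤ d → (∀ t → ∃[ g ] eval P (pos t) ≡ g ℤ.* eval f (pos t)) →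
    ∀ n → coeff P n ≡ 0ℤ
  multiple-of-smaller-degree P len multiple = eval-vanishes⇒coeff≡0 P (suc (height P + height fs)) vanish
    where
    vanish : ∀ t → suc (height P + height fs) ≤ t → eval P (pos t) ≡ 0ℤ
    vanish t H<t with multiple t
    ... | g , eq with g ℤ.≟ 0ℤ
    ... | yes refl = eq
    ... | no g≢0 with m≤n⇒∃[o]m+o≡n (≤-trans (s≤s (z≤n {height P + height fs})) H<t)
    vanish t H<t | g , eq | no g≢0 | _ with d in d≡
    ... | zero  = coeff≡0⇒eval≡0 P (λ n → coeff-≥length P (≤-trans len z≤n)) (pos t)
    ... | suc k = contradiction H<t (≤⇒≯ (*-cancelʳ-≤ t (height P + height fs) (t ^ k) {{m^n≢0 t k {{>-nonZero 1≤t}}}} (begin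
      t * t ^ k  ≡⟨ cong (t ^_) d≡ ⟨
      t ^ d  ≡⟨ cong ∣_∣ (pos-^ t d) ⟩
      ∣ pos t ℤ.^ d ∣  ≡⟨ cong ∣_∣ (trans (lemma (eval fs (pos t)) (pos t ℤ.^ d)) (cong (ℤ._- eval fs (pos t)) (sym (eval-snoc fs (pos 1) (pos t))))) ⟩
      ∣ eval f (pos t) ℤ.- eval fs (pos t) ∣  ≤⟨ ℤ.∣i-j∣≤∣i∣+∣j∣ (eval f (pos t)) (eval fs (pos t)) ⟩
      ∣ eval f (pos t) ∣ + ∣ eval fs (pos t) ∣  ≤⟨ +-mono-≤ f≤P (∣eval∣≤height fs t k 1≤t (≤-reflexive d≡)) ⟩
      ∣ eval P (pos t) ∣ + height fs * t ^ k  ≤⟨ +-monoˡ-≤ _ (∣eval∣≤height P t k 1≤t len) ⟩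
      height P * t ^ k + height fs * t ^ k  ≡⟨ *-distribʳ-+ (t ^ k) (height P) (height fs) ⟨
      (height P + height fs) * t ^ k  ∎)))
      where
      open ≤-Reasoning
      1≤t : 1 ≤ t
      1≤t = ≤-trans (s≤s z≤n) H<t
      lemma : ∀ a b → b ≡ a ℤ.+ b ℤ.* pos 1 ℤ.- a
      lemma = ℤ-solve-∀
      f≤P : ∣ eval f (pos t) ∣ ≤ ∣ eval P (pos t) ∣
      f≤P = begin
        ∣ eval f (pos t) ∣  ≤⟨ m≤n*m ∣ eval f (pos t) ∣ ∣ g ∣ {{≢-nonZero (g≢0 ∘ ℤ.∣i∣≡0⇒i≡0)}} ⟩
        ∣ g ∣ * ∣ eval f (pos t) ∣  ≡⟨ ℤ.abs-* g (eval f (pos t)) ⟨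
        ∣ g ℤ.* eval f (pos t) ∣  ≡⟨ cong ∣_∣ eq ⟨
        ∣ eval P (pos t) ∣  ∎

  -- By the Bézout identity for `x`, if `f` divides P·x then it divides c·P, whose degree is too
  -- small. Thus multiplication by a nonzero element is injective modulo `f`.
  cancel-nonzero-factor : ∀ x → Bézout x → ∀ P → length P ≤ d →
    (∀ t → ∃[ g ] eval P (pos t) ℤ.* eval x (pos t) ≡ g ℤ.* eval f (pos t)) → ∀ n → coeff P n ≡ 0ℤ
  cancel-nonzero-factor x (c , c≢0 , comb) P len multiple n
    with ℤ.i*j≡0⇒i≡0∨j≡0 c (trans (sym (coeff-scaleP c P n))
      (multiple-of-smaller-degree (scaleP c P) (≤-trans (≤-reflexive (length-map _ P)) len) cP n))
    where
    open ≡-Reasoning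
    lemma : ∀ a f b x P → (a ℤ.* f ℤ.+ b ℤ.* x) ℤ.* P ≡ a ℤ.* P ℤ.* f ℤ.+ b ℤ.* (P ℤ.* x)
    lemma = ℤ-solve-∀
    lemma′ : ∀ a P f b g → a ℤ.* P ℤ.* f ℤ.+ b ℤ.* (g ℤ.* f) ≡ (a ℤ.* P ℤ.+ b ℤ.* g) ℤ.* f
    lemma′ = ℤ-solve-∀
    cP : ∀ t → ∃[ g ] eval (scaleP c P) (pos t) ≡ g ℤ.* eval f (pos t)
    cP t = let a , b , c≡ = comb (pos t) ; g , Px≡ = multiple t
               F = eval f (pos t) ; X = eval x (pos t) ; p = eval P (pos t) in
      a ℤ.* p ℤ.+ b ℤ.* g , (begin
        eval (scaleP c P) (pos t)  ≡⟨ eval-scaleP c P (pos t) ⟩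
        c ℤ.* p  ≡⟨ cong (ℤ._* p) c≡ ⟩
        (a ℤ.* F ℤ.+ b ℤ.* X) ℤ.* p  ≡⟨ lemma a F b X p ⟩
        a ℤ.* p ℤ.* F ℤ.+ b ℤ.* (p ℤ.* X)  ≡⟨ cong (λ z → a ℤ.* p ℤ.* F ℤ.+ b ℤ.* z) Px≡ ⟩
        a ℤ.* p ℤ.* F ℤ.+ b ℤ.* (g ℤ.* F)  ≡⟨ lemma′ a p F b g ⟩
        (a ℤ.* p ℤ.+ b ℤ.* g) ℤ.* F  ∎)
  ... | inj₁ c≡0 = contradiction c≡0 c≢0
  ... | inj₂ P≡0 = P≡0

-- Divided differences

-- A list of naturals gives the lower coefficients of a monic polynomial.
evalM : List ℕ → ℕ → ℕ
evalM []       s = 1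
evalM (c ∷ gs) s = c + s * evalM gs s

evalM-mono : ∀ gs {s t} → s ≤ t → evalM gs s ≤ evalM gs t
evalM-mono []       s≤t = ≤-refl
evalM-mono (c ∷ gs) s≤t = +-monoʳ-≤ c (*-mono-≤ s≤t (evalM-mono gs s≤t))

^≤evalM : ∀ gs s → s ^ length gs ≤ evalM gs s
^≤evalM []       s = ≤-refl
^≤evalM (c ∷ gs) s = ≤-trans (*-monoʳ-≤ s (^≤evalM gs s)) (m≤n+m _ c)

evalM≥1 : ∀ gs {s} → 1 ≤ s → 1 ≤ evalM gs s
evalM≥1 gs {s} 1≤s = ≤-trans (m^n>0 s {{>-nonZero 1≤s}} (length gs)) (^≤evalM gs s)

private
  -- Lower coefficients of the monic polynomial ((s + A) G(s) - A G(0)) / s: multiplying the shifted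
  -- polynomial by the old variable s + A, with the constant term split off.
  rest : ℕ → List ℕ → List ℕ
  rest A []      = []
  rest A (g ∷ G) = g + A * evalM G 0 ∷ rest A G

  length-rest : ∀ A G → length (rest A G) ≡ length G
  length-rest A []      = refl
  length-rest A (g ∷ G) = cong suc (length-rest A G)

  rest-spec : ∀ A G s → (s + A) * evalM G s ≡ A * evalM G 0 + s * evalM (rest A G) s
  rest-spec A []      s = lemma A s
    where
    lemma : ∀ A s → (s + A) * 1 ≡ A * 1 + s * 1
    lemma = solve-∀
  rest-spec A (g ∷ G) s = begin
    (s + A) * (g + s * evalM G s)  ≡⟨ lemma A s g (evalM G s) ⟩
    A * (g + 0 * evalM G 0) + s * (g + (s + A) * evalM G s)  ≡⟨ cong (λ z → A * (g + 0 * evalM G 0) + s * (g + z)) (rest-spec A G s) ⟩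
    A * (g + 0 * evalM G 0) + s * (g + (A * evalM G 0 + s * evalM (rest A G) s))
      ≡⟨ cong (λ z → A * (g + 0 * evalM G 0) + s * z) (sym (+-assoc g _ _)) ⟩
    A * (g + 0 * evalM G 0) + s * (g + A * evalM G 0 + s * evalM (rest A G) s) ∎
    where
    open ≡-Reasoning
    lemma : ∀ A s g x → (s + A) * (g + s * x) ≡ A * (g + 0) + s * (g + (s + A) * x)
    lemma = solve-∀

-- Natural Taylor coefficients keep all divided differences positive, which turns divisibility into size bounds.
shift-positive : ∀ gs → ∃[ A₀ ] ∀ A → A₀ ≤ A → ∃[ G ]
  (length G ≡ length gs × 1 ≤ evalM G 0 × ∀ s → eval (snoc gs (pos 1)) (pos (s + A)) ≡ pos (evalM G s))
shift-positive [] = 0 , λ A _ → [] , refl , ≤-refl , λ s → trans (cong (ℤ._+_ (pos 1)) (ℤ.*-zeroʳ (pos (s + A)))) refl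
shift-positive (c ∷ gs) with shift-positive gs
-- The new constant term is c + A·G(0) with G(0) ≥ 1, and A > ∣c∣ makes it positive.
... | A₀ , shifted = A₀ ⊔ suc ∣ c ∣ , λ A A₀≤A →
  let G , len , G[0]≥1 , spec = shifted A (≤-trans (m≤m⊔n A₀ (suc ∣ c ∣)) A₀≤A)
      k , k≡ , k≥1 = positive c (A * evalM G 0)
        (≤-trans (m≤n⊔m A₀ (suc ∣ c ∣)) (≤-trans A₀≤A (m≤m*n A (evalM G 0) {{>-nonZero G[0]≥1}})))
  in k ∷ rest A G , cong suc (trans (length-rest A G) len) , ≤-trans k≥1 (m≤m+n k 0) , λ s → (begin
    c ℤ.+ pos (s + A) ℤ.* eval (snoc gs (pos 1)) (pos (s + A))  ≡⟨ cong (λ z → c ℤ.+ pos (s + A) ℤ.* z) (spec s) ⟩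
    c ℤ.+ pos (s + A) ℤ.* pos (evalM G s)  ≡⟨ cong (ℤ._+_ c) (ℤ.pos-* (s + A) (evalM G s)) ⟨
    c ℤ.+ pos ((s + A) * evalM G s)  ≡⟨ cong (λ z → c ℤ.+ pos z) (rest-spec A G s) ⟩
    c ℤ.+ pos (A * evalM G 0 + s * evalM (rest A G) s)  ≡⟨ cong (ℤ._+_ c) (ℤ.pos-+ (A * evalM G 0) _) ⟩
    c ℤ.+ (pos (A * evalM G 0) ℤ.+ pos (s * evalM (rest A G) s)) ≡⟨ ℤ.+-assoc c _ _ ⟨
    c ℤ.+ pos (A * evalM G 0) ℤ.+ pos (s * evalM (rest A G) s)  ≡⟨ cong (ℤ._+ pos (s * evalM (rest A G) s)) k≡ ⟩
    pos k ℤ.+ pos (s * evalM (rest A G) s)  ≡⟨ ℤ.pos-+ k _ ⟨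
    pos (k + s * evalM (rest A G) s)  ∎)
  where
  open ≡-Reasoning
  positive : ∀ c n → suc ∣ c ∣ ≤ n → ∃[ k ] (c ℤ.+ pos n ≡ pos k × 1 ≤ k)
  positive (pos m)  n m<n = m + n , sym (ℤ.pos-+ m n) , ≤-trans (≤-trans (s≤s z≤n) m<n) (m≤n+m n m)
  positive -[1+ m ] n m<n = n ∸ suc m , ℤ.⊖-≥ (<⇒≤ m<n) , m<n⇒0<n∸m m<n

dd : ℕ → List ℕ → List ℕ
dd a []               = []
dd a gs@(_ ∷ gs′)     = evalM gs a ∷ dd a gs′

length-dd : ∀ a gs → length (dd a gs) ≡ length gs
length-dd a []       = refl
length-dd a (_ ∷ gs) = cong suc (length-dd a gs)

-- dd a gs is the divided difference (G(s) − G(a)) / (s − a) of G = c ∷ gs, written without subtraction.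
dd-spec : ∀ a c gs s → evalM (c ∷ gs) s + a * evalM (dd a gs) s ≡ evalM (c ∷ gs) a + s * evalM (dd a gs) s
dd-spec a c []       s = lemma a c s
  where
  lemma : ∀ a c s → c + s * 1 + a * 1 ≡ c + a * 1 + s * 1
  lemma = solve-∀
dd-spec a c (g ∷ gs) s = begin
  c + s * q s + a * (q a + s * Q)  ≡⟨ lemma a c s (q s) (q a) Q ⟩
  c + a * q a + s * (q s + a * Q)  ≡⟨ cong (λ z → c + a * q a + s * z) (dd-spec a g gs s) ⟩
  c + a * q a + s * (q a + s * Q)  ∎
  where
  open ≡-Reasoning
  q = evalM (g ∷ gs)
  Q = evalM (dd a gs) s
  lemma : ∀ a c s x y Q → c + s * x + a * (y + s * Q) ≡ c + a * y + s * (x + a * Q)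
  lemma = solve-∀

evalM-dd : ∀ a gs T → a ≤ T → evalM (dd a gs) T ≤ suc (length gs) * evalM gs T
evalM-dd a []       T a≤T = ≤-refl
evalM-dd a (g ∷ gs) T a≤T = begin
  evalM (g ∷ gs) a + T * evalM (dd a gs) T  ≤⟨ +-mono-≤ (evalM-mono (g ∷ gs) a≤T) (*-monoʳ-≤ T (evalM-dd a gs T a≤T)) ⟩
  evalM (g ∷ gs) T + T * (suc (length gs) * evalM gs T)  ≡⟨ cong (evalM (g ∷ gs) T +_) (lemma T (suc (length gs)) (evalM gs T)) ⟩
  evalM (g ∷ gs) T + suc (length gs) * (T * evalM gs T)  ≤⟨ +-monoʳ-≤ (evalM (g ∷ gs) T) (*-monoʳ-≤ (suc (length gs)) (m≤n+m _ g)) ⟩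
  evalM (g ∷ gs) T + suc (length gs) * evalM (g ∷ gs) T  ∎
  where
  open ≤-Reasoning
  lemma : ∀ a b c → a * (b * c) ≡ b * (a * c)
  lemma = solve-∀

∣evalM-dd : ∀ w a b c gs → Coprime w ∣ a - b ∣ → w ∣ evalM (c ∷ gs) a → w ∣ evalM (c ∷ gs) b → w ∣ evalM (dd a gs) b
∣evalM-dd w a b c gs coprime w∣a w∣b with ≤-total a b
... | inj₁ a≤b with m≤n⇒∃[o]m+o≡n a≤b
...   | u , refl = coprime-divisor (subst (Coprime w) (∣m-m+n∣≡n a u) coprime)
        (∣m+n∣m⇒∣n {m = evalM (c ∷ gs) a} (subst (w ∣_) eq w∣b) w∣a)
  where
  Q = evalM (dd a gs) (a + u)
  eq : evalM (c ∷ gs) (a + u) ≡ evalM (c ∷ gs) a + u * Q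
  eq = +-cancelʳ-≡ (a * Q) _ _ (trans (dd-spec a c gs (a + u)) (lemma (evalM (c ∷ gs) a) a u Q))
    where
    lemma : ∀ x a u Q → x + (a + u) * Q ≡ x + u * Q + a * Q
    lemma = solve-∀
∣evalM-dd w a b c gs coprime w∣a w∣b | inj₂ b≤a with m≤n⇒∃[o]m+o≡n b≤a
...   | u , refl = coprime-divisor (subst (Coprime w) (trans (∣-∣-comm (b + u) b) (∣m-m+n∣≡n b u)) coprime)
        (∣m+n∣m⇒∣n {m = evalM (c ∷ gs) b} (subst (w ∣_) (sym eq) w∣a) w∣b)
  where
  Q = evalM (dd (b + u) gs) b
  eq : evalM (c ∷ gs) b + u * Q ≡ evalM (c ∷ gs) (b + u)
  eq = +-cancelʳ-≡ (b * Q) _ _ (trans (lemma (evalM (c ∷ gs) b) b u Q) (dd-spec (b + u) c gs b))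
    where
    lemma : ∀ x b u Q → x + u * Q + b * Q ≡ x + (b + u) * Q
    lemma = solve-∀

-- Iterated divided differences at the common roots stay divisible by w but lose one degree each time.
common-divisor-bound : ∀ gs w T a as → 2 ≤ w → All (λ x → 1 ≤ x × x ≤ T) (a ∷ as) →
  AllPairs (λ x y → Coprime w ∣ x - y ∣) (a ∷ as) → All (λ x → w ∣ evalM gs x) (a ∷ as) →
  suc (length as) ≤ length gs × T ^ length as * w ≤ length gs ^ length as * evalM gs T
-- A monic polynomial of degree 0 is 1, which `w` cannot divide. This case is what limits the number
-- of common roots to the degree.
common-divisor-bound [] w T a as 2≤w _ _ (w∣1 ∷ _) = contradiction (∣1⇒≡1 w∣1) (λ { refl → contradiction 2≤w (λ { (s≤s ()) }) })
common-divisor-bound (c ∷ gs) w T a [] 2≤w ((1≤a , a≤T) ∷ _) _ (w∣a ∷ _) = s≤s z≤n , (begin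
  1 * w  ≡⟨ *-identityˡ w ⟩
  w  ≤⟨ ∣⇒≤ {{>-nonZero (evalM≥1 (c ∷ gs) 1≤a)}} w∣a ⟩
  evalM (c ∷ gs) a  ≤⟨ evalM-mono (c ∷ gs) a≤T ⟩
  evalM (c ∷ gs) T  ≡⟨ *-identityˡ _ ⟨
  1 * evalM (c ∷ gs) T  ∎)
  where open ≤-Reasoning
common-divisor-bound (c ∷ gs) w T a (b ∷ bs) 2≤w ((1≤a , a≤T) ∷ bounds) (coprimes ∷ pairs) (w∣a ∷ w∣bs)
  with common-divisor-bound (dd a gs) w T b bs 2≤w bounds pairs
         (All.tabulate λ {x} x∈ → ∣evalM-dd w a x c gs (All.lookup coprimes x∈) w∣a (All.lookup w∣bs x∈))
... | k≤ , bound rewrite length-dd a gs = s≤s k≤ , (begin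
  T * T ^ k * w  ≡⟨ *-assoc T (T ^ k) w ⟩
  T * (T ^ k * w)  ≤⟨ *-monoʳ-≤ T bound ⟩
  T * (length gs ^ k * evalM (dd a gs) T)  ≤⟨ *-monoʳ-≤ T (*-mono-≤ (^-monoˡ-≤ k (n≤1+n (length gs))) (evalM-dd a gs T a≤T)) ⟩
  T * (suc (length gs) ^ k * (suc (length gs) * evalM gs T)) ≡⟨ lemma T (suc (length gs) ^ k) (suc (length gs)) (evalM gs T) ⟩
  suc (length gs) * suc (length gs) ^ k * (T * evalM gs T)  ≤⟨ *-monoʳ-≤ (suc (length gs) * suc (length gs) ^ k) (m≤n+m _ c) ⟩
  suc (length gs) * suc (length gs) ^ k * evalM (c ∷ gs) T  ∎)
  where
  open ≤-Reasoning
  k = length bs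
  lemma : ∀ T e e′ x → T * (e * (e′ * x)) ≡ e′ * e * (T * x)
  lemma = solve-∀

-- Roots modulo a prime

roots : Poly → ℕ → List ℕ
roots f p = filter (λ r → p ∣? ∣ eval f (pos r) ∣) (downFrom p)

∈-roots⁺ : ∀ f {p r} → r < p → p ∣ ∣ eval f (pos r) ∣ → r ∈ roots f p
∈-roots⁺ f {p} r<p p∣ = ∈-filter⁺ (λ r → p ∣? ∣ eval f (pos r) ∣) (∈-downFrom⁺ r<p) p∣

∈-roots⁻ : ∀ f {p r} → r ∈ roots f p → r < p × p ∣ ∣ eval f (pos r) ∣
∈-roots⁻ f {p} r∈ with ∈-filter⁻ (λ r → p ∣? ∣ eval f (pos r) ∣) {xs = downFrom p} r∈
... | r∈d , p∣ = ∈-downFrom⁻ r∈d , p∣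

roots-unique : ∀ f p → Unique (roots f p)
roots-unique f p = Unique.filter⁺ _ (Unique.downFrom⁺ p)

eval-congruent : ∀ f n u → u ∣ℤ eval f (n ℤ.+ u) ℤ.- eval f n
eval-congruent f n u with taylor f n u
... | h , eq = ℤ∣.divides (D ℤ.+ u ℤ.* h) (trans (cong (ℤ._- eval f n) eq) (lemma (eval f n) u D h))
  where
  D = eval (derivative f) n
  lemma : ∀ x u D h → x ℤ.+ u ℤ.* D ℤ.+ u ℤ.* u ℤ.* h ℤ.- x ≡ (D ℤ.+ u ℤ.* h) ℤ.* u
  lemma = ℤ-solve-∀

∣eval-shift : ∀ f p r k → p ∣ ∣ eval f (pos r) ∣ → p ∣ ∣ eval f (pos (r + k * p)) ∣
∣eval-shift f p r k p∣ = ℤ∣.∣⇒∣ᵤ (subst (pos p ∣ℤ_) (lemma (eval f (pos (r + k * p))) (eval f (pos r)))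
  (ℤ∣.∣m∣n⇒∣m+n (ℤ∣.∣-trans (ℤ∣.divides (pos k) (ℤ.pos-* k p))
    (subst (λ z → pos (k * p) ∣ℤ eval f z ℤ.- eval f (pos r)) (sym (ℤ.pos-+ r (k * p))) (eval-congruent f (pos r) (pos (k * p)))))
    (ℤ∣.∣ᵤ⇒∣ p∣)))
  where
  lemma : ∀ x y → x ℤ.- y ℤ.+ y ≡ x
  lemma = ℤ-solve-∀

AllPairs-map-unique : ∀ {A B : Set} {R : B → B → Set} (g : A → B) (xs : List A) → Unique xs →
  (∀ {x y} → x ∈ xs → y ∈ xs → ¬ x ≡ y → R (g x) (g y)) → AllPairs R (map g xs)
AllPairs-map-unique g []       []             R = []
AllPairs-map-unique g (x ∷ xs) (x∉ ∷ unique) R =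
  All.map⁺ (All.tabulate (λ y∈ → R (here refl) (there y∈) (All.lookup x∉ y∈))) ∷
  AllPairs-map-unique g xs unique (λ x∈ y∈ → R (there x∈) (there y∈))

∣-∣-distinct-bounds : ∀ {m n p} → m < p → n < p → ¬ m ≡ n → 1 ≤ ∣ m - n ∣ × ∣ m - n ∣ < p
∣-∣-distinct-bounds {m} {n} m<p n<p m≢n = n≢0⇒n>0 (m≢n ∘ ∣m-n∣≡0⇒m≡n) , ≤-<-trans (∣m-n∣≤m⊔n m n) (⊔-lub m<p n<p)

-- The first half of `common-divisor-bound` with w = p. A root r is moved to r + A·p, which is the
-- node r + A·(p - 1) in the variable shifted by A; the nodes differ as the roots do, by less than
-- p. The successor in `A` makes them positive.
lagrange : ∀ gs p → Prime p → length (roots (snoc gs (pos 1)) p) ≤ length gs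
lagrange gs p p-prime = go (roots f p) (roots-unique f p) (λ {r} → ∈-roots⁻ f {p} {r})
  where
  f = snoc gs (pos 1)
  A₀ = proj₁ (shift-positive gs)
  A = suc A₀
  shifted = proj₂ (shift-positive gs) A (n≤1+n A₀)
  G = proj₁ shifted
  2≤p = prime≥2 p-prime
  node : ℕ → ℕ
  node r = r + A * pred p
  node+A : ∀ r → node r + A ≡ r + A * p
  node+A r = trans (+-assoc r _ A) (cong (λ z → r + z) (trans (+-comm _ A) (trans (sym (*-suc A (pred p)))
    (cong (A *_) (suc-pred p {{prime⇒nonZero p-prime}})))))
  node≥1 : ∀ r → 1 ≤ node r
  node≥1 r = ≤-trans (≤-trans (≤-pred (subst (2 ≤_) (sym (suc-pred p {{prime⇒nonZero p-prime}})) 2≤p)) (m≤m+n (pred p) _)) (m≤n+m _ r)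
  p∣G : ∀ r → p ∣ ∣ eval f (pos r) ∣ → p ∣ evalM G (node r)
  p∣G r p∣ = subst (p ∣_) (cong ∣_∣ (trans (cong (λ z → eval f (pos z)) (sym (node+A r))) (proj₂ (proj₂ (proj₂ shifted)) (node r)))) (∣eval-shift f p r A p∣)
  go : ∀ rs → Unique rs → (∀ {r} → r ∈ rs → r < p × p ∣ ∣ eval f (pos r) ∣) → length rs ≤ length gs
  go []       _      _    = z≤n
  go (r ∷ rs) unique root = subst₂ _≤_ (cong suc (length-map node rs)) (proj₁ (proj₂ shifted))
    (proj₁ (common-divisor-bound G p (p + A * pred p) (node r) (map node rs) 2≤p
      (All.map⁺ {xs = r ∷ rs} (All.tabulate (λ {s} s∈ → node≥1 s , +-monoˡ-≤ _ (<⇒≤ (proj₁ (root s∈))))))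
      (AllPairs-map-unique node (r ∷ rs) unique (λ {x} {y} x∈ y∈ x≢y → coprime x y (proj₁ (root x∈)) (proj₁ (root y∈)) x≢y))
      (All.map⁺ {xs = r ∷ rs} (All.tabulate (λ {s} s∈ → p∣G s (proj₂ (root s∈)))))))
    where
    coprime : ∀ x y → x < p → y < p → ¬ x ≡ y → Coprime p ∣ node x - node y ∣
    coprime x y x<p y<p x≢y with ∣-∣-distinct-bounds x<p y<p x≢y
    ... | ≥1 , <p = subst (Coprime p) (sym (trans (cong₂ ∣_-_∣ (+-comm x _) (+-comm y _)) (∣m+n-m+o∣≡∣n-o∣ (A * pred p) x y)))
                      (prime⇒coprime p-prime {{>-nonZero ≥1}} <p)

-- Norms

open import Algebra.Properties.Group (AbelianGroup.group ℤ.+-0-abelianGroup) using () renaming (∙-cancelˡ to ℤ-+-cancelˡ; ∙-cancelʳ to ℤ-+-cancelʳ)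

boxes : List ℕ → List (List ℕ)
boxes []       = [] ∷ []
boxes (b ∷ bs) = cartesianProductWith _∷_ (downFrom b) (boxes bs)

length-boxes : ∀ bs → length (boxes bs) ≡ product bs
length-boxes []       = refl
length-boxes (b ∷ bs) = trans (length-cartesianProductWith _∷_ (downFrom b) (boxes bs))
  (cong₂ _*_ (length-downFrom b) (length-boxes bs))

boxes-unique : ∀ bs → Unique (boxes bs)
boxes-unique []       = [] ∷ []
boxes-unique (b ∷ bs) = Unique.cartesianProductWith⁺ _∷_ ∷-injective (Unique.downFrom⁺ b) (boxes-unique bs)

∈-boxes⁺ : ∀ {cs bs} → Pointwise _<_ cs bs → cs ∈ boxes bs
∈-boxes⁺ []           = here refl
∈-boxes⁺ (c<b ∷ rest) = ∈-cartesianProductWith⁺ _∷_ (∈-downFrom⁺ c<b) (∈-boxes⁺ rest)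

∈-boxes⁻ : ∀ {cs} bs → cs ∈ boxes bs → Pointwise _<_ cs bs
∈-boxes⁻ []       (here refl) = []
∈-boxes⁻ (b ∷ bs) cs∈ with ∈-cartesianProductWith⁻ _∷_ (downFrom b) (boxes bs) cs∈
... | _ , _ , c∈ , rest∈ , refl = ∈-downFrom⁻ c∈ ∷ ∈-boxes⁻ bs rest∈

product-replicate : ∀ n b → product (replicate n b) ≡ b ^ n
product-replicate zero    b = refl
product-replicate (suc n) b = cong (b *_) (product-replicate n b)

∈-boxes-replicate⁻ : ∀ {cs} n {b} → cs ∈ boxes (replicate n b) → length cs ≡ n × All (_< b) cs
∈-boxes-replicate⁻ n cs∈ = go n (∈-boxes⁻ (replicate n _) cs∈)
  where
  go : ∀ {cs b} n → Pointwise _<_ cs (replicate n b) → length cs ≡ n × All (_< b) cs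
  go zero    []           = refl , []
  go (suc n) (c<b ∷ rest) = let len , all = go n rest in cong suc len , c<b ∷ all

∈-boxes-replicate⁺ : ∀ {cs n b} → length cs ≡ n → All (_< b) cs → cs ∈ boxes (replicate n b)
∈-boxes-replicate⁺ len all = ∈-boxes⁺ (go len all)
  where
  go : ∀ {cs n b} → length cs ≡ n → All (_< b) cs → Pointwise _<_ cs (replicate n b)
  go refl []           = []
  go refl (c<b ∷ all) = c<b ∷ go refl all

Bounded : ℕ → Poly → Set
Bounded B = All (λ a → ∣ a ∣ ≤ B)

Bounded-weaken : ∀ {B C p} → B ≤ C → Bounded B p → Bounded C p
Bounded-weaken B≤C = All.map (λ a≤B → ≤-trans a≤B B≤C)

Bounded-addP : ∀ {B C p q} → Bounded B p → Bounded C q → Bounded (B + C) (addP p q)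
Bounded-addP {B} {C} []         bq        = Bounded-weaken (m≤n+m C B) bq
Bounded-addP {B} {C} (a ∷ bp)   []        = Bounded-weaken (m≤m+n B C) (a ∷ bp)
Bounded-addP (_∷_ {x = x} a bp) (_∷_ {x = y} b bq) = ≤-trans (ℤ.∣i+j∣≤∣i∣+∣j∣ x y) (+-mono-≤ a b) ∷ Bounded-addP bp bq

Bounded-scaleP : ∀ {B C p} c → ∣ c ∣ ≤ C → Bounded B p → Bounded (C * B) (scaleP c p)
Bounded-scaleP c c≤C [] = []
Bounded-scaleP c c≤C (_∷_ {x = a} a≤B bp) =
  ≤-trans (≤-reflexive (ℤ.abs-* c a)) (*-mono-≤ c≤C a≤B) ∷ Bounded-scaleP c c≤C bp

Bounded-height : ∀ p → Bounded (height p) p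
Bounded-height []      = []
Bounded-height (a ∷ p) = m≤m+n ∣ a ∣ (height p) ∷ Bounded-weaken (m≤n+m (height p) ∣ a ∣) (Bounded-height p)

Bounded-zeros : ∀ {B} cs → Bounded B (zeros cs)
Bounded-zeros []       = []
Bounded-zeros (c ∷ cs) = z≤n ∷ Bounded-zeros cs

length-addP-≡ : ∀ {n} p q → length p ≡ n → length q ≡ n → length (addP p q) ≡ n
length-addP-≡ []      q       refl len = len
length-addP-≡ (a ∷ p) (b ∷ q) refl len = cong suc (length-addP-≡ p q refl (suc-injective len))

length-scaleP : ∀ c p → length (scaleP c p) ≡ length p
length-scaleP c p = length-map (c ℤ.*_) p

Bounded-carry : ∀ {B a} rs → ∣ a ∣ ≤ B → Bounded B rs → ∣ carry a rs ∣ ≤ B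
Bounded-carry []       a≤B []       = a≤B
Bounded-carry (r ∷ rs) a≤B (r≤B ∷ b) = Bounded-carry rs r≤B b

Bounded-step : ∀ {B H v a} rs cs → ∣ v ∣ ≤ B → ∣ a ∣ ≤ B → Bounded B rs → Bounded H cs →
               Bounded (B * suc H) (step (pos 1) v a rs cs)
Bounded-step []       cs       v≤B a≤B b         h         = []
Bounded-step (r ∷ rs) []       v≤B a≤B b         h         = []
Bounded-step {B} {H} {v} {a} (r ∷ rs) (c ∷ cs) v≤B a≤B (r≤B ∷ b) (c≤H ∷ h) = (begin
  ∣ pos 1 ℤ.* a ℤ.- v ℤ.* c ∣  ≤⟨ ℤ.∣i-j∣≤∣i∣+∣j∣ (pos 1 ℤ.* a) (v ℤ.* c) ⟩
  ∣ pos 1 ℤ.* a ∣ + ∣ v ℤ.* c ∣  ≡⟨ cong₂ _+_ (cong ∣_∣ (ℤ.*-identityˡ a)) (ℤ.abs-* v c) ⟩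
  ∣ a ∣ + ∣ v ∣ * ∣ c ∣  ≤⟨ +-mono-≤ a≤B (*-mono-≤ v≤B c≤H) ⟩
  B + B * H  ≡⟨ *-suc B H ⟨
  B * suc H  ∎) ∷ Bounded-step rs cs v≤B r≤B b h
  where open ≤-Reasoning

shift-abs : ∀ B a → ∣ a ∣ ≤ B → pos ∣ a ℤ.+ pos B ∣ ≡ a ℤ.+ pos B
shift-abs B (pos m)  m≤B = refl
shift-abs B -[1+ m ] m≤B = trans (cong (pos ∘ ∣_∣) (ℤ.⊖-≥ m≤B)) (sym (ℤ.⊖-≥ m≤B))

map-shift-injective : ∀ {B} p q → Bounded B p → Bounded B q →
  map (λ a → ∣ a ℤ.+ pos B ∣) p ≡ map (λ a → ∣ a ℤ.+ pos B ∣) q → p ≡ q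
map-shift-injective []      []      _ _ _ = refl
map-shift-injective {B} (a ∷ p) (b ∷ q) (a≤B ∷ bp) (b≤B ∷ bq) eq = cong₂ _∷_
  (ℤ-+-cancelʳ (pos B) a b
    (trans (sym (shift-abs B a a≤B)) (trans (cong pos (proj₁ (∷-injective eq))) (shift-abs B b b≤B))))
  (map-shift-injective p q bp bq (proj₂ (∷-injective eq)))

∣ℤ-*-+-* : ∀ {p} a b c e → pos p ∣ℤ b → pos p ∣ℤ e → pos p ∣ℤ a ℤ.* b ℤ.+ c ℤ.* e
∣ℤ-*-+-* a b c e p∣b p∣e = ℤ∣.∣m∣n⇒∣m+n (ℤ∣.∣n⇒∣m*n a p∣b) (ℤ∣.∣n⇒∣m*n c p∣e)

∣pos-pos∣ : ∀ m n → ∣ pos m ℤ.- pos n ∣ ≡ ∣ m - n ∣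
∣pos-pos∣ m n with ≤-total m n
... | inj₁ m≤n = trans (cong ∣_∣ (ℤ.m-n≡m⊖n m n)) (trans (ℤ.∣⊖∣-≤ m≤n) (sym (m≤n⇒∣m-n∣≡n∸m m≤n)))
... | inj₂ n≤m = trans (cong ∣_∣ (trans (ℤ.m-n≡m⊖n m n) (ℤ.⊖-≥ n≤m))) (sym (m≤n⇒∣n-m∣≡n∸m n≤m))

∣pos-difference⇒≡ : ∀ {p m n} → m < p → n < p → pos p ∣ℤ pos m ℤ.- pos n → m ≡ n
∣pos-difference⇒≡ {p} {m} {n} m<p n<p p∣ with m ≟ n
... | yes m≡n = m≡n
... | no  m≢n with ∣-∣-distinct-bounds m<p n<p m≢n
...   | ≥1 , <p = contradiction (subst (p ∣_) (∣pos-pos∣ m n) (ℤ∣.∣⇒∣ᵤ p∣)) (>⇒∤ {{>-nonZero ≥1}} <p)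

pos-pos : ∀ a b → pos a ℤ.+ ℤ.- pos 1 ℤ.* pos b ≡ pos a ℤ.- pos b
pos-pos a b = cong (ℤ._+_ (pos a)) (ℤ.-1*i≡-i (pos b))

difference-coeff≡0⇒≡ : ∀ xs ys → length xs ≡ length ys →
  (∀ n → coeff (addP (map pos xs) (scaleP (ℤ.- pos 1) (map pos ys))) n ≡ 0ℤ) → xs ≡ ys
difference-coeff≡0⇒≡ []       []       _  _ = refl
difference-coeff≡0⇒≡ (x ∷ xs) (y ∷ ys) eq z = cong₂ _∷_
  (ℤ.+-injective (ℤ.i-j≡0⇒i≡j (pos x) (pos y) (trans (sym (pos-pos x y)) (z 0))))
  (difference-coeff≡0⇒≡ xs ys (suc-injective eq) (z ∘ suc))

module NormBound (fs : Poly) (irreducible : Irreducible (snoc fs (pos 1))) (1≤d : 1 ≤ length fs) where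

  open MonicIrreducible fs irreducible

  H : ℕ
  H = height fs

  -- Multiplication by the variable modulo `f`: since `f` is monic, the pseudo-division step is an
  -- exact one and subtracts `carry 0ℤ x` times `f`.
  mulT : Poly → Poly
  mulT x = step (pos 1) (carry 0ℤ x) 0ℤ x fs

  length-mulT : ∀ x → length x ≡ d → length (mulT x) ≡ d
  length-mulT x len = length-step (pos 1) (carry 0ℤ x) 0ℤ x fs len

  eval-mulT : ∀ x t → length x ≡ d → eval (mulT x) t ≡ t ℤ.* eval x t ℤ.- carry 0ℤ x ℤ.* eval f t
  eval-mulT x t len = trans (eval-step (pos 1) 0ℤ x fs t len) (lemma (t ℤ.* eval x t) (carry 0ℤ x ℤ.* eval f t))
    where
    lemma : ∀ a b → pos 1 ℤ.* (0ℤ ℤ.+ a) ℤ.- b ≡ a ℤ.- b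
    lemma = ℤ-solve-∀

  -- φ x y represents the product x·y modulo f.
  φ : Poly → Poly → Poly
  φ x []       = zeros fs
  φ x (y ∷ ys) = addP (scaleP y x) (φ (mulT x) ys)

  length-φ : ∀ x ys → length x ≡ d → length (φ x ys) ≡ d
  length-φ x []       len = length-map _ fs
  length-φ x (y ∷ ys) len = length-addP-≡ (scaleP y x) _ (trans (length-scaleP y x) len) (length-φ (mulT x) ys (length-mulT x len))

  eval-φ : ∀ x ys t → length x ≡ d → ∃[ g ] eval (φ x ys) t ≡ eval ys t ℤ.* eval x t ℤ.+ g ℤ.* eval f t
  eval-φ x []       t len = 0ℤ , trans (eval-zeros fs t) (lemma (eval x t) (eval f t))
    where
    lemma : ∀ x f → 0ℤ ≡ 0ℤ ℤ.* x ℤ.+ 0ℤ ℤ.* f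
    lemma = ℤ-solve-∀
  eval-φ x (y ∷ ys) t len with eval-φ (mulT x) ys t (length-mulT x len)
  ... | g , eq = g ℤ.- Y ℤ.* carry 0ℤ x , (begin
    eval (addP (scaleP y x) (φ (mulT x) ys)) t  ≡⟨ eval-addP (scaleP y x) _ t ⟩
    eval (scaleP y x) t ℤ.+ eval (φ (mulT x) ys) t  ≡⟨ cong₂ ℤ._+_ (eval-scaleP y x t) eq ⟩
    y ℤ.* X ℤ.+ (Y ℤ.* eval (mulT x) t ℤ.+ g ℤ.* F)  ≡⟨ cong (λ z → y ℤ.* X ℤ.+ (Y ℤ.* z ℤ.+ g ℤ.* F)) (eval-mulT x t len) ⟩
    y ℤ.* X ℤ.+ (Y ℤ.* (t ℤ.* X ℤ.- carry 0ℤ x ℤ.* F) ℤ.+ g ℤ.* F)  ≡⟨ lemma y X Y t (carry 0ℤ x) F g ⟩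
    (y ℤ.+ t ℤ.* Y) ℤ.* X ℤ.+ (g ℤ.- Y ℤ.* carry 0ℤ x) ℤ.* F  ∎)
    where
    open ≡-Reasoning
    X = eval x t
    Y = eval ys t
    F = eval f t
    lemma : ∀ y X Y t v F g → y ℤ.* X ℤ.+ (Y ℤ.* (t ℤ.* X ℤ.- v ℤ.* F) ℤ.+ g ℤ.* F) ≡
            (y ℤ.+ t ℤ.* Y) ℤ.* X ℤ.+ (g ℤ.- Y ℤ.* v) ℤ.* F
    lemma = ℤ-solve-∀

  Bounded-φ : ∀ {X Y} x ys → Bounded X x → Bounded Y ys → Bounded (length ys * (Y * X) * suc H ^ length ys) (φ x ys)
  Bounded-φ x [] bx by = Bounded-zeros fs
  Bounded-φ {X} {Y} x (y ∷ ys) bx (y≤Y ∷ by) = Bounded-weaken bound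
    (Bounded-addP (Bounded-scaleP y y≤Y bx)
      (Bounded-φ (mulT x) ys (Bounded-step x fs (Bounded-carry x z≤n bx) z≤n bx (Bounded-height fs)) by))
    where
    n = length ys
    open ≤-Reasoning
    lemma : ∀ n Y X h u → Y * X * (h * u) + n * (Y * (X * h)) * u ≡ (Y * X + n * (Y * X)) * (h * u)
    lemma = solve-∀
    bound : Y * X + n * (Y * (X * suc H)) * suc H ^ n ≤ (Y * X + n * (Y * X)) * suc H ^ suc n
    bound = begin
      Y * X + n * (Y * (X * suc H)) * suc H ^ n  ≤⟨ +-monoˡ-≤ _ (m≤m*n (Y * X) (suc H ^ suc n) {{m^n≢0 (suc H) (suc n)}}) ⟩
      Y * X * suc H ^ suc n + n * (Y * (X * suc H)) * suc H ^ n  ≡⟨ lemma n Y X (suc H) (suc H ^ n) ⟩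
      (Y * X + n * (Y * X)) * suc H ^ suc n  ∎

  one : Poly → Poly
  one []       = []
  one (_ ∷ cs) = pos 1 ∷ zeros cs

  length-one : ∀ cs → length (one cs) ≡ length cs
  length-one []       = refl
  length-one (_ ∷ cs) = cong suc (length-map _ cs)

  eval-one : ∀ cs t → 1 ≤ length cs → eval (one cs) t ≡ pos 1
  eval-one (_ ∷ cs) t _ rewrite eval-zeros cs t = cong (ℤ._+_ (pos 1)) (ℤ.*-zeroʳ t)

  separator-step : ∀ {p q} → Dec (q ≡ p) → ℕ → Poly → Poly
  separator-step         (yes _) s z = addP (mulT z) (scaleP (ℤ.- pos s) z)
  separator-step {q = q} (no  _) s z = scaleP (pos q) z

  -- Modulo `f` this is the product over S of X - s for the pairs (p, s) and of q for the pairs (q,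
  -- s) with q ≠ p. It vanishes at every pair of S, but modulo p at no root of `f` outside S, as in
  -- the Chinese remainder theorem.
  separator : ℕ → List (ℕ × ℕ) → Poly
  separator p []            = one fs
  separator p ((q , s) ∷ S) = separator-step (q ≟ p) s (separator p S)

  length-separator-step : ∀ {p q} (q≟p : Dec (q ≡ p)) s z → length z ≡ d → length (separator-step q≟p s z) ≡ d
  length-separator-step         (yes _) s z len = length-addP-≡ (mulT z) _ (length-mulT z len) (trans (length-scaleP (ℤ.- pos s) z) len)
  length-separator-step {q = q} (no  _) s z len = trans (length-scaleP (pos q) z) len

  length-separator : ∀ p S → length (separator p S) ≡ d
  length-separator p []            = length-one fs
  length-separator p ((q , s) ∷ S) = length-separator-step (q ≟ p) s (separator p S) (length-separator p S)

  -- Such a pair is the prime ideal (p, X - r) of ℤ[X]/(f), with residue field of p elements: as p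
  -- divides f(r), evaluation at r modulo p is well defined modulo `f`.
  Good : ℕ × ℕ → Set
  Good (p , r) = Prime p × r < p × pos p ∣ℤ eval f (pos r)

  private
    eval-linear : ∀ z s t → length z ≡ d → eval (addP (mulT z) (scaleP (ℤ.- s) z)) t ≡
                  (t ℤ.- s) ℤ.* eval z t ℤ.- carry 0ℤ z ℤ.* eval f t
    eval-linear z s t len = trans (eval-addP (mulT z) (scaleP (ℤ.- s) z) t) (trans (cong₂ ℤ._+_ (eval-mulT z t len) (eval-scaleP (ℤ.- s) z t))
      (lemma t (eval z t) (carry 0ℤ z ℤ.* eval f t) s))
      where
      lemma : ∀ t z u s → t ℤ.* z ℤ.- u ℤ.+ ℤ.- s ℤ.* z ≡ (t ℤ.- s) ℤ.* z ℤ.- u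
      lemma = ℤ-solve-∀

    step-vanishes-head : ∀ {p q} (q≟p : Dec (q ≡ p)) s z → length z ≡ d → pos q ∣ℤ eval f (pos s) →
                         pos q ∣ℤ eval (separator-step q≟p s z) (pos s)
    step-vanishes-head {q = q} (yes _) s z len q∣f = subst (pos q ∣ℤ_) (sym (eval-linear z (pos s) (pos s) len))
      (ℤ∣.∣m∣n⇒∣m-n {m = (pos s ℤ.- pos s) ℤ.* eval z (pos s)}
        (ℤ∣.∣m⇒∣m*n (eval z (pos s)) (subst (pos q ∣ℤ_) (sym (ℤ.+-inverseʳ (pos s))) (ℤ∣.divides 0ℤ refl)))
        (ℤ∣.∣n⇒∣m*n (carry 0ℤ z) q∣f))
    step-vanishes-head {q = q} (no  _) s z len q∣f = subst (pos q ∣ℤ_) (sym (eval-scaleP (pos q) z (pos s)))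
      (ℤ∣.∣m⇒∣m*n (eval z (pos s)) ℤ∣.∣-refl)

    step-vanishes-tail : ∀ {p q} (q≟p : Dec (q ≡ p)) s z {q′ s′} → length z ≡ d → pos q′ ∣ℤ eval z (pos s′) →
                         pos q′ ∣ℤ eval f (pos s′) → pos q′ ∣ℤ eval (separator-step q≟p s z) (pos s′)
    step-vanishes-tail (yes _) s z {q′} {s′} len q′∣z q′∣f = subst (pos q′ ∣ℤ_) (sym (eval-linear z (pos s) (pos s′) len))
      (ℤ∣.∣m∣n⇒∣m-n {m = (pos s′ ℤ.- pos s) ℤ.* eval z (pos s′)}
        (ℤ∣.∣n⇒∣m*n (pos s′ ℤ.- pos s) q′∣z) (ℤ∣.∣n⇒∣m*n (carry 0ℤ z) q′∣f))
    step-vanishes-tail {q = q} (no  _) s z {q′} {s′} len q′∣z q′∣f = subst (pos q′ ∣ℤ_) (sym (eval-scaleP (pos q) z (pos s′)))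
      (ℤ∣.∣n⇒∣m*n (pos q) q′∣z)

    step-separates : ∀ {p q} (q≟p : Dec (q ≡ p)) s z {r} → length z ≡ d → Prime p → Prime q → r < p → s < q → ¬ (p , r) ≡ (q , s) →
                     pos p ∣ℤ eval f (pos r) → pos p ∣ℤ eval (separator-step q≟p s z) (pos r) → pos p ∣ℤ eval z (pos r)
    step-separates {p} (yes refl) s z {r} len p-prime q-prime r<p s<q ≢ p∣f p∣ = cases (euclidℤ p-prime (pos r ℤ.- pos s) (eval z (pos r)) p∣product)
      where
      lemma : ∀ x y → x ℤ.- y ℤ.+ y ≡ x
      lemma = ℤ-solve-∀
      p∣product : pos p ∣ℤ (pos r ℤ.- pos s) ℤ.* eval z (pos r)
      p∣product = subst (pos p ∣ℤ_) (lemma ((pos r ℤ.- pos s) ℤ.* eval z (pos r)) (carry 0ℤ z ℤ.* eval f (pos r)))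
        (ℤ∣.∣m∣n⇒∣m+n {m = (pos r ℤ.- pos s) ℤ.* eval z (pos r) ℤ.- carry 0ℤ z ℤ.* eval f (pos r)}
          (subst (pos p ∣ℤ_) (eval-linear z (pos s) (pos r) len) p∣) (ℤ∣.∣n⇒∣m*n (carry 0ℤ z) p∣f))
      cases : pos p ∣ℤ pos r ℤ.- pos s ⊎ pos p ∣ℤ eval z (pos r) → pos p ∣ℤ eval z (pos r)
      cases (inj₁ p∣r-s) = contradiction (cong (p ,_) (∣pos-difference⇒≡ r<p s<q p∣r-s)) ≢
      cases (inj₂ p∣z)   = p∣z
    step-separates {p} {q} (no q≢p) s z {r} len p-prime q-prime r<p s<q ≢ p∣f p∣ =
      cases (euclidℤ p-prime (pos q) (eval z (pos r)) (subst (pos p ∣ℤ_) (eval-scaleP (pos q) z (pos r)) p∣))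
      where
      cases : pos p ∣ℤ pos q ⊎ pos p ∣ℤ eval z (pos r) → pos p ∣ℤ eval z (pos r)
      cases (inj₁ p∣q) = contradiction (sym (prime-∣-prime p-prime q-prime (ℤ∣.∣⇒∣ᵤ p∣q))) q≢p
      cases (inj₂ p∣z) = p∣z

  separator-vanishes : ∀ p S → All Good S → ∀ {q s} → (q , s) ∈ S → pos q ∣ℤ eval (separator p S) (pos s)
  separator-vanishes p ((q , s) ∷ S) (good ∷ goods) (here refl) =
    step-vanishes-head (q ≟ p) s (separator p S) (length-separator p S) (proj₂ (proj₂ good))
  separator-vanishes p ((q , s) ∷ S) (good ∷ goods) {q′} {s′} (there i) =
    step-vanishes-tail (q ≟ p) s (separator p S) {q′} {s′} (length-separator p S) (separator-vanishes p S goods i) (proj₂ (proj₂ (All.lookup goods i)))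

  separator-separates : ∀ {p r} S → Good (p , r) → All Good S → ¬ (p , r) ∈ S → ¬ pos p ∣ℤ eval (separator p S) (pos r)
  separator-separates {p} {r} [] (p-prime , _) _ _ p∣1 =
    ¬prime[1] (subst Prime (∣1⇒≡1 (ℤ∣.∣⇒∣ᵤ (subst (pos p ∣ℤ_) (eval-one fs (pos r) 1≤d) p∣1))) p-prime)
  separator-separates {p} {r} ((q , s) ∷ S) good@(p-prime , r<p , p∣f) ((q-prime , s<q , _) ∷ goods) ∉S p∣ =
    separator-separates S good goods (∉S ∘ there)
      (step-separates (q ≟ p) s (separator p S) (length-separator p S) p-prime q-prime r<p s<q (∉S ∘ here) p∣f p∣)

  moduli : List (ℕ × ℕ) → List ℕ
  moduli = map proj₁

  -- Representatives of distinct residue classes modulo the ideal of elements vanishing at S, in mixed radix.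
  rep : List (ℕ × ℕ) → List ℕ → Poly
  rep ((p , r) ∷ S) (c ∷ cs) = addP (scaleP (pos c) (separator p S)) (rep S cs)
  rep _             _        = zeros fs

  length-rep : ∀ S cs → length (rep S cs) ≡ d
  length-rep []            cs       = length-map _ fs
  length-rep ((p , r) ∷ S) []       = length-map _ fs
  length-rep ((p , r) ∷ S) (c ∷ cs) = length-addP-≡ (scaleP (pos c) (separator p S)) _
    (trans (length-scaleP (pos c) (separator p S)) (length-separator p S)) (length-rep S cs)

  rep-bound : List (ℕ × ℕ) → ℕ
  rep-bound []            = 0
  rep-bound ((p , r) ∷ S) = p * height (separator p S) + rep-bound S

  Bounded-rep : ∀ S {cs} → Pointwise _<_ cs (moduli S) → Bounded (rep-bound S) (rep S cs)
  Bounded-rep []            []           = Bounded-zeros fs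
  Bounded-rep ((p , r) ∷ S) {c ∷ _} (c<p ∷ rest) = Bounded-addP (Bounded-scaleP (pos c) (<⇒≤ c<p) (Bounded-height (separator p S))) (Bounded-rep S rest)

  -- The system is triangular. The first separator vanishes at all later pairs, so the later digits
  -- are determined by induction; at (p, r) it is a unit modulo p, which determines the first digit.
  rep-injective : ∀ S → Unique S → All Good S → ∀ {cs cs′} → Pointwise _<_ cs (moduli S) → Pointwise _<_ cs′ (moduli S) →
    (∀ {q s} → (q , s) ∈ S → pos q ∣ℤ eval (rep S cs) (pos s) ℤ.- eval (rep S cs′) (pos s)) → cs ≡ cs′
  rep-injective [] _ _ [] [] _ = refl
  rep-injective ((p , r) ∷ S) (∉S ∷ unique) (good ∷ goods) {c ∷ cs} {c′ ∷ cs′} (c<p ∷ <cs) (c′<p ∷ <cs′) congruent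
    with rep-injective S unique goods <cs <cs′ tail-congruent
    where
    z = separator p S
    difference : ∀ t → eval (rep ((p , r) ∷ S) (c ∷ cs)) t ℤ.- eval (rep ((p , r) ∷ S) (c′ ∷ cs′)) t ≡
                 (pos c ℤ.- pos c′) ℤ.* eval z t ℤ.+ (eval (rep S cs) t ℤ.- eval (rep S cs′) t)
    difference t rewrite eval-addP (scaleP (pos c) z) (rep S cs) t | eval-addP (scaleP (pos c′) z) (rep S cs′) t
                       | eval-scaleP (pos c) z t | eval-scaleP (pos c′) z t = lemma (pos c) (pos c′) (eval z t) (eval (rep S cs) t) (eval (rep S cs′) t)
      where
      lemma : ∀ c c′ z a b → c ℤ.* z ℤ.+ a ℤ.- (c′ ℤ.* z ℤ.+ b) ≡ (c ℤ.- c′) ℤ.* z ℤ.+ (a ℤ.- b)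
      lemma = ℤ-solve-∀
    tail-congruent : ∀ {q s} → (q , s) ∈ S → pos q ∣ℤ eval (rep S cs) (pos s) ℤ.- eval (rep S cs′) (pos s)
    tail-congruent {q} {s} i = ℤ∣.∣m+n∣m⇒∣n (subst (pos q ∣ℤ_) (difference (pos s)) (congruent (there i)))
      (ℤ∣.∣n⇒∣m*n (pos c ℤ.- pos c′) (separator-vanishes p S goods i))
  ... | refl with euclidℤ (proj₁ good) (pos c ℤ.- pos c′) (eval (separator p S) (pos r))
                    (subst (pos p ∣ℤ_) difference (congruent (here refl)))
    where
    z = separator p S
    difference : eval (rep ((p , r) ∷ S) (c ∷ cs)) (pos r) ℤ.- eval (rep ((p , r) ∷ S) (c′ ∷ cs)) (pos r) ≡
                 (pos c ℤ.- pos c′) ℤ.* eval z (pos r)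
    difference rewrite eval-addP (scaleP (pos c) z) (rep S cs) (pos r) | eval-addP (scaleP (pos c′) z) (rep S cs) (pos r)
                     | eval-scaleP (pos c) z (pos r) | eval-scaleP (pos c′) z (pos r) = lemma (pos c) (pos c′) (eval z (pos r)) (eval (rep S cs) (pos r))
      where
      lemma : ∀ c c′ z a → c ℤ.* z ℤ.+ a ℤ.- (c′ ℤ.* z ℤ.+ a) ≡ (c ℤ.- c′) ℤ.* z
      lemma = ℤ-solve-∀
  ...   | inj₁ p∣c-c′ = cong (_∷ cs) (∣pos-difference⇒≡ c<p c′<p p∣c-c′)
  ...   | inj₂ p∣z    = contradiction p∣z (separator-separates S good goods (λ i → All.lookup ∉S i refl))

  -- From 1 + 2B ≤ X·K₀·Y in `norm-bound`: the 3 absorbs the 1 and two copies of the bound for the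
  -- representatives, and the rest is two copies of the bound for x·y.
  K₀ : ℕ
  K₀ = 3 + 2 * (d * suc H ^ d)

  -- The ideal of elements vanishing at S has index ∏ p and contains the multiples of x; comparing the number
  -- of points rep + x·y in a large box with the size of the box bounds the index.
  norm-bound : ∀ x X S → length x ≡ d → Bounded X x → 1 ≤ X → ¬ (∀ t → eval x t ≡ 0ℤ) → Unique S → All Good S →
    (∀ {p r} → (p , r) ∈ S → pos p ∣ℤ eval x (pos r)) → product (moduli S) ≤ (X * K₀) ^ d
  norm-bound x X S len bx 1≤X x≢0 unique goods vanish = *-cancelʳ-≤ _ _ (Y ^ d) {{m^n≢0 Y d}} (begin
    product (moduli S) * Y ^ d  ≡⟨ cong₂ _*_ (length-boxes (moduli S)) (trans (length-boxes (replicate d Y)) (product-replicate d Y)) ⟨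
    length (boxes (moduli S)) * length (boxes (replicate d Y))  ≡⟨ length-cartesianProductWith _,_ (boxes (moduli S)) (boxes (replicate d Y)) ⟨
    length xs  ≤⟨ pigeonhole xs (boxes (replicate d (suc (B + B)))) key
                                                                      (Unique.cartesianProduct⁺ (boxes-unique (moduli S)) (boxes-unique (replicate d Y))) into inj ⟩
    length (boxes (replicate d (suc (B + B))))  ≡⟨ trans (length-boxes (replicate d (suc (B + B)))) (product-replicate d (suc (B + B))) ⟩
    suc (B + B) ^ d  ≤⟨ ^-monoˡ-≤ d size ⟩
    (X * K₀ * Y) ^ d  ≡⟨ ^-distribʳ-* d (X * K₀) Y ⟩
    (X * K₀) ^ d * Y ^ d  ∎)
    where
    open ≤-Reasoning
    Z = rep-bound S
    -- The size of the representatives is not controlled. A box for `y` of side larger than `Z`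
    -- makes this harmless, because `Y ^ d` cancels in the end.
    Y = suc Z
    B = Z + d * (Y * X) * suc H ^ d
    xs = cartesianProduct (boxes (moduli S)) (boxes (replicate d Y))
    element : List ℕ × List ℕ → Poly
    element (cs , ys) = addP (rep S cs) (φ x (map pos ys))
    -- Adding `B` turns coefficients between -B and B into natural numbers below 2B + 1 without loss
    -- of information.
    key : List ℕ × List ℕ → List ℕ
    key = map (λ a → ∣ a ℤ.+ pos B ∣) ∘ element
    size : suc (B + B) ≤ X * K₀ * Y
    size = begin
      suc (Z + E + (Z + E))  ≤⟨ s≤s (+-mono-≤ (+-monoˡ-≤ E (n≤1+n Z)) (+-monoˡ-≤ E (n≤1+n Z))) ⟩
      1 + (Y + E + (Y + E))  ≤⟨ +-mono-≤ 1≤XY (+-mono-≤ (+-monoˡ-≤ E Y≤XY) (+-monoˡ-≤ E Y≤XY)) ⟩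
      X * Y + (X * Y + E + (X * Y + E))  ≡⟨ lemma X Y d (suc H ^ d) ⟩
      X * K₀ * Y  ∎
      where
      E = d * (Y * X) * suc H ^ d
      Y≤XY : Y ≤ X * Y
      Y≤XY = m≤n*m Y X {{>-nonZero 1≤X}}
      1≤XY : 1 ≤ X * Y
      1≤XY = ≤-trans (s≤s z≤n) Y≤XY
      lemma : ∀ X Y d h → X * Y + (X * Y + d * (Y * X) * h + (X * Y + d * (Y * X) * h)) ≡ X * (3 + 2 * (d * h)) * Y
      lemma = solve-∀
    members : ∀ {cs ys} → (cs , ys) ∈ xs → Pointwise _<_ cs (moduli S) × length ys ≡ d × All (_< Y) ys
    members i = let cs∈ , ys∈ = ∈-cartesianProduct⁻ (boxes (moduli S)) (boxes (replicate d Y)) i in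
                ∈-boxes⁻ (moduli S) cs∈ , ∈-boxes-replicate⁻ d ys∈
    Bounded-pos : ∀ {ys} → All (_< Y) ys → Bounded Y (map pos ys)
    Bounded-pos []         = []
    Bounded-pos (y<Y ∷ ys) = <⇒≤ y<Y ∷ Bounded-pos ys
    bounded : ∀ z → z ∈ xs → Bounded B (element z)
    bounded (cs , ys) i with members i
    ... | cs< , len-ys , ys< = Bounded-addP (Bounded-rep S cs<)
            (subst (λ n → Bounded (n * (Y * X) * suc H ^ n) (φ x (map pos ys))) (trans (length-map pos ys) len-ys)
              (Bounded-φ x (map pos ys) bx (Bounded-pos ys<)))
    into : ∀ z → z ∈ xs → key z ∈ boxes (replicate d (suc (B + B)))
    into z@(cs , ys) i = ∈-boxes-replicate⁺
      (trans (length-map _ (element z)) (length-addP-≡ (rep S cs) _ (length-rep S cs) (length-φ x (map pos ys) len)))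
      (small (bounded z i))
      where
      small : ∀ {p} → Bounded B p → All (_< suc (B + B)) (map (λ a → ∣ a ℤ.+ pos B ∣) p)
      small [] = []
      small (_∷_ {x = a} a≤B b) = s≤s (≤-trans (ℤ.∣i+j∣≤∣i∣+∣j∣ a (pos B)) (+-monoˡ-≤ B a≤B)) ∷ small b
    x-Bézout : Bézout x
    x-Bézout = Bézout-nonzero x (≤-reflexive len) x≢0
    inj : ∀ z z′ → z ∈ xs → z′ ∈ xs → key z ≡ key z′ → z ≡ z′
    inj z@(cs , ys) z′@(cs′ , ys′) i i′ key≡ with members i | members i′
    ... | cs< , len-ys , ys< | cs′< , len-ys′ , ys′< = conclude (rep-injective S unique goods cs< cs′< congruent)
      where
      element≡ : element z ≡ element z′
      element≡ = map-shift-injective (element z) (element z′) (bounded z i) (bounded z′ i′) key≡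
      sum≡ : ∀ t → eval (rep S cs) t ℤ.+ eval (φ x (map pos ys)) t ≡ eval (rep S cs′) t ℤ.+ eval (φ x (map pos ys′)) t
      sum≡ t = trans (sym (eval-addP (rep S cs) _ t)) (trans (cong (λ e → eval e t) element≡) (eval-addP (rep S cs′) _ t))
      φ-vanishes : ∀ ys {q s} → (q , s) ∈ S → pos q ∣ℤ eval (φ x ys) (pos s)
      φ-vanishes ys {q} {s} j with eval-φ x ys (pos s) len
      ... | g , eq = subst (pos q ∣ℤ_) (sym eq) (∣ℤ-*-+-* (eval ys (pos s)) _ g _ (vanish j) (proj₂ (proj₂ (All.lookup goods j))))
      rearrange : ∀ a b c e → a ℤ.+ b ≡ c ℤ.+ e → a ℤ.- c ≡ e ℤ.- b
      rearrange a b c e eq = trans (lemma a b c) (trans (cong (λ u → u ℤ.- b ℤ.- c) eq) (lemma′ c e b))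
        where
        lemma : ∀ a b c → a ℤ.- c ≡ a ℤ.+ b ℤ.- b ℤ.- c
        lemma = ℤ-solve-∀
        lemma′ : ∀ c e b → c ℤ.+ e ℤ.- b ℤ.- c ≡ e ℤ.- b
        lemma′ = ℤ-solve-∀
      congruent : ∀ {q s} → (q , s) ∈ S → pos q ∣ℤ eval (rep S cs) (pos s) ℤ.- eval (rep S cs′) (pos s)
      congruent {q} {s} j = subst (pos q ∣ℤ_) (sym (rearrange (eval (rep S cs) (pos s)) _ (eval (rep S cs′) (pos s)) _ (sum≡ (pos s))))
        (ℤ∣.∣m∣n⇒∣m-n (φ-vanishes (map pos ys′) j) (φ-vanishes (map pos ys) j))
      -- Once the digits agree, the representatives cancel, so `f` divides (y - y′)·x, and `x` can
      -- be cancelled.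
      conclude : cs ≡ cs′ → z ≡ z′
      conclude refl = cong (cs ,_) (difference-coeff≡0⇒≡ ys ys′ (trans len-ys (sym len-ys′)) coeffs)
        where
        P = addP (map pos ys) (scaleP (ℤ.- pos 1) (map pos ys′))
        len-P : length P ≤ d
        len-P = ≤-reflexive (length-addP-≡ (map pos ys) _ (trans (length-map pos ys) len-ys)
                  (trans (length-scaleP (ℤ.- pos 1) (map pos ys′)) (trans (length-map pos ys′) len-ys′)))
        multiple : ∀ t → ∃[ g ] eval P (pos t) ℤ.* eval x (pos t) ≡ g ℤ.* eval f (pos t)
        multiple t with eval-φ x (map pos ys) (pos t) len | eval-φ x (map pos ys′) (pos t) len
        ... | g , eq | g′ , eq′ = g′ ℤ.- g , trans (cong (ℤ._* eval x (pos t)) (trans (eval-addP (map pos ys) _ (pos t))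
                (cong (ℤ._+_ (eval (map pos ys) (pos t))) (eval-scaleP (ℤ.- pos 1) (map pos ys′) (pos t)))))
                (solve (eval (map pos ys) (pos t)) (eval (map pos ys′) (pos t)) (eval x (pos t)) g g′ (eval f (pos t))
                  (trans (sym eq) (trans (ℤ-+-cancelˡ (eval (rep S cs) (pos t)) _ _ (sum≡ (pos t))) eq′)))
          where
          solve : ∀ y y′ x g g′ f → y ℤ.* x ℤ.+ g ℤ.* f ≡ y′ ℤ.* x ℤ.+ g′ ℤ.* f → (y ℤ.+ ℤ.- pos 1 ℤ.* y′) ℤ.* x ≡ (g′ ℤ.- g) ℤ.* f
          solve y y′ x g g′ f e = trans (lemma y y′ x g f) (trans (cong (λ u → u ℤ.- y′ ℤ.* x ℤ.- g ℤ.* f) e) (lemma′ y′ x g g′ f))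
            where
            lemma : ∀ y y′ x g f → (y ℤ.+ ℤ.- pos 1 ℤ.* y′) ℤ.* x ≡ y ℤ.* x ℤ.+ g ℤ.* f ℤ.- y′ ℤ.* x ℤ.- g ℤ.* f
            lemma = ℤ-solve-∀
            lemma′ : ∀ y′ x g g′ f → y′ ℤ.* x ℤ.+ g′ ℤ.* f ℤ.- y′ ℤ.* x ℤ.- g ℤ.* f ≡ (g′ ℤ.- g) ℤ.* f
            lemma′ = ℤ-solve-∀
        coeffs : ∀ n → coeff P n ≡ 0ℤ
        coeffs = cancel-nonzero-factor x x-Bézout P len-P multiple

-- The average number of roots modulo p

pairs : {α β : Set} → List α → (α → List β) → List (α × β)
pairs []       k = []
pairs (x ∷ xs) k = map (x ,_) (k x) ++ pairs xs k

∈-pairs⁻ : ∀ {α β : Set} (xs : List α) (k : α → List β) {x y} → (x , y) ∈ pairs xs k → x ∈ xs × y ∈ k x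
∈-pairs⁻ (x ∷ xs) k i with ∈-++⁻ (map (x ,_) (k x)) i
... | inj₁ j with ∈-map⁻ (x ,_) j
...   | y , y∈ , refl = here refl , y∈
∈-pairs⁻ (x ∷ xs) k i | inj₂ j = let x∈ , y∈ = ∈-pairs⁻ xs k j in there x∈ , y∈

pairs-unique : ∀ {α β : Set} (xs : List α) (k : α → List β) → Unique xs → (∀ x → Unique (k x)) → Unique (pairs xs k)
pairs-unique []       k []             uniq = []
pairs-unique (x ∷ xs) k (x∉ ∷ unique) uniq = Unique.++⁺ (Unique.map⁺ (cong proj₂) (uniq x)) (pairs-unique xs k unique uniq) disjoint
  where
  disjoint : ∀ {v} → ¬ (v ∈ map (x ,_) (k x) × v ∈ pairs xs k)
  disjoint (i , j) with ∈-map⁻ (x ,_) i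
  ... | y , y∈ , refl = All.lookup x∉ (proj₁ (∈-pairs⁻ xs k j)) refl

∏-pairs : ∀ {α β : Set} (xs : List α) (k : α → List β) (g : α × β → ℕ) → ∏ (pairs xs k) g ≡ ∏ xs (λ x → ∏ (k x) (λ y → g (x , y)))
∏-pairs []       k g = refl
∏-pairs (x ∷ xs) k g = trans (∏-++ (map (x ,_) (k x)) (pairs xs k) g) (cong₂ _*_ (∏-map (x ,_) (k x) g) (∏-pairs xs k g))

^-cancel-≤ : ∀ n {a b} → 1 ≤ n → a ^ n ≤ b ^ n → a ≤ b
^-cancel-≤ n {a} {b} 1≤n a^n≤b^n with a ≤? b
... | yes a≤b = a≤b
... | no  a≰b = contradiction a^n≤b^n (<⇒≱ (^-monoˡ-< n {{>-nonZero 1≤n}} (≰⇒> a≰b)))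

2kn≤n²+k² : ∀ k n → 2 * (k * n) ≤ n * n + k * k
2kn≤n²+k² k n with ≤-total k n
... | inj₁ k≤n with m≤n⇒∃[o]m+o≡n k≤n
...   | u , refl = subst (2 * (k * (k + u)) ≤_) (sym (lemma k u)) (m≤m+n _ (u * u))
  where
  lemma : ∀ k u → (k + u) * (k + u) + k * k ≡ 2 * (k * (k + u)) + u * u
  lemma = solve-∀
2kn≤n²+k² k n | inj₂ n≤k with m≤n⇒∃[o]m+o≡n n≤k
...   | u , refl = subst (2 * ((n + u) * n) ≤_) (sym (lemma n u)) (m≤m+n _ (u * u))
  where
  lemma : ∀ n u → n * n + (n + u) * (n + u) ≡ 2 * ((n + u) * n) + u * u
  lemma = solve-∀

∑-ι-≟ : ∀ p a (g : ℕ → ℕ) → a < p → ∑ (downFrom p) (λ c → ι (a ≟ c) * g c) ≡ g a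
∑-ι-≟ (suc p) a g a<p with a ≟ p
... | yes refl = trans (cong₂ _+_ (+-identityʳ (g p)) (trans (∑-cong (downFrom p) (λ c c∈ → cong (_* g c) (ι-no (p ≟ c) (λ { refl → <-irrefl refl (∈-downFrom⁻ c∈) })))) (∑-zero (downFrom p)))) (+-identityʳ (g p))
... | no a≢p = ∑-ι-≟ p a g (≤∧≢⇒< (≤-pred a<p) a≢p)

-- Cauchy–Schwarz: the number of pairs with equal keys is least when the keys are equidistributed.
collisions : ∀ {α : Set} (xs : List α) (key : α → ℕ) p → 1 ≤ p → (∀ x → key x < p) →
  length xs * (length xs ÷ p) ≤ ∑ xs (λ x → ∑ xs (λ y → ι (key x ≟ key y)))
collisions {α} xs key p 1≤p key<p = +-cancelʳ-≤ (N * k) _ _ (begin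
  N * k + N * k  ≡⟨ lemma N k ⟩
  2 * (k * N)  ≡⟨ cong (λ z → 2 * (k * z)) (sym total) ⟩
  2 * (k * ∑ (downFrom p) n)  ≡⟨ trans (sym (*-assoc 2 k _)) (sym (∑-*ˡ (downFrom p) (2 * k) n)) ⟩
  ∑ (downFrom p) (λ c → 2 * k * n c)  ≤⟨ ∑-mono (downFrom p) (λ c _ → ≤-trans (≤-reflexive (*-assoc 2 k (n c))) (2kn≤n²+k² k (n c))) ⟩
  ∑ (downFrom p) (λ c → n c * n c + k * k)  ≡⟨ ∑-+ (downFrom p) (λ c → n c * n c) (λ _ → k * k) ⟩
  ∑ (downFrom p) (λ c → n c * n c) + ∑ (downFrom p) (λ _ → k * k)  ≡⟨ cong₂ _+_ squares (trans (∑-const (downFrom p) (k * k)) (cong (_* (k * k)) (length-downFrom p))) ⟩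
  ∑ xs (λ x → ∑ xs (λ y → ι (key x ≟ key y))) + p * (k * k)  ≤⟨ +-monoʳ-≤ _ pk²≤Nk ⟩
  ∑ xs (λ x → ∑ xs (λ y → ι (key x ≟ key y))) + N * k  ∎)
  where
  open ≤-Reasoning
  N = length xs
  -- The mean size of a class, rounded down. Summing 2kn ≤ n² + k² over the p classes bounds the sum
  -- of squares below by 2kN - pk² ≥ kN, so that the rounding does no harm.
  k = N ÷ p
  n : ℕ → ℕ
  n c = ∑ xs (λ x → ι (key x ≟ c))
  lemma : ∀ N k → N * k + N * k ≡ 2 * (k * N)
  lemma = solve-∀
  pk²≤Nk : p * (k * k) ≤ N * k
  pk²≤Nk = ≤-trans (≤-reflexive (trans (sym (*-assoc p k k)) (cong (_* k) (*-comm p k)))) (*-monoˡ-≤ k (÷-*-≤ N p))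
  total : ∑ (downFrom p) n ≡ N
  total = trans (∑-swap (downFrom p) xs (λ c x → ι (key x ≟ c))) (trans
    (∑-cong xs (λ x _ → trans (∑-cong (downFrom p) (λ c _ → sym (*-identityʳ _))) (∑-ι-≟ p (key x) (const 1) (key<p x))))
    (trans (∑-const xs 1) (*-identityʳ N)))
  ι-sym : ∀ a b → ι (a ≟ b) ≡ ι (b ≟ a)
  ι-sym a b = ≤-antisym (ι-mono (a ≟ b) (b ≟ a) sym) (ι-mono (b ≟ a) (a ≟ b) sym)
  squares : ∑ (downFrom p) (λ c → n c * n c) ≡ ∑ xs (λ x → ∑ xs (λ y → ι (key x ≟ key y)))
  squares = begin-equality
    ∑ (downFrom p) (λ c → n c * n c)
      ≡⟨ ∑-cong (downFrom p) (λ c _ → trans (sym (∑-*ˡ xs (n c) (λ x → ι (key x ≟ c)))) (∑-cong xs (λ x _ → *-comm (n c) _))) ⟩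
    ∑ (downFrom p) (λ c → ∑ xs (λ x → ι (key x ≟ c) * n c))
      ≡⟨ ∑-swap (downFrom p) xs (λ c x → ι (key x ≟ c) * n c) ⟩
    ∑ xs (λ x → ∑ (downFrom p) (λ c → ι (key x ≟ c) * n c))
      ≡⟨ ∑-cong xs (λ x _ → ∑-ι-≟ p (key x) n (key<p x)) ⟩
    ∑ xs (λ x → ∑ xs (λ y → ι (key y ≟ key x)))
      ≡⟨ ∑-cong xs (λ x _ → ∑-cong xs (λ y _ → ι-sym (key y) (key x))) ⟩
    ∑ xs (λ x → ∑ xs (λ y → ι (key x ≟ key y))) ∎

rem : ℕ → ℕ → ℕ
rem a zero    = 0
rem a (suc p) = a % suc p

rem< : ∀ a p → 1 ≤ p → rem a p < p
rem< a (suc p) _ = m%n<n a (suc p)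

rem≡⇒∣ : ∀ a b p → 1 ≤ p → rem a p ≡ rem b p → pos p ∣ℤ pos a ℤ.- pos b
rem≡⇒∣ a b (suc p) _ eq = ℤ∣.divides (pos qa ℤ.- pos qb) (begin
  pos a ℤ.- pos b  ≡⟨ cong₂ (λ x y → pos x ℤ.- pos y) (m≡m%n+[m/n]*n a (suc p)) (m≡m%n+[m/n]*n b (suc p)) ⟩
  pos (ra + qa * suc p) ℤ.- pos (rb + qb * suc p)  ≡⟨ cong (λ z → pos (z + qa * suc p) ℤ.- pos (rb + qb * suc p)) eq ⟩
  pos (rb + qa * suc p) ℤ.- pos (rb + qb * suc p)  ≡⟨ cong₂ ℤ._-_ (push rb qa) (push rb qb) ⟩
  pos rb ℤ.+ pos qa ℤ.* P ℤ.- (pos rb ℤ.+ pos qb ℤ.* P) ≡⟨ lemma (pos rb) (pos qa) (pos qb) P ⟩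
  (pos qa ℤ.- pos qb) ℤ.* P  ∎)
  where
  open ≡-Reasoning
  P = pos (suc p)
  qa = a / suc p
  qb = b / suc p
  ra = a % suc p
  rb = b % suc p
  push : ∀ r q → pos (r + q * suc p) ≡ pos r ℤ.+ pos q ℤ.* P
  push r q = trans (ℤ.pos-+ r (q * suc p)) (cong (ℤ._+_ (pos r)) (ℤ.pos-* q (suc p)))
  lemma : ∀ r a b P → r ℤ.+ a ℤ.* P ℤ.- (r ℤ.+ b ℤ.* P) ≡ (a ℤ.- b) ℤ.* P
  lemma = ℤ-solve-∀

evalℕ : List ℕ → ℕ → ℕ
evalℕ []       t = 0
evalℕ (a ∷ xs) t = a + t * evalℕ xs t

eval-map-pos : ∀ xs t → eval (map pos xs) (pos t) ≡ pos (evalℕ xs t)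
eval-map-pos []       t = refl
eval-map-pos (a ∷ xs) t rewrite eval-map-pos xs t =
  trans (cong (ℤ._+_ (pos a)) (sym (ℤ.pos-* t (evalℕ xs t)))) (sym (ℤ.pos-+ a (t * evalℕ xs t)))

-- The size of a box is a d-th power. Induction on N: X is raised by one only if X^d is less than
-- the new N, and then X + 1 ≤ 2X costs at most the factor 2^d.
root-approximation : ∀ d N → 1 ≤ d → 1 ≤ N → ∃[ X ] (1 ≤ X × N ≤ X ^ d × X ^ d ≤ 2 ^ d * N)
root-approximation d (suc zero) 1≤d _ = 1 , ≤-refl , ≤-reflexive (sym (^-zeroˡ d)) , ≤-trans (≤-reflexive (^-zeroˡ d)) (≤-trans (m^n>0 2 d) (≤-reflexive (sym (*-identityʳ _))))
root-approximation d (suc (suc N)) 1≤d _ with root-approximation d (suc N) 1≤d (s≤s z≤n)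
... | X , 1≤X , N≤X^d , X^d≤ with suc (suc N) ≤? X ^ d
... | yes N+1≤X^d = X , 1≤X , N+1≤X^d , ≤-trans X^d≤ (*-monoʳ-≤ (2 ^ d) (n≤1+n (suc N)))
... | no  N+1≰X^d = suc X , s≤s z≤n , ≤-trans (s≤s N≤X^d) (^-monoˡ-< d {{>-nonZero 1≤d}} (n<1+n X)) , (begin
    suc X ^ d  ≤⟨ ^-monoˡ-≤ d (subst (suc X ≤_) (cong (X +_) (sym (+-identityʳ X))) (+-monoˡ-≤ X 1≤X)) ⟩
    (2 * X) ^ d  ≡⟨ ^-distribʳ-* d 2 X ⟩
    2 ^ d * X ^ d  ≤⟨ *-monoʳ-≤ (2 ^ d) (<⇒≤ (≰⇒> N+1≰X^d)) ⟩
    2 ^ d * suc (suc N)  ∎)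
  where open ≤-Reasoning

module RootAverage (fs : Poly) (irreducible : Irreducible (snoc fs (pos 1))) (1≤d : 1 ≤ length fs) where

  open MonicIrreducible fs irreducible using (f; d)
  open NormBound fs irreducible 1≤d using (K₀; norm-bound; Good; moduli)

  ρ : ℕ → ℕ
  ρ p = length (roots f p)

  rootPairs : ℕ → List (ℕ × ℕ)
  rootPairs Y = pairs (filter prime? (oneTo Y)) (roots f)

  rootPairs-unique : ∀ Y → Unique (rootPairs Y)
  rootPairs-unique Y = pairs-unique _ (roots f) (Unique.filter⁺ prime? (oneTo-unique Y)) (roots-unique f)

  rootPairs-good : ∀ Y {p r} → (p , r) ∈ rootPairs Y → Good (p , r)
  rootPairs-good Y {p} i = let p∈ , r∈ = ∈-pairs⁻ (filter prime? (oneTo Y)) (roots f) i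
                               r<p , p∣ = ∈-roots⁻ f {p} r∈
    in proj₂ (∈-filter⁻ prime? {xs = oneTo Y} p∈) , r<p , ℤ∣.∣ᵤ⇒∣ p∣

  ∏-rootPairs : ∀ Y (a : ℕ → ℕ) → ∏ (rootPairs Y) (λ (p , r) → p ^ a p) ≡ ∏ (oneTo Y) (λ p → prime^ p ^ (ρ p * a p))
  ∏-rootPairs Y a = begin
    ∏ (rootPairs Y) (λ (p , r) → p ^ a p)  ≡⟨ ∏-pairs (filter prime? (oneTo Y)) (roots f) _ ⟩
    ∏ (filter prime? (oneTo Y)) (λ p → ∏ (roots f p) (λ _ → p ^ a p))  ≡⟨ ∏-filter prime? (oneTo Y) _ ⟩
    ∏ (oneTo Y) (λ p → ∏ (roots f p) (λ _ → p ^ a p) ^ ι (prime? p))  ≡⟨ ∏-cong (oneTo Y) (λ p _ → pointwise p) ⟩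
    ∏ (oneTo Y) (λ p → prime^ p ^ (ρ p * a p))  ∎
    where
    open ≡-Reasoning
    pointwise : ∀ p → ∏ (roots f p) (λ _ → p ^ a p) ^ ι (prime? p) ≡ prime^ p ^ (ρ p * a p)
    pointwise p = begin
      ∏ (roots f p) (λ _ → p ^ a p) ^ ι (prime? p)  ≡⟨ cong (_^ ι (prime? p)) (∏-const (roots f p) (p ^ a p)) ⟩
      ((p ^ a p) ^ ρ p) ^ ι (prime? p)  ≡⟨ cong (_^ ι (prime? p)) (trans (^-*-assoc p (a p) (ρ p)) (cong (p ^_) (*-comm (a p) (ρ p)))) ⟩
      (p ^ (ρ p * a p)) ^ ι (prime? p)  ≡⟨ ^-swap p (ρ p * a p) (ι (prime? p)) ⟩
      prime^ p ^ (ρ p * a p)  ∎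

  -- The product of the p ^ ρ(p). It bounds the contribution of a diagonal pair (x, x), which is
  -- congruent at every root pair.
  Θ : ℕ → ℕ
  Θ Y = ∏ (rootPairs Y) proj₁

  Θ≥1 : ∀ Y → 1 ≤ Θ Y
  Θ≥1 Y = ∏≥1 (rootPairs Y) (λ (p , r) i → ≤-trans (s≤s z≤n) (prime≥2 (proj₁ (rootPairs-good Y i))))

  Θ-bound : ∀ Y → Θ Y ≤ 16 ^ (Y * d)
  Θ-bound Y = begin
    Θ Y  ≡⟨ ∏-cong (rootPairs Y) (λ (p , r) _ → sym (*-identityʳ p)) ⟩
    ∏ (rootPairs Y) (λ (p , r) → p ^ 1)  ≡⟨ ∏-rootPairs Y (const 1) ⟩
    ∏ (oneTo Y) (λ p → prime^ p ^ (ρ p * 1))  ≤⟨ ∏-mono (oneTo Y) few ⟩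
    ∏ (oneTo Y) (λ p → prime^ p ^ d)  ≡⟨ ∏-^ (oneTo Y) prime^ d ⟩
    θ Y ^ d  ≤⟨ ^-monoˡ-≤ d (θ≤16^ Y) ⟩
    (16 ^ Y) ^ d  ≡⟨ ^-*-assoc 16 Y d ⟩
    16 ^ (Y * d)  ∎
    where
    open ≤-Reasoning
    few : ∀ p → p ∈ oneTo Y → prime^ p ^ (ρ p * 1) ≤ prime^ p ^ d
    few p p∈ with prime? p
    ... | yes p-prime = ^-monoʳ-≤ (p ^ 1) {{m^n≢0 p 1 {{>-nonZero (proj₁ (∈-oneTo⁻ p∈))}}}} (≤-trans (≤-reflexive (*-identityʳ (ρ p))) (lagrange fs p p-prime))
    ... | no  _       = ≤-reflexive (trans (^-zeroˡ (ρ p * 1)) (sym (^-zeroˡ d)))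

  module _ (Y X : ℕ) (1≤X : 1 ≤ X) where

    private
      T = rootPairs Y
      box = boxes (replicate d X)
      M = X ^ d

      length-box : length box ≡ M
      length-box = trans (length-boxes (replicate d X)) (product-replicate d X)

      key : ℕ × ℕ → List ℕ → ℕ
      key (p , r) x = rem (evalℕ x r) p

      congruent? : ∀ x y (pr : ℕ × ℕ) → Dec (key pr x ≡ key pr y)
      congruent? x y pr = key pr x ≟ key pr y

      common : List ℕ → List ℕ → ℕ
      common x y = ∏ T (λ pr → proj₁ pr ^ ι (congruent? x y pr))

      common≤Θ : ∀ x y → common x y ≤ Θ Y
      common≤Θ x y = ∏-mono T (λ pr i → power≤ (proj₁ pr) (congruent? x y pr) (prime≥2 (proj₁ (rootPairs-good Y i))))
        where
        power≤ : ∀ {P : Set} p (c : Dec P) → 2 ≤ p → p ^ ι c ≤ p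
        power≤ p (yes _) 2≤p = ≤-reflexive (*-identityʳ p)
        power≤ p (no  _) 2≤p = ≤-trans (s≤s z≤n) 2≤p

      common-distinct : ∀ {x y} → x ∈ box → y ∈ box → ¬ x ≡ y → common x y ≤ (X * K₀) ^ d
      common-distinct {x} {y} x∈ y∈ x≢y = subst (_≤ (X * K₀) ^ d) product≡common
        (norm-bound u X S length-u (bounded x y <x <y (trans len-x (sym len-y))) 1≤X u≢0 (Unique.filter⁺ (congruent? x y) (rootPairs-unique Y))
          (All.tabulate (λ i → rootPairs-good Y (proj₁ (∈-filter⁻ (congruent? x y) {xs = T} i)))) (λ {p} {r} → vanish {p} {r}))
        where
        u = addP (map pos x) (scaleP (ℤ.- pos 1) (map pos y))
        S = filter (congruent? x y) T
        len-x = proj₁ (∈-boxes-replicate⁻ d x∈)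
        len-y = proj₁ (∈-boxes-replicate⁻ d y∈)
        <x = proj₂ (∈-boxes-replicate⁻ d x∈)
        <y = proj₂ (∈-boxes-replicate⁻ d y∈)
        length-u : length u ≡ d
        length-u = length-addP-≡ (map pos x) _ (trans (length-map pos x) len-x) (trans (length-scaleP (ℤ.- pos 1) (map pos y)) (trans (length-map pos y) len-y))
        product≡common : product (moduli S) ≡ common x y
        product≡common = ∏-filter (congruent? x y) T proj₁
        bounded : ∀ x y → All (_< X) x → All (_< X) y → length x ≡ length y → Bounded X (addP (map pos x) (scaleP (ℤ.- pos 1) (map pos y)))
        bounded []      []      _ _ _ = []
        bounded (a ∷ x) (b ∷ y) (a<X ∷ <x) (b<X ∷ <y) eq = small ∷ bounded x y <x <y (suc-injective eq)
          where
          small : ∣ pos a ℤ.+ ℤ.- pos 1 ℤ.* pos b ∣ ≤ X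
          small = ≤-trans (≤-reflexive (cong ∣_∣ (trans (pos-pos a b) (ℤ.m-n≡m⊖n a b))))
            (≤-trans (ℤ.∣m⊝n∣≤m⊔n a b) (⊔-lub (<⇒≤ a<X) (<⇒≤ b<X)))
        u≢0 : ¬ (∀ t → eval u t ≡ 0ℤ)
        u≢0 u≡0 = x≢y (difference-coeff≡0⇒≡ x y (trans len-x (sym len-y)) (eval-vanishes⇒coeff≡0 u 0 (λ t _ → u≡0 (pos t))))
        vanish : ∀ {p r} → (p , r) ∈ S → pos p ∣ℤ eval u (pos r)
        vanish {p} {r} i with ∈-filter⁻ (congruent? x y) {xs = T} i
        ... | i∈T , key≡ = subst (pos p ∣ℤ_) (sym (trans (eval-addP (map pos x) _ (pos r)) (trans (cong₂ ℤ._+_ (eval-map-pos x r)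
                (trans (eval-scaleP (ℤ.- pos 1) (map pos y) (pos r)) (cong (ℤ._*_ (ℤ.- pos 1)) (eval-map-pos y r)))) (pos-pos (evalℕ x r) (evalℕ y r)))))
                (rem≡⇒∣ (evalℕ x r) (evalℕ y r) p (<⇒≤ (prime≥2 (proj₁ (rootPairs-good Y i∈T)))) key≡)

      _≟ₗ_ : (x y : List ℕ) → Dec (x ≡ y)
      _≟ₗ_ = ≡-dec _≟_

      common-bound : ∀ x y → x ∈ box → y ∈ box → common x y ≤ (X * K₀) ^ d * Θ Y ^ ι (y ≟ₗ x)
      common-bound x y x∈ y∈ with y ≟ₗ x
      ... | yes refl = ≤-trans (common≤Θ x x) (≤-trans (≤-reflexive (sym (*-identityʳ (Θ Y))))
              (m≤n*m (Θ Y ^ 1) ((X * K₀) ^ d) {{m^n≢0 (X * K₀) d {{m*n≢0 X K₀ {{>-nonZero 1≤X}}}}}}))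
      ... | no y≢x   = ≤-trans (common-distinct x∈ y∈ (y≢x ∘ sym)) (≤-reflexive (sym (*-identityʳ _)))

      one-occurrence : ∀ x → ∑ box (λ y → ι (y ≟ₗ x)) ≤ 1
      one-occurrence x = subst (_≤ 1) (length-filter≡∑ (_≟ₗ x) box)
        (pigeonhole (filter (_≟ₗ x) box) (x ∷ []) id (Unique.filter⁺ (_≟ₗ x) (boxes-unique (replicate d X)))
          (λ y y∈ → here (proj₂ (∈-filter⁻ (_≟ₗ x) {xs = box} y∈))) (λ _ _ _ _ eq → eq))

    -- Double counting, after raising to the power M. By `collisions` each (p, r) sees at least M·(M
    -- ÷ p) congruent pairs of the box. Conversely, for fixed x each y ≠ x contributes at most
    -- `(X * K₀) ^ d` by the norm bound, and y = x at most `Θ Y`.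
    sparse-average : ∏ T (λ (p , r) → p ^ (M ÷ p)) ≤ (X * K₀) ^ (d * M) * Θ Y
    sparse-average = ^-cancel-≤ M (m^n>0 X {{>-nonZero 1≤X}} d) (begin
      ∏ T (λ (p , r) → p ^ (M ÷ p)) ^ M  ≡⟨ ∏-^ T (λ (p , r) → p ^ (M ÷ p)) M ⟨
      ∏ T (λ (p , r) → (p ^ (M ÷ p)) ^ M)  ≤⟨ ∏-mono T many ⟩
      ∏ T (λ pr → ∏ box (λ x → ∏ box (λ y → proj₁ pr ^ ι (congruent? x y pr))))
                                                                 ≡⟨ ∏-swap T box _ ⟩
      ∏ box (λ x → ∏ T (λ pr → ∏ box (λ y → proj₁ pr ^ ι (congruent? x y pr))))
                                                                 ≡⟨ ∏-cong box (λ x _ → ∏-swap T box _) ⟩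
      ∏ box (λ x → ∏ box (λ y → common x y))  ≤⟨ ∏-mono box (λ x x∈ → ∏-mono box (λ y y∈ → common-bound x y x∈ y∈)) ⟩
      ∏ box (λ x → ∏ box (λ y → (X * K₀) ^ d * Θ Y ^ ι (y ≟ₗ x))) ≤⟨ ∏-mono box (λ x _ → inner x) ⟩
      ∏ box (λ x → (X * K₀) ^ (d * M) * Θ Y)  ≡⟨ ∏-const box _ ⟩
      ((X * K₀) ^ (d * M) * Θ Y) ^ length box  ≡⟨ cong (((X * K₀) ^ (d * M) * Θ Y) ^_) length-box ⟩
      ((X * K₀) ^ (d * M) * Θ Y) ^ M  ∎)
      where
      open ≤-Reasoning
      inner : ∀ x → ∏ box (λ y → (X * K₀) ^ d * Θ Y ^ ι (y ≟ₗ x)) ≤ (X * K₀) ^ (d * M) * Θ Y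
      inner x = begin
        ∏ box (λ y → (X * K₀) ^ d * Θ Y ^ ι (y ≟ₗ x))  ≡⟨ ∏-* box _ _ ⟩
        ∏ box (λ y → (X * K₀) ^ d) * ∏ box (λ y → Θ Y ^ ι (y ≟ₗ x))  ≡⟨ cong₂ _*_ (∏-const box _) (sym (^-∑ box (Θ Y) _)) ⟩
        ((X * K₀) ^ d) ^ length box * Θ Y ^ ∑ box (λ y → ι (y ≟ₗ x))  ≤⟨ *-mono-≤ (≤-reflexive (trans (cong (((X * K₀) ^ d) ^_) length-box) (^-*-assoc (X * K₀) d M)))
                                                                               (^-monoʳ-≤ (Θ Y) {{>-nonZero (Θ≥1 Y)}} (one-occurrence x)) ⟩
        (X * K₀) ^ (d * M) * Θ Y ^ 1  ≡⟨ cong ((X * K₀) ^ (d * M) *_) (*-identityʳ (Θ Y)) ⟩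
        (X * K₀) ^ (d * M) * Θ Y  ∎
      many : ∀ pr → pr ∈ T → (proj₁ pr ^ (M ÷ proj₁ pr)) ^ M ≤ ∏ box (λ x → ∏ box (λ y → proj₁ pr ^ ι (congruent? x y pr)))
      many pr@(p , r) i = begin
        (p ^ (M ÷ p)) ^ M  ≡⟨ trans (^-*-assoc p (M ÷ p) M) (cong (p ^_) (*-comm (M ÷ p) M)) ⟩
        p ^ (M * (M ÷ p))  ≡⟨ cong (λ z → p ^ (z * (z ÷ p))) length-box ⟨
        p ^ (length box * (length box ÷ p))  ≤⟨ ^-monoʳ-≤ p {{>-nonZero 1≤p}} (collisions box (key pr) p 1≤p (λ x → rem< (evalℕ x r) p 1≤p)) ⟩
        p ^ ∑ box (λ x → ∑ box (λ y → ι (congruent? x y pr)))  ≡⟨ trans (^-∑ box p _) (∏-cong box (λ x _ → ^-∑ box p _)) ⟩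
        ∏ box (λ x → ∏ box (λ y → p ^ ι (congruent? x y pr)))  ∎
        where 1≤p = <⇒≤ (prime≥2 (proj₁ (rootPairs-good Y i)))

  -- Passage from M = X^d to an arbitrary N ≤ M. By M·(N ÷ p) ≤ N·(1 + M ÷ p) the rounding costs one
  -- more factor p for each root pair; this is the second power of `Θ Y`.
  root-average : ∀ N Y → 1 ≤ N →
    ∏ (oneTo Y) (λ p → prime^ p ^ (ρ p * (N ÷ p))) ≤ (2 ^ d * K₀ ^ d * N) ^ N * 16 ^ (2 * (Y * d))
  root-average N Y 1≤N with root-approximation d N 1≤d 1≤N
  ... | X , 1≤X , N≤M , M≤ = begin
    ∏ (oneTo Y) (λ p → prime^ p ^ (ρ p * (N ÷ p)))  ≡⟨ ∏-rootPairs Y (N ÷_) ⟨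
    ∏ T (λ (p , r) → p ^ (N ÷ p))  ≤⟨ ^-cancel-≤ M (≤-trans 1≤N N≤M) scaled ⟩
    (X * K₀) ^ (d * N) * Θ Y ^ 2  ≤⟨ *-mono-≤ main (^-monoˡ-≤ 2 (Θ-bound Y)) ⟩
    (2 ^ d * K₀ ^ d * N) ^ N * (16 ^ (Y * d)) ^ 2  ≡⟨ cong ((2 ^ d * K₀ ^ d * N) ^ N *_) (trans (^-*-assoc 16 (Y * d) 2) (cong (16 ^_) (*-comm (Y * d) 2))) ⟩
    (2 ^ d * K₀ ^ d * N) ^ N * 16 ^ (2 * (Y * d))  ∎
    where
    open ≤-Reasoning
    T = rootPairs Y
    M = X ^ d
    main : (X * K₀) ^ (d * N) ≤ (2 ^ d * K₀ ^ d * N) ^ N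
    main = begin
      (X * K₀) ^ (d * N)  ≡⟨ ^-*-assoc (X * K₀) d N ⟨
      ((X * K₀) ^ d) ^ N  ≤⟨ ^-monoˡ-≤ N (begin
        (X * K₀) ^ d  ≡⟨ ^-distribʳ-* d X K₀ ⟩
        M * K₀ ^ d  ≤⟨ *-monoˡ-≤ (K₀ ^ d) M≤ ⟩
        2 ^ d * N * K₀ ^ d  ≡⟨ trans (*-assoc (2 ^ d) N _) (trans (cong (2 ^ d *_) (*-comm N _)) (sym (*-assoc (2 ^ d) _ N))) ⟩
        2 ^ d * K₀ ^ d * N  ∎) ⟩
      (2 ^ d * K₀ ^ d * N) ^ N  ∎
    exponent : ∀ p → 1 ≤ p → M * (N ÷ p) ≤ N * suc (M ÷ p)
    exponent p 1≤p = *-cancelʳ-≤ _ _ p {{>-nonZero 1≤p}} (begin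
      M * (N ÷ p) * p  ≡⟨ *-assoc M (N ÷ p) p ⟩
      M * (N ÷ p * p)  ≤⟨ *-monoʳ-≤ M (÷-*-≤ N p) ⟩
      M * N  ≡⟨ *-comm M N ⟩
      N * M  ≤⟨ *-monoʳ-≤ N (<⇒≤ (<-suc÷-* M p 1≤p)) ⟩
      N * (suc (M ÷ p) * p)  ≡⟨ *-assoc N (suc (M ÷ p)) p ⟨
      N * suc (M ÷ p) * p  ∎)
    scaled : ∏ T (λ (p , r) → p ^ (N ÷ p)) ^ M ≤ ((X * K₀) ^ (d * N) * Θ Y ^ 2) ^ M
    scaled = begin
      ∏ T (λ (p , r) → p ^ (N ÷ p)) ^ M  ≡⟨ ∏-^ T (λ (p , r) → p ^ (N ÷ p)) M ⟨
      ∏ T (λ (p , r) → (p ^ (N ÷ p)) ^ M)  ≤⟨ ∏-mono T (λ (p , r) i → let 1≤p = <⇒≤ (prime≥2 (proj₁ (rootPairs-good Y i))) in begin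
        (p ^ (N ÷ p)) ^ M  ≡⟨ trans (^-*-assoc p (N ÷ p) M) (cong (p ^_) (*-comm (N ÷ p) M)) ⟩
        p ^ (M * (N ÷ p))  ≤⟨ ^-monoʳ-≤ p {{>-nonZero 1≤p}} (exponent p 1≤p) ⟩
        p ^ (N * suc (M ÷ p))  ≡⟨ trans (cong (p ^_) (*-comm N (suc (M ÷ p)))) (sym (^-*-assoc p (suc (M ÷ p)) N)) ⟩
        (p * p ^ (M ÷ p)) ^ N  ∎) ⟩
      ∏ T (λ (p , r) → (p * p ^ (M ÷ p)) ^ N)  ≡⟨ ∏-^ T (λ (p , r) → p * p ^ (M ÷ p)) N ⟩
      ∏ T (λ (p , r) → p * p ^ (M ÷ p)) ^ N  ≡⟨ cong (_^ N) (∏-* T proj₁ (λ (p , r) → p ^ (M ÷ p))) ⟩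
      (Θ Y * ∏ T (λ (p , r) → p ^ (M ÷ p))) ^ N  ≤⟨ ^-monoˡ-≤ N (*-monoʳ-≤ (Θ Y) (sparse-average Y X 1≤X)) ⟩
      (Θ Y * ((X * K₀) ^ (d * M) * Θ Y)) ^ N  ≡⟨ cong (_^ N) (lemma (Θ Y) ((X * K₀) ^ (d * M))) ⟩
      ((X * K₀) ^ (d * M) * Θ Y ^ 2) ^ N  ≡⟨ ^-distribʳ-* N ((X * K₀) ^ (d * M)) (Θ Y ^ 2) ⟩
      ((X * K₀) ^ (d * M)) ^ N * (Θ Y ^ 2) ^ N  ≤⟨ *-mono-≤ (≤-reflexive swap) (^-monoʳ-≤ (Θ Y ^ 2) {{m^n≢0 (Θ Y) 2 {{>-nonZero (Θ≥1 Y)}}}} N≤M) ⟩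
      ((X * K₀) ^ (d * N)) ^ M * (Θ Y ^ 2) ^ M  ≡⟨ ^-distribʳ-* M ((X * K₀) ^ (d * N)) (Θ Y ^ 2) ⟨
      ((X * K₀) ^ (d * N) * Θ Y ^ 2) ^ M  ∎
      where
      lemma : ∀ t x → t * (x * t) ≡ x * (t * (t * 1))
      lemma = solve-∀
      swap : ((X * K₀) ^ (d * M)) ^ N ≡ ((X * K₀) ^ (d * N)) ^ M
      swap = trans (cong (_^ N) (sym (^-*-assoc (X * K₀) d M))) (trans (^-swap ((X * K₀) ^ d) M N) (cong (_^ M) (^-*-assoc (X * K₀) d N)))

-- Prime powers dividing the values

coprime-prime-power : ∀ {p x} → Prime p → ¬ p ∣ x → ∀ l → Coprime (p ^ l) x
coprime-prime-power p-prime p∤x zero    (e∣1 , _) = ∣1⇒≡1 e∣1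
coprime-prime-power {p} {x} p-prime p∤x (suc l) {e} (e∣p^l+1 , e∣x) =
  coprime-prime-power p-prime p∤x l (coprime-divisor e⊥p e∣p^l+1 , e∣x)
  where
  e⊥p : Coprime e p
  e⊥p {g} (g∣e , g∣p) with prime⇒irreducible p-prime g∣p
  ... | inj₁ g≡1  = g≡1
  ... | inj₂ refl = contradiction (∣-trans g∣e e∣x) p∤x

rem-÷ : ∀ a p → 1 ≤ p → a ≡ rem a p + (a ÷ p) * p
rem-÷ a (suc p) _ = m≡m%n+[m/n]*n a (suc p)

same-digits⇒∣ : ∀ m n p D → 1 ≤ p → 1 ≤ D → rem m p ≡ rem n p → rem (m ÷ p) D ≡ rem (n ÷ p) D →
                pos (p * D) ∣ℤ pos m ℤ.- pos n
same-digits⇒∣ m n p D 1≤p 1≤D eq eq′ with rem≡⇒∣ (m ÷ p) (n ÷ p) D 1≤D eq′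
... | ℤ∣.divides k eq″ = ℤ∣.divides k (begin
  pos m ℤ.- pos n  ≡⟨ cong₂ (λ x y → pos x ℤ.- pos y) (rem-÷ m p 1≤p) (trans (rem-÷ n p 1≤p) (cong (_+ (n ÷ p) * p) (sym eq))) ⟩
  pos (r + (m ÷ p) * p) ℤ.- pos (r + (n ÷ p) * p)  ≡⟨ cong₂ ℤ._-_ (push (m ÷ p)) (push (n ÷ p)) ⟩
  pos r ℤ.+ pos (m ÷ p) ℤ.* pos p ℤ.- (pos r ℤ.+ pos (n ÷ p) ℤ.* pos p)
                                                          ≡⟨ lemma (pos r) (pos (m ÷ p)) (pos (n ÷ p)) (pos p) ⟩
  (pos (m ÷ p) ℤ.- pos (n ÷ p)) ℤ.* pos p  ≡⟨ cong (ℤ._* pos p) eq″ ⟩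
  k ℤ.* pos D ℤ.* pos p  ≡⟨ ℤ.*-assoc k (pos D) (pos p) ⟩
  k ℤ.* (pos D ℤ.* pos p)  ≡⟨ cong (ℤ._*_ k) (trans (ℤ.*-comm (pos D) (pos p)) (sym (ℤ.pos-* p D))) ⟩
  k ℤ.* pos (p * D)  ∎)
  where
  open ≡-Reasoning
  r = rem m p
  push : ∀ q → pos (r + q * p) ≡ pos r ℤ.+ pos q ℤ.* pos p
  push q = trans (ℤ.pos-+ r (q * p)) (cong (ℤ._+_ (pos r)) (ℤ.pos-* q p))
  lemma : ∀ r a b P → r ℤ.+ a ℤ.* P ℤ.- (r ℤ.+ b ℤ.* P) ≡ (a ℤ.- b) ℤ.* P
  lemma = ℤ-solve-∀

same-quotient⇒close : ∀ a b w → 1 ≤ w → a ÷ w ≡ b ÷ w → ∣ a - b ∣ < w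
same-quotient⇒close a b w 1≤w eq = subst₂ (λ x y → ∣ x - y ∣ < w) (sym (rem-÷ a w 1≤w)) (sym (trans (rem-÷ b w 1≤w) (cong (λ z → rem b w + z * w) (sym eq))))
  (subst (_< w) (sym (trans (cong₂ ∣_-_∣ (+-comm (rem a w) _) (+-comm (rem b w) _)) (∣m+n-m+o∣≡∣n-o∣ ((a ÷ w) * w) (rem a w) (rem b w))))
    (≤-<-trans (∣m-n∣≤m⊔n (rem a w) (rem b w)) (⊔-lub (rem< a w 1≤w) (rem< b w 1≤w))))

p^#levels≤ : ∀ p V L → 1 ≤ p → 1 ≤ V → p ^ ∑ (oneTo L) (λ l → ι (p ^ suc l ≤? V)) ≤ V
p^#levels≤ p V zero    1≤p 1≤V = 1≤V
p^#levels≤ p V (suc L) 1≤p 1≤V with p ^ suc (suc L) ≤? V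
... | no  _  = p^#levels≤ p V L 1≤p 1≤V
... | yes ≤V = ≤-trans (^-monoʳ-≤ p {{>-nonZero 1≤p}} (s≤s (≤-trans (at-most L) (n≤1+n L)))) ≤V
  where
  at-most : ∀ L → ∑ (oneTo L) (λ l → ι (p ^ suc l ≤? V)) ≤ L
  at-most L = ≤-trans (∑-mono (oneTo L) (λ l _ → ι≤1 (p ^ suc l ≤? V))) (≤-reflexive (trans (∑-const (oneTo L) 1) (trans (*-identityʳ _) (length-oneTo L))))

module Separation (f : Poly) (c : ℤ) (c≢0 : ¬ c ≡ 0ℤ)
  (identity : ∀ t → ∃[ a ] ∃[ b ] c ≡ a ℤ.* eval f t ℤ.+ b ℤ.* eval (derivative f) t) where

  D : ℕ
  D = ∣ c ∣

  1≤D : 1 ≤ D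
  1≤D = n≢0⇒n>0 (c≢0 ∘ ℤ.∣i∣≡0⇒i≡0)

  private
    -- Multiplying the Taylor expansion of f(m + u) by b turns its linear term u f′(m) into u c, up to multiples of f(m).
    taylor-combination : ∀ a b c F F′ h u k P → c ≡ a ℤ.* F ℤ.+ b ℤ.* F′ → u ≡ k ℤ.* (P ℤ.* c) →
      b ℤ.* (u ℤ.* F′ ℤ.+ u ℤ.* u ℤ.* h) ℤ.+ a ℤ.* u ℤ.* F ≡ u ℤ.* c ℤ.* (pos 1 ℤ.+ k ℤ.* b ℤ.* h ℤ.* P)
    taylor-combination a b c F F′ h u k P c≡ u≡ = begin
      b ℤ.* (u ℤ.* F′ ℤ.+ u ℤ.* u ℤ.* h) ℤ.+ a ℤ.* u ℤ.* F  ≡⟨ lemma b u F′ h a F ⟩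
      u ℤ.* (a ℤ.* F ℤ.+ b ℤ.* F′) ℤ.+ u ℤ.* u ℤ.* (b ℤ.* h)  ≡⟨ cong₂ (λ y z → u ℤ.* y ℤ.+ u ℤ.* z ℤ.* (b ℤ.* h)) (sym c≡) u≡ ⟩
      u ℤ.* c ℤ.+ u ℤ.* (k ℤ.* (P ℤ.* c)) ℤ.* (b ℤ.* h)  ≡⟨ lemma′ u c k P b h ⟩
      u ℤ.* c ℤ.* (pos 1 ℤ.+ k ℤ.* b ℤ.* h ℤ.* P)  ∎
      where
      open ≡-Reasoning
      lemma : ∀ b u F′ h a F → b ℤ.* (u ℤ.* F′ ℤ.+ u ℤ.* u ℤ.* h) ℤ.+ a ℤ.* u ℤ.* F ≡ u ℤ.* (a ℤ.* F ℤ.+ b ℤ.* F′) ℤ.+ u ℤ.* u ℤ.* (b ℤ.* h)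
      lemma = ℤ-solve-∀
      lemma′ : ∀ u c k p b h → u ℤ.* c ℤ.+ u ℤ.* (k ℤ.* (p ℤ.* c)) ℤ.* (b ℤ.* h) ≡ u ℤ.* c ℤ.* (pos 1 ℤ.+ k ℤ.* b ℤ.* h ℤ.* p)
      lemma′ = ℤ-solve-∀

    p∤1+kp : ∀ {p} k → Prime p → ¬ p ∣ ∣ pos 1 ℤ.+ k ℤ.* pos p ∣
    p∤1+kp {p} k p-prime p∣v = ¬prime[1] (subst Prime (∣1⇒≡1 (ℤ∣.∣⇒∣ᵤ
      (ℤ∣.∣m+n∣n⇒∣m {m = pos 1} (ℤ∣.∣ᵤ⇒∣ {pos p} {pos 1 ℤ.+ k ℤ.* pos p} p∣v) (ℤ∣.∣n⇒∣m*n k ℤ∣.∣-refl)))) p-prime)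

    separatedℤ : ∀ {p} l m u k a b h → Prime p → u ≡ k ℤ.* (pos p ℤ.* c) → c ≡ a ℤ.* eval f m ℤ.+ b ℤ.* eval (derivative f) m →
      eval f (m ℤ.+ u) ≡ eval f m ℤ.+ u ℤ.* eval (derivative f) m ℤ.+ u ℤ.* u ℤ.* h →
      pos (p ^ l) ∣ℤ eval f m → pos (p ^ l) ∣ℤ eval f (m ℤ.+ u) → p ^ l ∣ ∣ u ℤ.* c ∣
    separatedℤ {p} l m u k a b h p-prime u≡ c≡ f≡ w∣m w∣n =
      coprime-divisor (coprime-prime-power p-prime (p∤1+kp (k ℤ.* b ℤ.* h) p-prime) l)
        (subst (w ∣_) (trans (cong ∣_∣ (ℤ.*-comm (u ℤ.* c) v)) (ℤ.abs-* v (u ℤ.* c))) (ℤ∣.∣⇒∣ᵤ w∣ucv))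
      where
      w = p ^ l
      v = pos 1 ℤ.+ k ℤ.* b ℤ.* h ℤ.* pos p
      F = eval f m
      F′ = eval (derivative f) m
      w∣remainder : pos w ∣ℤ u ℤ.* F′ ℤ.+ u ℤ.* u ℤ.* h
      w∣remainder = ℤ∣.∣m+n∣m⇒∣n {m = F} (subst (pos w ∣ℤ_) (trans f≡ (ℤ.+-assoc F (u ℤ.* F′) (u ℤ.* u ℤ.* h))) w∣n) w∣m
      w∣ucv : pos w ∣ℤ u ℤ.* c ℤ.* v
      w∣ucv = subst (pos w ∣ℤ_) (taylor-combination a b c F F′ h u k (pos p) c≡ u≡)
        (∣ℤ-*-+-* b (u ℤ.* F′ ℤ.+ u ℤ.* u ℤ.* h) (a ℤ.* u) F w∣remainder w∣m)

  -- A quantitative form of Hensel's lemma that also covers the primes dividing `D`. With u = n - m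
  -- divisible by p·c, the expansion shows that p^l divides u·c times a number congruent to 1 modulo
  -- p, hence it divides u·c.
  separated : ∀ {p} l m n → Prime p → pos (p * D) ∣ℤ pos n ℤ.- pos m → pos (p ^ l) ∣ℤ eval f (pos m) →
              pos (p ^ l) ∣ℤ eval f (pos n) → p ^ l ∣ D * ∣ n - m ∣
  separated {p} l m n p-prime pD∣n-m w∣m w∣n = subst (p ^ l ∣_) abs≡
    (separatedℤ l (pos m) u (ℤ∣.quotient pc∣u) (proj₁ (identity (pos m))) (proj₁ (proj₂ (identity (pos m))))
      (proj₁ (taylor f (pos m) u)) p-prime (ℤ∣._∣_.equality pc∣u) (proj₂ (proj₂ (identity (pos m))))
      (proj₂ (taylor f (pos m) u)) w∣m (subst (λ z → pos (p ^ l) ∣ℤ eval f z) (sym (m+[n-m] (pos m) (pos n))) w∣n))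
    where
    u = pos n ℤ.- pos m
    m+[n-m] : ∀ m n → m ℤ.+ (n ℤ.- m) ≡ n
    m+[n-m] = ℤ-solve-∀
    pc∣u : pos p ℤ.* c ∣ℤ u
    pc∣u = ℤ∣.∣-trans (ℤ∣.∣-trans (ℤ∣.*-monoʳ-∣ (pos p) ℤ∣.m∣∣m∣) (ℤ∣.∣-reflexive (sym (ℤ.pos-* p D)))) pD∣n-m
    abs≡ : ∣ u ℤ.* c ∣ ≡ D * ∣ n - m ∣
    abs≡ = trans (ℤ.abs-* u c) (trans (*-comm ∣ u ∣ D) (cong (D *_) (∣pos-pos∣ n m)))

module SmallPrimes (fs : Poly) (irreducible : Irreducible (snoc fs (pos 1))) (1≤d : 1 ≤ length fs) where

  open MonicIrreducible fs irreducible using (f; d; Bézout; Bézout-derivative)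
  open NormBound fs irreducible 1≤d using (K₀)
  open RootAverage fs irreducible 1≤d using (ρ; root-average)

  private
    derivative-identity : Bézout (derivative f)
    derivative-identity = Bézout-derivative 1≤d

  open Separation f (proj₁ derivative-identity) (proj₁ (proj₂ derivative-identity)) (proj₂ (proj₂ derivative-identity)) public

  rem∈roots : ∀ {p} n → 1 ≤ p → p ∣ ∣ eval f (pos n) ∣ → rem n p ∈ roots f p
  rem∈roots {p} n 1≤p p∣f = ∈-roots⁺ f (rem< n p 1≤p) (ℤ∣.∣⇒∣ᵤ (subst (pos p ∣ℤ_) (lemma (eval f (pos n)) (eval f (pos r)))
    (ℤ∣.∣m∣n⇒∣m-n {m = eval f (pos n)} (ℤ∣.∣ᵤ⇒∣ p∣f) (ℤ∣.∣-trans (ℤ∣.divides (pos q) (ℤ.pos-* q p)) kp∣))))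
    where
    r = rem n p
    q = n ÷ p
    lemma : ∀ x y → x ℤ.- (x ℤ.- y) ≡ y
    lemma = ℤ-solve-∀
    kp∣ : pos (q * p) ∣ℤ eval f (pos n) ℤ.- eval f (pos r)
    kp∣ = subst (λ z → pos (q * p) ∣ℤ eval f z ℤ.- eval f (pos r))
            (trans (sym (ℤ.pos-+ r (q * p))) (cong pos (sym (rem-÷ n p 1≤p)))) (eval-congruent f (pos r) (pos (q * p)))

  module _ (N : ℕ) (1≤N : 1 ≤ N) (h : ℕ → ℕ) (h∣f : ∀ {w} n → 2 ≤ w → w ∣ h n → w ∣ ∣ eval f (pos n) ∣) where

    level : ℕ → ℕ
    level w = ∑ (oneTo N) (λ n → ι (w ∣? h n))

    private
      hits : ℕ → List ℕ
      hits w = filter (λ n → w ∣? h n) (oneTo N)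

      ∈-hits : ∀ w {n} → n ∈ hits w → n ≤ N × w ∣ h n
      ∈-hits w i = let n∈ , w∣ = ∈-filter⁻ (λ n → w ∣? h n) {xs = oneTo N} i in proj₂ (∈-oneTo⁻ n∈) , w∣

      level≤ : ∀ {β : Set} w (key : ℕ → β) (ys : List β) → (∀ n → n ∈ hits w → key n ∈ ys) →
               (∀ m n → m ∈ hits w → n ∈ hits w → key m ≡ key n → m ≡ n) → level w ≤ length ys
      level≤ w key ys into inj = subst (_≤ length ys) (length-filter≡∑ (λ n → w ∣? h n) (oneTo N))
        (pigeonhole (hits w) ys key (Unique.filter⁺ _ (oneTo-unique N)) into inj)

    level-prime : ∀ {p} → Prime p → level p ≤ ρ p * suc (N ÷ p)
    level-prime {p} p-prime = subst (level p ≤_)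
      (trans (length-cartesianProductWith _,_ (roots f p) (downFrom (suc (N ÷ p)))) (cong (λ z → ρ p * suc z) (length-downFrom (N ÷ p))))
      (level≤ p (λ n → rem n p , n ÷ p) (cartesianProduct (roots f p) (downFrom (suc (N ÷ p))))
        (λ n i → let n≤N , p∣h = ∈-hits p i in
          ∈-cartesianProduct⁺ (rem∈roots n 1≤p (h∣f n 2≤p p∣h)) (∈-downFrom⁺ (s≤s (÷-monoˡ p n≤N))))
        (λ m n _ _ eq → trans (rem-÷ m p 1≤p) (trans (cong₂ (λ r q → r + q * p) (cong proj₁ eq) (cong proj₂ eq)) (sym (rem-÷ n p 1≤p)))))
      where
      2≤p = prime≥2 p-prime
      1≤p = <⇒≤ 2≤p

    -- The first two entries of `key` fix n modulo p·D, so that `separated` makes the distance of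
    -- two hits, times `D`, a multiple of w. The third puts `D * n` into a block of length w, where
    -- this multiple must be 0.
    level-prime-power : ∀ {p} l → Prime p → level (p ^ suc l) ≤ ρ p * (D * suc (D * N ÷ p ^ suc l))
    level-prime-power {p} l p-prime = subst (level w ≤_)
      (trans (length-cartesianProductWith _,_ (roots f p) ys) (cong (ρ p *_) (trans (length-cartesianProductWith _,_ (downFrom D) (downFrom (suc (D * N ÷ w))))
        (cong₂ _*_ (length-downFrom D) (length-downFrom (suc (D * N ÷ w)))))))
      (level≤ w key (cartesianProduct (roots f p) ys) into inj)
      where
      w = p ^ suc l
      2≤p = prime≥2 p-prime
      1≤p = <⇒≤ 2≤p
      1≤w : 1 ≤ w
      1≤w = m^n>0 p {{>-nonZero 1≤p}} (suc l)
      2≤w : 2 ≤ w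
      2≤w = ≤-trans 2≤p (m≤m*n p (p ^ l) {{m^n≢0 p l {{>-nonZero 1≤p}}}})
      ys = cartesianProduct (downFrom D) (downFrom (suc (D * N ÷ w)))
      key : ℕ → ℕ × ℕ × ℕ
      key n = rem n p , rem (n ÷ p) D , D * n ÷ w
      w∣f : ∀ {n} → n ∈ hits w → w ∣ ∣ eval f (pos n) ∣
      w∣f {n} i = h∣f n 2≤w (proj₂ (∈-hits w i))
      into : ∀ n → n ∈ hits w → key n ∈ cartesianProduct (roots f p) ys
      into n i = ∈-cartesianProduct⁺ (rem∈roots n 1≤p (∣-trans (m∣m*n (p ^ l)) (w∣f i)))
        (∈-cartesianProduct⁺ (∈-downFrom⁺ (rem< (n ÷ p) D 1≤D)) (∈-downFrom⁺ (s≤s (÷-monoˡ w (*-monoʳ-≤ D (proj₁ (∈-hits w i)))))))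
      inj : ∀ m n → m ∈ hits w → n ∈ hits w → key m ≡ key n → m ≡ n
      inj m n i j eq = sym (∣m-n∣≡0⇒m≡n (small (m*n≡0⇒m≡0∨n≡0 D zero-distance)))
        where
        close : D * ∣ n - m ∣ < w
        close = subst (_< w) (trans (sym (*-distribˡ-∣-∣ D m n)) (cong (D *_) (∣-∣-comm m n)))
          (same-quotient⇒close (D * m) (D * n) w 1≤w (cong (proj₂ ∘ proj₂) eq))
        divisible : w ∣ D * ∣ n - m ∣
        divisible = separated (suc l) m n p-prime (same-digits⇒∣ n m p D 1≤p 1≤D (sym (cong proj₁ eq)) (sym (cong (proj₁ ∘ proj₂) eq)))
          (ℤ∣.∣ᵤ⇒∣ (w∣f i)) (ℤ∣.∣ᵤ⇒∣ (w∣f j))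
        zero-distance : D * ∣ n - m ∣ ≡ 0
        zero-distance with D * ∣ n - m ∣ in eq₀
        ... | zero  = refl
        ... | suc z = contradiction (subst (w ∣_) eq₀ divisible) (>⇒∤ (subst (_< w) eq₀ close))
        small : D ≡ 0 ⊎ ∣ n - m ∣ ≡ 0 → ∣ n - m ∣ ≡ 0
        small (inj₁ D≡0) = contradiction D≡0 (≢-nonZero⁻¹ D {{>-nonZero 1≤D}})
        small (inj₂ z)   = z

    -- Legendre's count: for a prime p and positive values it is, once L is large, the exponent of p
    -- in the product of the h(n).
    levels : ℕ → ℕ → ℕ
    levels L p = ∑ (oneTo L) (λ l → level (p ^ l))

    module _ (V : ℕ) (1≤h : ∀ n → 1 ≤ h n) (h≤V : ∀ n → n ≤ N → h n ≤ V) where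

      private
        1≤V : 1 ≤ V
        1≤V = ≤-trans (1≤h N) (h≤V N ≤-refl)

      level-large : ∀ w → ¬ w ≤ V → level w ≡ 0
      level-large w w≰V = trans (∑-cong (oneTo N) (λ n n∈ → ι-no (w ∣? h n) (λ w∣h →
        w≰V (≤-trans (∣⇒≤ {{>-nonZero (1≤h n)}} w∣h) (h≤V n (proj₂ (∈-oneTo⁻ n∈))))))) (∑-zero (oneTo N))

      -- The `suc` in `level-prime-power` is a rounding cost that would accumulate over all l. It is
      -- charged only while the power is at most `V`, because no larger power divides a value.
      level-bound : ∀ {p} l → Prime p → level (p ^ suc l) ≤ d * D * (D * N ÷ p ^ suc l) + d * D * ι (p ^ suc l ≤? V)
      level-bound {p} l p-prime with p ^ suc l ≤? V
      ... | no  w≰V = ≤-trans (≤-reflexive (level-large (p ^ suc l) w≰V)) z≤n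
      ... | yes _   = ≤-trans (level-prime-power l p-prime) (≤-trans (*-monoˡ-≤ (D * suc (D * N ÷ p ^ suc l)) (lagrange fs p p-prime))
                        (≤-reflexive (lemma d D (D * N ÷ p ^ suc l))))
        where
        lemma : ∀ d D x → d * (D * suc x) ≡ d * D * x + d * D * 1
        lemma = solve-∀

      levels-bound : ∀ {p} L → Prime p → levels (suc L) p ≤
        ρ p * (N ÷ p) + d + (D * N ÷ (p * p)) * (2 * (d * D)) + ∑ (oneTo L) (λ l → ι (p ^ suc l ≤? V)) * (d * D)
      levels-bound {p} L p-prime = begin
        levels (suc L) p  ≡⟨ ∑-oneTo-suc L (λ l → level (p ^ l)) ⟩
        level (p * 1) + ∑ (oneTo L) (λ l → level (p ^ suc l))  ≤⟨ +-mono-≤ first (∑-mono (oneTo L) (λ l _ → level-bound l p-prime)) ⟩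
        ρ p * (N ÷ p) + d + ∑ (oneTo L) (λ l → k * g l + k * i l)  ≡⟨ cong (ρ p * (N ÷ p) + d +_) (trans (∑-+ (oneTo L) (λ l → k * g l) (λ l → k * i l)) (cong₂ _+_ (∑-*ˡ (oneTo L) k g) (∑-*ˡ (oneTo L) k i))) ⟩
        ρ p * (N ÷ p) + d + (k * ∑ (oneTo L) g + k * ∑ (oneTo L) i)  ≤⟨ +-monoʳ-≤ (ρ p * (N ÷ p) + d) (+-monoˡ-≤ _ (*-monoʳ-≤ k (∑-geometric-from-2 L (D * N) p 2≤p))) ⟩
        ρ p * (N ÷ p) + d + (k * (2 * (D * N ÷ (p * p))) + k * ∑ (oneTo L) i)
          ≡⟨ lemma (ρ p * (N ÷ p) + d) k (D * N ÷ (p * p)) (∑ (oneTo L) i) ⟩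
        ρ p * (N ÷ p) + d + (D * N ÷ (p * p)) * (2 * k) + ∑ (oneTo L) i * k ∎
        where
        open ≤-Reasoning
        2≤p = prime≥2 p-prime
        k = d * D
        g i : ℕ → ℕ
        g l = D * N ÷ p ^ suc l
        i l = ι (p ^ suc l ≤? V)
        lemma : ∀ a k x y → a + (k * (2 * x) + k * y) ≡ a + x * (2 * k) + y * k
        lemma = solve-∀
        first : level (p * 1) ≤ ρ p * (N ÷ p) + d
        first = begin
          level (p * 1)  ≡⟨ cong level (*-identityʳ p) ⟩
          level p  ≤⟨ level-prime p-prime ⟩
          ρ p * suc (N ÷ p)  ≡⟨ trans (*-suc (ρ p) (N ÷ p)) (+-comm (ρ p) _) ⟩
          ρ p * (N ÷ p) + ρ p  ≤⟨ +-monoʳ-≤ _ (lagrange fs p p-prime) ⟩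
          ρ p * (N ÷ p) + d  ∎

      -- `P₁` is the main term, `P₂` the rounding at the first level, `P₃` the proportional part of
      -- the higher levels, and `P₄` their rounding. For Y = O(N) and V polynomial in N, all but the
      -- `N ^ N` in the first bound is of the form C ^ N.
      small-primes : ∀ L Y → ∏ (oneTo Y) (λ p → prime^ p ^ levels (suc L) p) ≤
        (2 ^ d * K₀ ^ d * N) ^ N * 16 ^ (2 * (Y * d)) * (16 ^ Y) ^ d * (16 ^ (2 * (D * N))) ^ (2 * (d * D)) * (V ^ π Y) ^ (d * D)
      small-primes L Y = begin
        ∏ (oneTo Y) (λ p → prime^ p ^ levels (suc L) p)
          ≤⟨ ∏-mono (oneTo Y) pointwise ⟩
        ∏ (oneTo Y) (λ p → P₁ p * P₂ p * P₃ p * P₄ p)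
          ≡⟨ trans (∏-* (oneTo Y) (λ p → P₁ p * P₂ p * P₃ p) P₄) (cong (_* ∏ (oneTo Y) P₄)
               (trans (∏-* (oneTo Y) (λ p → P₁ p * P₂ p) P₃) (cong (_* ∏ (oneTo Y) P₃) (∏-* (oneTo Y) P₁ P₂)))) ⟩
        ∏ (oneTo Y) P₁ * ∏ (oneTo Y) P₂ * ∏ (oneTo Y) P₃ * ∏ (oneTo Y) P₄
          ≤⟨ *-mono-≤ (*-mono-≤ (*-mono-≤ (root-average N Y 1≤N)
               (≤-trans (≤-reflexive (∏-^ (oneTo Y) prime^ d)) (^-monoˡ-≤ d (θ≤16^ Y))))
               (≤-trans (≤-reflexive (∏-^ (oneTo Y) (λ p → prime^ p ^ (D * N ÷ (p * p))) (2 * (d * D)))) (^-monoˡ-≤ (2 * (d * D)) (∏-prime-squares Y (D * N)))))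
               (≤-reflexive (trans (∏-^ (oneTo Y) (λ p → V ^ ι (prime? p)) (d * D)) (cong (_^ (d * D)) (sym (^-∑ (oneTo Y) V (ι ∘ prime?)))))) ⟩
        (2 ^ d * K₀ ^ d * N) ^ N * 16 ^ (2 * (Y * d)) * (16 ^ Y) ^ d * (16 ^ (2 * (D * N))) ^ (2 * (d * D)) * (V ^ π Y) ^ (d * D) ∎
        where
        open ≤-Reasoning
        P₁ P₂ P₃ P₄ : ℕ → ℕ
        P₁ p = prime^ p ^ (ρ p * (N ÷ p))
        P₂ p = prime^ p ^ d
        P₃ p = (prime^ p ^ (D * N ÷ (p * p))) ^ (2 * (d * D))
        P₄ p = (V ^ ι (prime? p)) ^ (d * D)
        pointwise : ∀ p → p ∈ oneTo Y → prime^ p ^ levels (suc L) p ≤ P₁ p * P₂ p * P₃ p * P₄ p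
        pointwise p p∈ with prime? p
        ... | no _ = ≤-reflexive (trans (^-zeroˡ (levels (suc L) p)) (sym (cong₂ _*_ (cong₂ _*_ (cong₂ _*_ (^-zeroˡ (ρ p * (N ÷ p))) (^-zeroˡ d))
                       (trans (cong (_^ (2 * (d * D))) (^-zeroˡ (D * N ÷ (p * p)))) (^-zeroˡ (2 * (d * D))))) (^-zeroˡ (d * D)))))
        ... | yes p-prime = begin
            q ^ levels (suc L) p  ≤⟨ ^-monoʳ-≤ q {{q≢0}} (levels-bound L p-prime) ⟩
            q ^ (e₁ + d + e₃ * (2 * (d * D)) + e₄ * (d * D))
              ≡⟨ trans (^-distribˡ-+-* q (e₁ + d + e₃ * (2 * (d * D))) (e₄ * (d * D))) (cong (_* q ^ (e₄ * (d * D)))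
                   (trans (^-distribˡ-+-* q (e₁ + d) (e₃ * (2 * (d * D)))) (cong (_* q ^ (e₃ * (2 * (d * D)))) (^-distribˡ-+-* q e₁ d)))) ⟩
            q ^ e₁ * q ^ d * q ^ (e₃ * (2 * (d * D))) * q ^ (e₄ * (d * D))
              ≤⟨ *-mono-≤ (*-monoʳ-≤ (q ^ e₁ * q ^ d) (≤-reflexive (sym (^-*-assoc q e₃ (2 * (d * D))))))
                   (≤-trans (≤-reflexive (sym (^-*-assoc q e₄ (d * D)))) (^-monoˡ-≤ (d * D)
                     (≤-trans (≤-reflexive (cong (_^ e₄) (*-identityʳ p))) (≤-trans (p^#levels≤ p V L 1≤p 1≤V) (≤-reflexive (sym (*-identityʳ V))))))) ⟩
            q ^ e₁ * q ^ d * (q ^ e₃) ^ (2 * (d * D)) * (V ^ 1) ^ (d * D) ∎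
          where
          1≤p = proj₁ (∈-oneTo⁻ p∈)
          q = p ^ 1
          q≢0 : NonZero q
          q≢0 = m^n≢0 p 1 {{>-nonZero 1≤p}}
          e₁ = ρ p * (N ÷ p)
          e₃ = D * N ÷ (p * p)
          e₄ = ∑ (oneTo L) (λ l → ι (p ^ suc l ≤? V))

-- Large primes

private
  staircase-base : ∀ e (k : ℕ → ℕ) → (∀ l → 1 ≤ k l → l + 2 * k l ≤ 2 * suc e + 1) → k 1 ≤ suc e
  staircase-base e k bound with k 1 in eq
  ... | zero  = z≤n
  ... | suc j = *-cancelˡ-≤ 2 (+-cancelˡ-≤ 1 _ _ (≤-trans (subst (λ z → 1 + 2 * z ≤ 2 * suc e + 1) eq (bound 1 (subst (1 ≤_) (sym eq) (s≤s z≤n))))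
                  (≤-reflexive (+-comm (2 * suc e) 1))))

-- The inequality gives k(1) ≤ e and k(2) ≤ e - 1, together 2e - 1 = e² - (e - 1)². Dropping these
-- two levels leaves the same hypothesis for e - 1.
∑-staircase : ∀ e L (k : ℕ → ℕ) → (∀ l → 1 ≤ k l → l + 2 * k l ≤ 2 * e + 1) → ∑ (oneTo L) k ≤ e * e
∑-staircase zero L k bound = ≤-reflexive (trans (∑-cong (oneTo L) (λ l l∈ → none l (proj₁ (∈-oneTo⁻ l∈)))) (∑-zero (oneTo L)))
  where
  none : ∀ l → 1 ≤ l → k l ≡ 0
  none l 1≤l with k l in eq
  ... | zero  = refl
  ... | suc j = contradiction (subst (λ z → l + 2 * z ≤ 1) eq (bound l (subst (1 ≤_) (sym eq) (s≤s z≤n))))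
                  (<⇒≱ (≤-trans (s≤s (s≤s z≤n)) (+-mono-≤ 1≤l (*-monoʳ-≤ 2 (s≤s (z≤n {j}))))))
∑-staircase (suc e) zero          k bound = z≤n
∑-staircase (suc e) (suc zero)    k bound =
  ≤-trans (≤-reflexive (+-identityʳ (k 1))) (≤-trans (staircase-base e k bound) (m≤m*n (suc e) (suc e)))
∑-staircase (suc e) (suc (suc L)) k bound = begin
  ∑ (oneTo (suc (suc L))) k  ≡⟨ ∑-oneTo-suc (suc L) k ⟩
  k 1 + ∑ (oneTo (suc L)) (k ∘ suc)  ≡⟨ cong (k 1 +_) (∑-oneTo-suc L (k ∘ suc)) ⟩
  k 1 + (k 2 + ∑ (oneTo L) (k ∘ suc ∘ suc))  ≤⟨ +-mono-≤ (staircase-base e k bound) (+-mono-≤ k₂≤ (∑-staircase e L (k ∘ suc ∘ suc) bound′)) ⟩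
  suc e + (e + e * e)  ≡⟨ lemma e ⟩
  suc e * suc e  ∎
  where
  open ≤-Reasoning
  lemma : ∀ e → suc e + (e + e * e) ≡ suc e * suc e
  lemma = solve-∀
  two-more : ∀ e → 2 * suc e + 1 ≡ 2 + (2 * e + 1)
  two-more = solve-∀
  k₂≤ : k 2 ≤ e
  k₂≤ with k 2 in eq
  ... | zero  = z≤n
  ... | suc j = ≤-pred (*-cancelˡ-< 2 (suc j) (suc e) (≤-trans (s≤s (+-cancelˡ-≤ 2 _ _ (≤-trans (subst (λ z → 2 + 2 * z ≤ 2 * suc e + 1) eq (bound 2 (subst (1 ≤_) (sym eq) (s≤s z≤n))))
                  (≤-reflexive (two-more e))))) (≤-reflexive (lemma′ e))))
    where
    lemma′ : ∀ e → suc (2 * e + 1) ≡ 2 * suc e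
    lemma′ = solve-∀
  bound′ : ∀ l → 1 ≤ k (2 + l) → l + 2 * k (2 + l) ≤ 2 * e + 1
  bound′ l 1≤k = +-cancelˡ-≤ 2 _ _ (≤-trans (bound (2 + l) 1≤k) (≤-reflexive (two-more e)))

evalM-upper : ∀ gs T → 1 ≤ T → evalM gs T ≤ suc (sum gs) * T ^ length gs
evalM-upper []       T 1≤T = ≤-refl
evalM-upper (c ∷ gs) T 1≤T = begin
  c + T * evalM gs T  ≤⟨ +-mono-≤ (m≤m*n c (T ^ suc (length gs)) {{m^n≢0 T (suc (length gs)) {{>-nonZero 1≤T}}}}) (*-monoʳ-≤ T (evalM-upper gs T 1≤T)) ⟩
  c * T ^ suc (length gs) + T * (suc (sum gs) * T ^ length gs) ≡⟨ lemma c T (sum gs) (T ^ length gs) ⟩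
  suc (c + sum gs) * T ^ suc (length gs)  ∎
  where
  open ≤-Reasoning
  lemma : ∀ c T s u → c * (T * u) + T * (suc s * u) ≡ suc (c + s) * (T * u)
  lemma = solve-∀

∣∸-∸∣ : ∀ m n A → A ≤ m → A ≤ n → ∣ m ∸ A - n ∸ A ∣ ≡ ∣ m - n ∣
∣∸-∸∣ m n A A≤m A≤n with m≤n⇒∃[o]m+o≡n A≤m | m≤n⇒∃[o]m+o≡n A≤n
... | i , refl | j , refl = trans (cong₂ ∣_-_∣ (m+n∸m≡n A i) (m+n∸m≡n A j)) (sym (∣m+n-m+o∣≡∣n-o∣ A i j))

∣m²-n²∣ : ∀ m n → ∣ m * m - n * n ∣ ≡ ∣ m - n ∣ * (m + n)
∣m²-n²∣ m n with ≤-total m n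
... | inj₁ m≤n with m≤n⇒∃[o]m+o≡n m≤n
...   | u , refl = trans (cong (λ z → ∣ m * m - z ∣) (expand m u)) (trans (∣m-m+n∣≡n (m * m) _) (cong (_* (m + (m + u))) (sym (∣m-m+n∣≡n m u))))
  where
  expand : ∀ m u → (m + u) * (m + u) ≡ m * m + u * (m + (m + u))
  expand = solve-∀
∣m²-n²∣ m n | inj₂ n≤m with m≤n⇒∃[o]m+o≡n n≤m
...   | u , refl = trans (∣-∣-comm ((n + u) * (n + u)) (n * n)) (trans (cong (λ z → ∣ n * n - z ∣) (expand n u))
        (trans (∣m-m+n∣≡n (n * n) _) (cong (_* (n + u + n)) (sym (trans (∣-∣-comm (n + u) n) (∣m-m+n∣≡n n u))))))
  where
  expand : ∀ n u → (n + u) * (n + u) ≡ n * n + u * (n + u + n)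
  expand = solve-∀

-- h n is the value f(n) = G(n² − A), replaced by 1 for the finitely many n ≤ 2A.
module EvenValues (G : List ℕ) (A : ℕ) where

  e : ℕ
  e = length G

  node : ℕ → ℕ
  node n = n * n ∸ A

  private
    value : ∀ n → Dec (2 * A < n) → ℕ
    value n (yes _) = evalM G (node n)
    value n (no  _) = 1

  h : ℕ → ℕ
  h n = value n (2 * A <? n)

  h-large : ∀ {n} → 2 * A < n → h n ≡ evalM G (node n)
  h-large {n} <n with 2 * A <? n
  ... | yes _  = refl
  ... | no ≮n = contradiction <n ≮n

  h-large⁻ : ∀ {w n} → 2 ≤ w → w ∣ h n → 2 * A < n
  h-large⁻ {w} {n} 2≤w w∣h with 2 * A <? n
  ... | yes <n = <n
  ... | no  _  = contradiction (∣1⇒≡1 w∣h) (λ { refl → contradiction 2≤w (λ { (s≤s ()) }) })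

  n≤n² : ∀ n → n ≤ n * n
  n≤n² zero    = z≤n
  n≤n² (suc n) = m≤m*n (suc n) (suc n)

  A≤n² : ∀ {n} → 2 * A < n → A ≤ n * n
  A≤n² {n} <n = ≤-trans (m≤n*m A 2) (≤-trans (<⇒≤ <n) (n≤n² n))

  n²≤2node : ∀ {n} → 2 * A < n → n * n ≤ 2 * node n
  n²≤2node {n} <n = +-cancelʳ-≤ (2 * A) _ _ (begin
    n * n + 2 * A  ≤⟨ +-monoʳ-≤ (n * n) (≤-trans (<⇒≤ <n) (n≤n² n)) ⟩
    n * n + n * n  ≡⟨ cong (n * n +_) (+-identityʳ (n * n)) ⟨
    2 * (n * n)  ≡⟨ cong (2 *_) (m∸n+n≡m (A≤n² <n)) ⟨
    2 * (node n + A)  ≡⟨ *-distribˡ-+ 2 (node n) A ⟩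
    2 * node n + 2 * A  ∎)
    where open ≤-Reasoning

  node≥1 : ∀ {n} → 2 * A < n → 1 ≤ node n
  node≥1 {n} <n with node n in eq
  ... | suc _ = s≤s z≤n
  ... | zero  = contradiction (≤-trans (≤-trans (≤-trans (s≤s z≤n) <n) (n≤n² n)) (≤-trans (n²≤2node <n) (≤-reflexive (cong (2 *_) eq)))) (λ ())

  h≥1 : ∀ n → 1 ≤ h n
  h≥1 n with 2 * A <? n
  ... | yes <n = evalM≥1 G (node≥1 <n)
  ... | no  _  = ≤-refl

  -- `K₁` has one summand for each case of `h`: 2^e because n² is at most twice the node when n >
  -- 2A, and (2A)^(2e) for the small n, where `h` is 1. `K₂` is the coefficient sum of the monic
  -- polynomial.
  K₁ K₂ : ℕ
  K₁ = 2 ^ e + (2 * A) ^ (2 * e)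
  K₂ = suc (sum G)

  h-lower : ∀ n → n ^ (2 * e) ≤ K₁ * h n
  h-lower n with 2 * A <? n
  ... | no  ≮n = ≤-trans (^-monoˡ-≤ (2 * e) (≮⇒≥ ≮n)) (≤-trans (m≤n+m _ (2 ^ e)) (≤-reflexive (sym (*-identityʳ K₁))))
  ... | yes <n = begin
    n ^ (2 * e)  ≡⟨ ^-*-assoc n 2 e ⟨
    (n * (n * 1)) ^ e  ≡⟨ cong (λ z → (n * z) ^ e) (*-identityʳ n) ⟩
    (n * n) ^ e  ≤⟨ ^-monoˡ-≤ e (n²≤2node <n) ⟩
    (2 * node n) ^ e  ≡⟨ ^-distribʳ-* e 2 (node n) ⟩
    2 ^ e * node n ^ e  ≤⟨ *-mono-≤ (m≤m+n (2 ^ e) _) (^≤evalM G (node n)) ⟩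
    K₁ * evalM G (node n)  ∎
    where open ≤-Reasoning

  h-upper : ∀ N n → 1 ≤ N → n ≤ N → h n ≤ K₂ * N ^ (2 * e)
  h-upper N n 1≤N n≤N with 2 * A <? n
  ... | no  _ = ≤-trans (m^n>0 N {{>-nonZero 1≤N}} (2 * e)) (m≤n*m _ K₂)
  ... | yes _ = begin
    evalM G (node n)  ≤⟨ evalM-mono G (≤-trans (m∸n≤m (n * n) A) (*-mono-≤ n≤N n≤N)) ⟩
    evalM G (N * N)  ≤⟨ evalM-upper G (N * N) (*-mono-≤ 1≤N 1≤N) ⟩
    K₂ * (N * N) ^ e  ≡⟨ cong (λ z → K₂ * (N * z) ^ e) (*-identityʳ N) ⟨
    K₂ * (N ^ 2) ^ e  ≡⟨ cong (K₂ *_) (^-*-assoc N 2 e) ⟩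
    K₂ * N ^ (2 * e)  ∎
    where open ≤-Reasoning

  -- The summand 2 gives p > 2N, so that p divides neither m - n nor m + n for distinct m, n ≤ N,
  -- and the squares stay distinct modulo p. The other summand exceeds every constant `E` in the
  -- size comparison of `staircase`.
  C₀ : ℕ
  C₀ = 2 + suc e ^ e * K₂

  module _ (N : ℕ) (1≤N : 1 ≤ N) {p} (p-prime : Prime p) (Y<p : C₀ * N < p) where

    private
      2N<p : 2 * N < p
      2N<p = ≤-<-trans (*-monoˡ-≤ N (m≤m+n 2 (suc e ^ e * K₂))) Y<p

      1≤p : 1 ≤ p
      1≤p = <⇒≤ (prime≥2 p-prime)

      ∤ : ∀ {x} → 1 ≤ x → x < p → ¬ p ∣ x
      ∤ 1≤x x<p = >⇒∤ {{>-nonZero 1≤x}} x<p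

      node-coprime : ∀ l {m n} → 2 * A < m → 2 * A < n → m ≤ N → n ≤ N → ¬ m ≡ n → Coprime (p ^ l) ∣ node m - node n ∣
      node-coprime l {m} {n} <m <n m≤N n≤N m≢n = coprime-prime-power p-prime p∤ l
        where
        m+n<p : m + n < p
        m+n<p = ≤-<-trans (+-mono-≤ m≤N (≤-trans n≤N (≤-reflexive (sym (+-identityʳ N))))) 2N<p
        p∤ : ¬ p ∣ ∣ node m - node n ∣
        p∤ p∣ with euclidsLemma ∣ m - n ∣ (m + n) p-prime (subst (p ∣_) (trans (∣∸-∸∣ (m * m) (n * n) A (A≤n² <m) (A≤n² <n)) (∣m²-n²∣ m n)) p∣)
        ... | inj₁ p∣-   = ∤ (n≢0⇒n>0 (m≢n ∘ ∣m-n∣≡0⇒m≡n)) (≤-<-trans (≤-trans (∣m-n∣≤m⊔n m n) (m⊔n≤m+n m n)) m+n<p) p∣-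
        ... | inj₂ p∣m+n = ∤ (≤-trans (≤-trans (s≤s z≤n) <m) (m≤m+n m n)) m+n<p p∣m+n

      hits : ℕ → List ℕ
      hits w = filter (λ n → w ∣? h n) (oneTo N)

      staircase : ∀ l k → 1 ≤ k → k ≤ e → (N * N) ^ pred k * p ^ l ≤ e ^ pred k * evalM G (N * N) → l + 2 * k ≤ 2 * e + 1
      staircase l (suc k) _ k<e bound with l + 2 * suc k ≤? 2 * e + 1
      ... | yes ≤ = ≤
      ... | no  ≰ with m≤n⇒∃[o]m+o≡n k<e
      ...   | j , k+j≡e = contradiction chain (<⇒≱ too-large)
        where
        open ≤-Reasoning
        E = e ^ k * K₂
        -- With `suc k` common roots this is 2(e - k), the power of N left when N^(2k) is cancelled
        -- from N^(2e). The negated claim says m ≤ l, so that p^m would be at most `E * N ^ m`,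
        -- against p > C₀·N.
        m = 2 * suc j
        m≤l : m ≤ l
        m≤l = +-cancelʳ-≤ (2 * suc k) m l (≤-trans (≤-reflexive (trans (lemma j k) (cong (λ z → suc (2 * z + 1)) k+j≡e))) (≰⇒> ≰))
          where
          lemma : ∀ j k → 2 * suc j + 2 * suc k ≡ suc (2 * (suc k + j) + 1)
          lemma = solve-∀
        chain : p ^ m ≤ E * N ^ m
        chain = *-cancelˡ-≤ ((N * N) ^ k) {{m^n≢0 (N * N) k {{>-nonZero (*-mono-≤ 1≤N 1≤N)}}}} (begin
          (N * N) ^ k * p ^ m  ≤⟨ *-monoʳ-≤ ((N * N) ^ k) (^-monoʳ-≤ p {{>-nonZero 1≤p}} m≤l) ⟩
          (N * N) ^ k * p ^ l  ≤⟨ bound ⟩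
          e ^ k * evalM G (N * N)  ≤⟨ *-monoʳ-≤ (e ^ k) (evalM-upper G (N * N) (*-mono-≤ 1≤N 1≤N)) ⟩
          e ^ k * (K₂ * (N * N) ^ e)  ≡⟨ *-assoc (e ^ k) K₂ _ ⟨
          E * (N * N) ^ e  ≡⟨ cong (λ z → E * (N * N) ^ z) (trans (sym k+j≡e) (sym (+-suc k j))) ⟩
          E * (N * N) ^ (k + suc j)  ≡⟨ cong (E *_) (^-distribˡ-+-* (N * N) k (suc j)) ⟩
          E * ((N * N) ^ k * (N * N) ^ suc j)  ≡⟨ cong (λ z → E * ((N * N) ^ k * z)) (trans (cong (λ z → (N * z) ^ suc j) (sym (*-identityʳ N))) (^-*-assoc N 2 (suc j))) ⟩
          E * ((N * N) ^ k * N ^ m)  ≡⟨ trans (sym (*-assoc E ((N * N) ^ k) (N ^ m))) (trans (cong (_* N ^ m) (*-comm E ((N * N) ^ k))) (*-assoc ((N * N) ^ k) E (N ^ m))) ⟩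
          (N * N) ^ k * (E * N ^ m)  ∎)
        E≤C₀ : E ≤ C₀
        E≤C₀ = ≤-trans (*-monoˡ-≤ K₂ (≤-trans (^-monoˡ-≤ k (n≤1+n e)) (^-monoʳ-≤ (suc e) (<⇒≤ k<e)))) (m≤n+m _ 2)
        too-large : E * N ^ m < p ^ m
        too-large = begin-strict
          E * N ^ m  ≤⟨ *-monoˡ-≤ (N ^ m) E≤C₀ ⟩
          C₀ * N ^ m  ≤⟨ *-monoˡ-≤ (N ^ m) (m≤m*n C₀ (C₀ ^ pred m) {{m^n≢0 C₀ (pred m)}}) ⟩
          C₀ ^ m * N ^ m  ≡⟨ ^-distribʳ-* m C₀ N ⟨
          (C₀ * N) ^ m  <⟨ ^-monoˡ-< m Y<p ⟩
          p ^ m  ∎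

    large-level : ∀ l → 1 ≤ l → 1 ≤ ∑ (oneTo N) (λ n → ι (p ^ l ∣? h n)) →
                  l + 2 * ∑ (oneTo N) (λ n → ι (p ^ l ∣? h n)) ≤ 2 * e + 1
    large-level l 1≤l = subst (λ k → 1 ≤ k → l + 2 * k ≤ 2 * e + 1) (length-filter≡∑ (λ n → w ∣? h n) (oneTo N)) (go (hits w) unique props)
      where
      w = p ^ l
      2≤w : 2 ≤ w
      2≤w = ≤-trans (prime≥2 p-prime) (≤-trans (≤-reflexive (sym (*-identityʳ p))) (^-monoʳ-≤ p {{>-nonZero 1≤p}} 1≤l))
      unique : Unique (hits w)
      unique = Unique.filter⁺ _ (oneTo-unique N)
      props : ∀ {n} → n ∈ hits w → n ≤ N × 2 * A < n × w ∣ evalM G (node n)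
      props {n} i = let n∈ , w∣h = ∈-filter⁻ (λ n → w ∣? h n) {xs = oneTo N} i
                        <n = h-large⁻ {w} {n} 2≤w w∣h
                    in proj₂ (∈-oneTo⁻ n∈) , <n , subst (w ∣_) (h-large <n) w∣h
      go : ∀ ns → Unique ns → (∀ {n} → n ∈ ns → n ≤ N × 2 * A < n × w ∣ evalM G (node n)) → 1 ≤ length ns → l + 2 * length ns ≤ 2 * e + 1
      go (n ∷ ns) unique props _ = staircase l (suc (length ns)) (s≤s z≤n) (subst (λ z → suc z ≤ e) (length-map node ns) (proj₁ bounds))
        (subst (λ z → (N * N) ^ z * w ≤ e ^ z * evalM G (N * N)) (length-map node ns) (proj₂ bounds))
        where
        bounds = common-divisor-bound G w (N * N) (node n) (map node ns) 2≤w
          (All.map⁺ {xs = n ∷ ns} (All.tabulate (λ {m} i → let m≤N , <m , _ = props i in node≥1 <m , ≤-trans (m∸n≤m (m * m) A) (*-mono-≤ m≤N m≤N))))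
          (AllPairs-map-unique node (n ∷ ns) unique (λ i j m≢n → let m≤N , <m , _ = props i ; n≤N , <n , _ = props j in node-coprime l <m <n m≤N n≤N m≢n))
          (All.map⁺ {xs = n ∷ ns} (All.tabulate (λ i → proj₂ (proj₂ (props i)))))

    large-levels : ∀ L → ∑ (oneTo L) (λ l → ∑ (oneTo N) (λ n → ι (p ^ l ∣? h n))) ≤ e * e
    large-levels L = subst (_≤ e * e) (∑-cong (oneTo L) (λ { zero i → contradiction (proj₁ (∈-oneTo⁻ i)) (λ ()) ; (suc l) _ → refl }))
      (∑-staircase e L k bound)
      where
      k : ℕ → ℕ
      -- A default: p^0 divides all N values, and that count may violate the staircase inequality.
      -- Level 0 is outside `oneTo L`.
      k zero    = 0
      k (suc l) = ∑ (oneTo N) (λ n → ι (p ^ suc l ∣? h n))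
      bound : ∀ l → 1 ≤ k l → l + 2 * k l ≤ 2 * e + 1
      bound zero    ()
      bound (suc l) = large-level (suc l) (s≤s z≤n)

-- Factorisation into primes and radicals

evens : Poly → Poly
evens []          = []
evens (a ∷ [])    = a ∷ []
evens (a ∷ _ ∷ p) = a ∷ evens p

eval-evens : ∀ p → (∀ k → coeff p (suc (k + k)) ≡ 0ℤ) → ∀ x → eval p x ≡ eval (evens p) (x ℤ.* x)
eval-evens []          odd x = refl
eval-evens (a ∷ [])    odd x = cong (ℤ._+_ a) (trans (ℤ.*-zeroʳ x) (sym (ℤ.*-zeroʳ (x ℤ.* x))))
eval-evens (a ∷ b ∷ p) odd x rewrite odd 0 | eval-evens p (λ k → subst (λ z → coeff p z ≡ 0ℤ) (+-suc k k) (odd (suc k))) x =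
  lemma a x (eval (evens p) (x ℤ.* x))
  where
  lemma : ∀ a x P → a ℤ.+ x ℤ.* (0ℤ ℤ.+ x ℤ.* P) ≡ a ℤ.+ x ℤ.* x ℤ.* P
  lemma = ℤ-solve-∀

evens-snoc : ∀ e fs l → length fs ≡ e + e → evens (snoc fs l) ≡ snoc (evens fs) l × length (evens fs) ≡ e
evens-snoc zero    []           l len = refl , refl
evens-snoc (suc e) []           l ()
evens-snoc zero    (a ∷ _)      l ()
evens-snoc (suc e) (a ∷ [])     l len = contradiction (trans (suc-injective len) (+-suc e e)) (λ ())
evens-snoc (suc e) (a ∷ b ∷ fs) l len with evens-snoc e fs l (suc-injective (trans (suc-injective len) (+-suc e e)))
... | eq , eq′ = cong (a ∷_) eq , cong suc eq′

IsEven⇒odd-coeff≡0 : ∀ f → IsEven f → ∀ k → coeff f (suc (k + k)) ≡ 0ℤ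
IsEven⇒odd-coeff≡0 f even k with ℤ.i*j≡0⇒i≡0∨j≡0 (pos 2) (double (coeff f (suc (k + k))) negated)
  where
  [-1]^2k : ∀ k → (ℤ.- pos 1) ℤ.^ (k + k) ≡ pos 1
  [-1]^2k zero    = refl
  [-1]^2k (suc k) rewrite +-suc k k | [-1]^2k k = refl
  negated : (ℤ.- pos 1) ℤ.* pos 1 ℤ.* coeff f (suc (k + k)) ≡ coeff f (suc (k + k))
  negated = trans (cong (λ z → (ℤ.- pos 1) ℤ.* z ℤ.* coeff f (suc (k + k))) (sym ([-1]^2k k))) (even (suc (k + k)))
  double : ∀ a → (ℤ.- pos 1) ℤ.* pos 1 ℤ.* a ≡ a → pos 2 ℤ.* a ≡ 0ℤ
  double a eq = trans (lemma a) (trans (cong (ℤ._- (ℤ.- pos 1) ℤ.* pos 1 ℤ.* a) (sym eq)) (ℤ.+-inverseʳ ((ℤ.- pos 1) ℤ.* pos 1 ℤ.* a)))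
    where
    lemma : ∀ a → pos 2 ℤ.* a ≡ a ℤ.- (ℤ.- pos 1) ℤ.* pos 1 ℤ.* a
    lemma = ℤ-solve-∀
... | inj₂ a≡0 = a≡0

unsnoc : ∀ f d → length f ≡ suc d → ∃[ fs ] (f ≡ snoc fs (coeff f d) × length fs ≡ d)
unsnoc (a ∷ [])        zero    len = [] , refl , refl
unsnoc (a ∷ p@(_ ∷ _)) (suc d) len with unsnoc p d (suc-injective len)
... | fs , eq , len′ = a ∷ fs , cong (a ∷_) eq , cong suc len′

multiplicity : ℕ → ℕ → ℕ → ℕ
multiplicity L p m = ∑ (oneTo L) (λ l → ι (p ^ l ∣? m))

factor≤∏ : ∀ (g : ℕ → ℕ) {x} xs → (∀ y → y ∈ xs → 1 ≤ g y) → x ∈ xs → g x ≤ ∏ xs g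
factor≤∏ g (x ∷ xs) g≥1 (here refl) = m≤m*n (g x) (∏ xs g) {{>-nonZero (∏≥1 xs (λ y → g≥1 y ∘ there))}}
factor≤∏ g (x ∷ xs) g≥1 (there i)   = ≤-trans (factor≤∏ g xs (λ y → g≥1 y ∘ there) i) (m≤n*m _ (g x) {{>-nonZero (g≥1 x (here refl))}})

-- Each level of `m` moves up by one in `q * m` and the first level is gained. Nothing is lost at
-- the top, since q^L exceeds `m`.
multiplicity-prime-* : ∀ L {q} m → Prime q → 1 ≤ m → q * m ≤ L → suc (multiplicity L q m) ≤ multiplicity L q (q * m)
multiplicity-prime-* zero    {q} m q-prime 1≤m qm≤L = contradiction (≤-trans (*-mono-≤ (<⇒≤ (prime≥2 q-prime)) 1≤m) qm≤L) (λ ())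
multiplicity-prime-* (suc L) {q} m q-prime 1≤m qm≤L = begin
  suc (ι (q ^ suc L ∣? m) + multiplicity L q m)  ≡⟨ cong (λ z → suc (z + multiplicity L q m)) (ι-no (q ^ suc L ∣? m) too-large) ⟩
  suc (multiplicity L q m)  ≤⟨ +-mono-≤ (≤-reflexive (sym (ι-yes (q ^ 1 ∣? q * m) (subst (_∣ q * m) (sym (*-identityʳ q)) (m∣m*n m)))))
                                                                              (∑-mono (oneTo L) (λ l _ → ι-mono (q ^ l ∣? m) (q ^ suc l ∣? q * m) (*-monoʳ-∣ q))) ⟩
  ι (q ^ 1 ∣? q * m) + ∑ (oneTo L) (λ l → ι (q ^ suc l ∣? q * m))  ≡⟨ ∑-oneTo-suc L (λ l → ι (q ^ l ∣? q * m)) ⟨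
  multiplicity (suc L) q (q * m)  ∎
  where
  open ≤-Reasoning
  too-large : ¬ q ^ suc L ∣ m
  too-large q^∣m = <⇒≱ (begin-strict
    m  ≤⟨ m≤n*m m q {{prime⇒nonZero q-prime}} ⟩
    q * m  ≤⟨ qm≤L ⟩
    suc L  <⟨ suc≤2^ (suc L) ⟩
    2 ^ suc L  ≤⟨ ^-monoˡ-≤ (suc L) (prime≥2 q-prime) ⟩
    q ^ suc L  ∎) (∣⇒≤ {{>-nonZero 1≤m}} q^∣m)

product≤∏-multiplicity : ∀ L M ps → All Prime ps → product ps ≤ L → product ps ≤ M →
  product ps ≤ ∏ (oneTo M) (λ p → prime^ p ^ multiplicity L p (product ps))
product≤∏-multiplicity L M [] _ _ _ = ∏≥1 (oneTo M) (λ p i → m^n>0 (prime^ p) {{prime^≢0 i}} (multiplicity L p 1))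
product≤∏-multiplicity L M (q ∷ ps) (q-prime ∷ primes) ≤L ≤M = begin
  q * m  ≤⟨ *-mono-≤ single (product≤∏-multiplicity L M ps primes (≤-trans m≤qm ≤L) (≤-trans m≤qm ≤M)) ⟩
  ∏ (oneTo M) (λ p → prime^ p ^ ι (q ≟ p)) * ∏ (oneTo M) (λ p → prime^ p ^ multiplicity L p m)
                                                                                           ≡⟨ ∏-* (oneTo M) _ _ ⟨
  ∏ (oneTo M) (λ p → prime^ p ^ ι (q ≟ p) * prime^ p ^ multiplicity L p m)  ≤⟨ ∏-mono (oneTo M) combine ⟩
  ∏ (oneTo M) (λ p → prime^ p ^ multiplicity L p (q * m))  ∎
  where
  open ≤-Reasoning
  m = product ps
  1≤m : 1 ≤ m
  1≤m = productOfPrimes≥1 primes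
  m≤qm : m ≤ q * m
  m≤qm = m≤n*m m q {{prime⇒nonZero q-prime}}
  q∈ : q ∈ oneTo M
  q∈ = ∈-oneTo⁺ (<⇒≤ (prime≥2 q-prime)) (≤-trans (m≤m*n q m {{>-nonZero 1≤m}}) ≤M)
  single : q ≤ ∏ (oneTo M) (λ p → prime^ p ^ ι (q ≟ p))
  single = ≤-trans (≤-reflexive (sym (trans (cong (prime^ q ^_) (ι-yes (q ≟ q) refl)) (trans (*-identityʳ _) (trans (cong (q ^_) (ι-yes (prime? q) q-prime)) (*-identityʳ q))))))
    (factor≤∏ (λ p → prime^ p ^ ι (q ≟ p)) (oneTo M) (λ p i → m^n>0 (prime^ p) {{prime^≢0 i}} (ι (q ≟ p))) q∈)
  combine : ∀ p → p ∈ oneTo M → prime^ p ^ ι (q ≟ p) * prime^ p ^ multiplicity L p m ≤ prime^ p ^ multiplicity L p (q * m)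
  combine p i = ≤-trans (≤-reflexive (sym (^-distribˡ-+-* (prime^ p) (ι (q ≟ p)) _))) (^-monoʳ-≤ (prime^ p) {{prime^≢0 i}} (exponents (q ≟ p)))
    where
    exponents : (q≟p : Dec (q ≡ p)) → ι q≟p + multiplicity L p m ≤ multiplicity L p (q * m)
    exponents (yes refl) = multiplicity-prime-* L m q-prime 1≤m ≤L
    exponents (no _)     = ∑-mono (oneTo L) (λ l _ → ι-mono (p ^ l ∣? m) (p ^ l ∣? q * m) (∣n⇒∣m*n q))

n≤∏-multiplicity : ∀ L M n → 1 ≤ n → n ≤ L → n ≤ M → n ≤ ∏ (oneTo M) (λ p → prime^ p ^ multiplicity L p n)
n≤∏-multiplicity L M n 1≤n n≤L n≤M with factorise n {{>-nonZero 1≤n}}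
... | record { factors = ps ; isFactorisation = refl ; factorsPrime = primes } = product≤∏-multiplicity L M ps primes n≤L n≤M

∏-oneTo-truncate : ∀ n k (g : ℕ → ℕ) → (∀ m → n < m → g m ≡ 1) → ∏ (oneTo (n + k)) g ≡ ∏ (oneTo n) g
∏-oneTo-truncate n zero    g g≡1 = cong (λ z → ∏ (oneTo z) g) (+-identityʳ n)
∏-oneTo-truncate n (suc k) g g≡1 rewrite +-suc n k | g≡1 (suc (n + k)) (s≤s (m≤m+n n k)) =
  trans (+-identityʳ _) (∏-oneTo-truncate n k g g≡1)

∏-↭ : ∀ {xs ys : List ℕ} (g : ℕ → ℕ) → xs ↭ ys → ∏ xs g ≡ ∏ ys g
∏-↭ g perm = product-↭ (↭-map⁺ g perm)

rad≡∏ : ∀ m → rad m ≡ ∏ (oneTo m) (λ p → prime^ p ^ ι (p ∣? m))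
rad≡∏ m = begin
  product (filter P? (upTo (suc m)))  ≡⟨ cong product (map-id (filter P? (upTo (suc m)))) ⟨
  ∏ (filter P? (upTo (suc m))) id  ≡⟨ ∏-filter P? (upTo (suc m)) id ⟩
  ∏ (upTo (suc m)) (λ p → p ^ ι (P? p))  ≡⟨ ∏-cong (upTo (suc m)) (λ p _ → pointwise p) ⟩
  ∏ (upTo (suc m)) g  ≡⟨ cong (λ xs → ∏ xs g) (reverse-downFrom (suc m)) ⟨
  ∏ (reverse (downFrom (suc m))) g  ≡⟨ ∏-↭ g (↭-reverse (downFrom (suc m))) ⟩
  ∏ (downFrom (suc m)) g  ≡⟨ cong (λ xs → ∏ xs g) (downFrom-∷ʳ m) ⟨
  ∏ (oneTo m ++ 0 ∷ []) g  ≡⟨ ∏-++ (oneTo m) (0 ∷ []) g ⟩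
  -- The entry 0, present in `upTo` but not in `oneTo`, is not prime and contributes a power of 1.
  ∏ (oneTo m) g * (g 0 * 1)  ≡⟨ cong (∏ (oneTo m) g *_) (trans (*-identityʳ (g 0)) (^-zeroˡ (ι (0 ∣? m)))) ⟩
  ∏ (oneTo m) g * 1  ≡⟨ *-identityʳ _ ⟩
  ∏ (oneTo m) g  ∎
  where
  open ≡-Reasoning
  P? : (p : ℕ) → Dec (Prime p × p ∣ m)
  P? p = prime? p ×-dec p ∣? m
  g : ℕ → ℕ
  g p = prime^ p ^ ι (p ∣? m)
  pointwise : ∀ p → p ^ ι (P? p) ≡ prime^ p ^ ι (p ∣? m)
  pointwise p = trans (cong (p ^_) (ι-× (prime? p) (p ∣? m))) (sym (^-*-assoc p (ι (prime? p)) (ι (p ∣? m))))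
    where
    ι-× : ∀ {P Q : Set} (x : Dec P) (y : Dec Q) → ι (x ×-dec y) ≡ ι x * ι y
    ι-× (yes p) (yes q) = refl
    ι-× (yes p) (no ¬q) = refl
    ι-× (no ¬p) y       = refl

∈⇒∣prodℤ : ∀ {x} xs → x ∈ xs → ∣ x ∣ ∣ ∣ prodℤ xs ∣
∈⇒∣prodℤ (x ∷ xs) (here refl) = subst (∣ x ∣ ∣_) (sym (ℤ.abs-* x (prodℤ xs))) (m∣m*n ∣ prodℤ xs ∣)
∈⇒∣prodℤ {y} (x ∷ xs) (there i) = subst (∣ y ∣ ∣_) (sym (ℤ.abs-* x (prodℤ xs))) (∣n⇒∣m*n ∣ x ∣ (∈⇒∣prodℤ xs i))

prodℤ≢0 : ∀ xs → (∀ x → x ∈ xs → ¬ x ≡ 0ℤ) → ¬ prodℤ xs ≡ 0ℤ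
prodℤ≢0 []       ≢0 ()
prodℤ≢0 (x ∷ xs) ≢0 = *-nonzero (≢0 x (here refl)) (prodℤ≢0 xs (λ y → ≢0 y ∘ there))

n!≡∏ : ∀ n → n ! ≡ ∏ (oneTo n) id
n!≡∏ zero    = refl
n!≡∏ (suc n) = cong (suc n *_) (n!≡∏ n)

π≤ : ∀ Y → π Y ≤ Y
π≤ Y = ≤-trans (∑-mono (oneTo Y) (λ p _ → ι≤1 (prime? p))) (≤-reflexive (trans (∑-const (oneTo Y) 1) (trans (*-identityʳ _) (length-oneTo Y))))

-- Combination of the estimates

module EvenPolynomial (fs : Poly) (irreducible : Irreducible (snoc fs (pos 1))) (e : ℕ) (1≤e : 1 ≤ e)
  (len : length fs ≡ 2 * e) (A : ℕ) (G : List ℕ) (len-G : length G ≡ e)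
  (G-spec : ∀ n → A ≤ n * n → eval (snoc fs (pos 1)) (pos n) ≡ pos (evalM G (n * n ∸ A))) where

  1≤d : 1 ≤ length fs
  1≤d = ≤-trans (≤-trans 1≤e (m≤n*m e 2)) (≤-reflexive (sym len))

  2≤d : 2 ≤ length fs
  2≤d = ≤-trans (*-monoʳ-≤ 2 1≤e) (≤-reflexive (sym len))

  open MonicIrreducible fs irreducible using (f; d; no-root)
  open NormBound fs irreducible 1≤d using (K₀)
  open SmallPrimes fs irreducible 1≤d using (D; level; levels; small-primes)
  open EvenValues G A hiding (e)

  len′ : d ≡ 2 * length G
  len′ = trans len (cong (2 *_) (sym len-G))

  h∣f : ∀ {w} n → 2 ≤ w → w ∣ h n → w ∣ ∣ eval f (pos n) ∣
  h∣f {w} n 2≤w w∣h = subst (w ∣_) (sym (cong ∣_∣ (G-spec n (A≤n² <n)))) (subst (w ∣_) (h-large <n) w∣h)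
    where <n = h-large⁻ {w} {n} 2≤w w∣h

  module _ (N : ℕ) (1≤N : 1 ≤ N) where

    private
      values : List ℤ
      values = map (λ n → eval f (pos (suc n))) (upTo N)

      F : ℕ
      F = ∣ prodℤ values ∣

      Y : ℕ
      Y = C₀ * N

      1≤F : 1 ≤ F
      1≤F = n≢0⇒n>0 (prodℤ≢0 values nonzero ∘ ℤ.∣i∣≡0⇒i≡0)
        where
        nonzero : ∀ x → x ∈ values → ¬ x ≡ 0ℤ
        nonzero x i with ∈-map⁻ (λ n → eval f (pos (suc n))) i
        ... | n , _ , refl = no-root 2≤d (pos (suc n))

      f∣F : ∀ n → n ∈ oneTo N → ∣ eval f (pos n) ∣ ∣ F
      f∣F zero    i = contradiction (proj₁ (∈-oneTo⁻ i)) (λ ())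
      f∣F (suc n) i = ∈⇒∣prodℤ values (∈-map⁺ (λ n → eval f (pos (suc n))) (∈-upTo⁺ (proj₂ (∈-oneTo⁻ i))))

      h≤F : ∀ n → n ∈ oneTo N → h n ≤ F
      h≤F n i with 2 ≤? h n
      ... | yes 2≤h = ∣⇒≤ {{>-nonZero 1≤F}} (∣-trans (h∣f {h n} n 2≤h ∣-refl) (f∣F n i))
      ... | no  2≰h = ≤-trans (≤-pred (≰⇒> 2≰h)) 1≤F

      -- Every h(n) is at most `F`, so `suc F` levels see all prime powers that divide it; the
      -- successor fits `small-primes`, which splits off the first level.
      lev : ℕ → ℕ
      lev = levels N 1≤N h h∣f (suc F)

      -- The range up to `Y + F` contains both the primes up to `Y` and all prime divisors of `F`;
      -- it is cut down to one or the other in `∏-small` and `∏-rad`.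
      ∏h≤∏levels : ∏ (oneTo N) h ≤ ∏ (oneTo (Y + F)) (λ p → prime^ p ^ lev p)
      ∏h≤∏levels = begin
        ∏ (oneTo N) h
          ≤⟨ ∏-mono (oneTo N) (λ n i → n≤∏-multiplicity (suc F) (Y + F) (h n) (h≥1 n) (m≤n⇒m≤1+n (h≤F n i)) (≤-trans (h≤F n i) (m≤n+m F Y))) ⟩
        ∏ (oneTo N) (λ n → ∏ (oneTo (Y + F)) (λ p → prime^ p ^ multiplicity (suc F) p (h n)))
          ≡⟨ ∏-swap (oneTo N) (oneTo (Y + F)) _ ⟩
        ∏ (oneTo (Y + F)) (λ p → ∏ (oneTo N) (λ n → prime^ p ^ multiplicity (suc F) p (h n)))
          ≡⟨ ∏-cong (oneTo (Y + F)) (λ p _ → trans (sym (^-∑ (oneTo N) (prime^ p) (λ n → multiplicity (suc F) p (h n))))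
               (cong (prime^ p ^_) (∑-swap (oneTo N) (oneTo (suc F)) (λ n l → ι (p ^ l ∣? h n))))) ⟩
        ∏ (oneTo (Y + F)) (λ p → prime^ p ^ lev p) ∎
        where open ≤-Reasoning

      lev-zero : ∀ p → 2 ≤ p → ¬ p ∣ F → lev p ≡ 0
      lev-zero p 2≤p p∤F = trans (∑-cong (oneTo (suc F)) (λ l l∈ → trans (∑-cong (oneTo N) (λ n n∈ → ι-no (p ^ l ∣? h n) (λ p^l∣h →
        p∤F (∣-trans (h∣f {p} n 2≤p (∣-trans (p∣p^l l (proj₁ (∈-oneTo⁻ l∈))) p^l∣h)) (f∣F n n∈))))) (∑-zero (oneTo N)))) (∑-zero (oneTo (suc F)))
        where
        p∣p^l : ∀ l → 1 ≤ l → p ∣ p ^ l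
        p∣p^l (suc l) _ = m∣m*n (p ^ l)

      -- For p ≤ Y the first factor is the whole left side. For p > Y the second suffices:
      -- `large-levels` bounds the exponent by e², and a prime that does not divide `F` divides no
      -- h(n) and has exponent 0.
      split : ∀ p → p ∈ oneTo (Y + F) →
        prime^ p ^ lev p ≤ (prime^ p ^ lev p) ^ ι (p ≤? Y) * (prime^ p ^ ι (p ∣? F)) ^ (e * e)
      split p i with p ≤? Y
      ... | yes _ = ≤-trans (≤-reflexive (sym (*-identityʳ (prime^ p ^ lev p))))
                      (m≤m*n ((prime^ p ^ lev p) ^ 1) _ {{m^n≢0 (prime^ p ^ ι (p ∣? F)) (e * e) {{m^n≢0 (prime^ p) (ι (p ∣? F)) {{prime^≢0 i}}}}}})
      ... | no p≰Y = ≤-trans (large (prime? p) (p ∣? F)) (≤-reflexive (sym (*-identityˡ _)))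
        where
        large : (p-prime? : Dec (Prime p)) (p∣F? : Dec (p ∣ F)) → (p ^ ι p-prime?) ^ lev p ≤ ((p ^ ι p-prime?) ^ ι p∣F?) ^ (e * e)
        large (no _) p∣F? = ≤-reflexive (trans (^-zeroˡ (lev p)) (sym (trans (cong (_^ (e * e)) (^-zeroˡ (ι p∣F?))) (^-zeroˡ (e * e)))))
        large (yes p-prime) (no p∤F)  = ≤-reflexive (trans (cong ((p ^ 1) ^_) (lev-zero p (prime≥2 p-prime) p∤F)) (sym (^-zeroˡ (e * e))))
        large (yes p-prime) (yes _) = ≤-trans (^-monoʳ-≤ (p ^ 1) {{m^n≢0 p 1 {{prime⇒nonZero p-prime}}}}
          (subst (λ z → lev p ≤ z * z) len-G (large-levels N 1≤N p-prime (≰⇒> p≰Y) (suc F)))) (≤-reflexive (cong (_^ (e * e)) (sym (*-identityʳ (p ^ 1)))))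

      ∏-small : ∏ (oneTo (Y + F)) (λ p → (prime^ p ^ lev p) ^ ι (p ≤? Y)) ≡ ∏ (oneTo Y) (λ p → prime^ p ^ lev p)
      ∏-small = trans (∏-oneTo-truncate Y F _ (λ m Y<m → cong ((prime^ m ^ lev m) ^_) (ι-no (m ≤? Y) (<⇒≱ Y<m))))
        (∏-cong (oneTo Y) (λ p i → trans (cong ((prime^ p ^ lev p) ^_) (ι-yes (p ≤? Y) (proj₂ (∈-oneTo⁻ i)))) (*-identityʳ _)))

      ∏-rad : ∏ (oneTo (Y + F)) (λ p → prime^ p ^ ι (p ∣? F)) ≡ ℓ f N
      ∏-rad = trans (cong (λ z → ∏ (oneTo z) (λ p → prime^ p ^ ι (p ∣? F))) (+-comm Y F))
        (trans (∏-oneTo-truncate F Y _ (λ m F<m → cong (prime^ m ^_) (ι-no (m ∣? F) (λ m∣F → <⇒≱ F<m (∣⇒≤ {{>-nonZero 1≤F}} m∣F))))) (sym (rad≡∏ F)))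

    ℓ≥1 : 1 ≤ ℓ f N
    ℓ≥1 = subst (1 ≤_) ∏-rad (∏≥1 (oneTo (Y + F)) (λ p i → m^n>0 (prime^ p) {{prime^≢0 i}} (ι (p ∣? F))))

    V : ℕ
    V = K₂ * N ^ d

    small-bound : ℕ
    small-bound = (2 ^ d * K₀ ^ d * N) ^ N * 16 ^ (2 * (C₀ * N * d)) * (16 ^ (C₀ * N)) ^ d * (16 ^ (2 * (D * N))) ^ (2 * (d * D)) * (V ^ π (C₀ * N)) ^ (d * D)

    values-bound : ∏ (oneTo N) h ≤
      small-bound * ℓ f N ^ (e * e)
    values-bound = begin
      ∏ (oneTo N) h  ≤⟨ ∏h≤∏levels ⟩
      ∏ (oneTo (Y + F)) (λ p → prime^ p ^ lev p)  ≤⟨ ∏-mono (oneTo (Y + F)) split ⟩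
      ∏ (oneTo (Y + F)) (λ p → (prime^ p ^ lev p) ^ ι (p ≤? Y) * (prime^ p ^ ι (p ∣? F)) ^ (e * e))
                                                              ≡⟨ ∏-* (oneTo (Y + F)) _ _ ⟩
      ∏ (oneTo (Y + F)) (λ p → (prime^ p ^ lev p) ^ ι (p ≤? Y)) * ∏ (oneTo (Y + F)) (λ p → (prime^ p ^ ι (p ∣? F)) ^ (e * e))
        ≡⟨ cong₂ _*_ ∏-small (trans (∏-^ (oneTo (Y + F)) (λ p → prime^ p ^ ι (p ∣? F)) (e * e)) (cong (_^ (e * e)) ∏-rad)) ⟩
      ∏ (oneTo Y) (λ p → prime^ p ^ lev p) * ℓ f N ^ (e * e)
        ≤⟨ *-monoˡ-≤ (ℓ f N ^ (e * e)) (small-primes N 1≤N h h∣f V h≥1 (λ n n≤N → subst (λ z → h n ≤ K₂ * N ^ z) (sym len′) (h-upper N n 1≤N n≤N)) F Y) ⟩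
      small-bound * ℓ f N ^ (e * e) ∎
      where open ≤-Reasoning

    factorial-bound : N ^ (d * N) ≤ (4 ^ d * K₁) ^ N * ∏ (oneTo N) h
    factorial-bound = begin
      N ^ (d * N)  ≡⟨ trans (cong (N ^_) (*-comm d N)) (sym (^-*-assoc N N d)) ⟩
      (N ^ N) ^ d  ≤⟨ ^-monoˡ-≤ d (n^n≤4^n*n! N) ⟩
      (4 ^ N * N !) ^ d  ≡⟨ ^-distribʳ-* d (4 ^ N) (N !) ⟩
      (4 ^ N) ^ d * (N !) ^ d  ≡⟨ cong₂ _*_ (^-swap 4 N d) (trans (cong (_^ d) (n!≡∏ N)) (sym (∏-^ (oneTo N) id d))) ⟩
      (4 ^ d) ^ N * ∏ (oneTo N) (λ n → n ^ d)  ≤⟨ *-monoʳ-≤ ((4 ^ d) ^ N) (∏-mono (oneTo N) (λ n _ → subst (λ z → n ^ z ≤ K₁ * h n) (sym len′) (h-lower n))) ⟩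
      (4 ^ d) ^ N * ∏ (oneTo N) (λ n → K₁ * h n)  ≡⟨ cong ((4 ^ d) ^ N *_) (trans (∏-* (oneTo N) (const K₁) h) (cong (_* ∏ (oneTo N) h) (trans (∏-const (oneTo N) K₁) (cong (K₁ ^_) (length-oneTo N))))) ⟩
      (4 ^ d) ^ N * (K₁ ^ N * ∏ (oneTo N) h)  ≡⟨ trans (sym (*-assoc ((4 ^ d) ^ N) _ _)) (cong (_* ∏ (oneTo N) h) (sym (^-distribʳ-* N (4 ^ d) K₁))) ⟩
      (4 ^ d * K₁) ^ N * ∏ (oneTo N) h  ∎
      where open ≤-Reasoning

    V^π-bound : V ^ π (C₀ * N) ≤ (K₂ ^ C₀ * (1024 ^ C₀) ^ d) ^ N
    V^π-bound = begin
      (K₂ * N ^ d) ^ π Y  ≤⟨ ^-monoˡ-≤ (π Y) (*-monoʳ-≤ K₂ (^-monoˡ-≤ d (m≤n*m N C₀))) ⟩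
      (K₂ * Y ^ d) ^ π Y  ≡⟨ ^-distribʳ-* (π Y) K₂ (Y ^ d) ⟩
      K₂ ^ π Y * (Y ^ d) ^ π Y  ≤⟨ *-mono-≤ (^-monoʳ-≤ K₂ (π≤ Y)) (≤-trans (≤-reflexive (^-swap Y d (π Y))) (^-monoˡ-≤ d (Y^π≤1024^Y Y))) ⟩
      K₂ ^ (C₀ * N) * (1024 ^ (C₀ * N)) ^ d  ≡⟨ cong₂ _*_ (sym (^-*-assoc K₂ C₀ N)) (trans (cong (_^ d) (sym (^-*-assoc 1024 C₀ N))) (^-swap (1024 ^ C₀) N d)) ⟩
      (K₂ ^ C₀) ^ N * ((1024 ^ C₀) ^ d) ^ N  ≡⟨ ^-distribʳ-* N (K₂ ^ C₀) _ ⟨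
      (K₂ ^ C₀ * (1024 ^ C₀) ^ d) ^ N  ∎
      where open ≤-Reasoning

  -- `E₁` to `E₄` are the constants whose N-th powers are, or bound, the last four factors of
  -- `small-bound`. `E` adds the constants of `factorial-bound` and of the main term.
  E₁ E₂ E₃ E₄ E : ℕ
  E₁ = 16 ^ (2 * (C₀ * d))
  E₂ = (16 ^ C₀) ^ d
  E₃ = (16 ^ (2 * D)) ^ (2 * (d * D))
  E₄ = (K₂ ^ C₀ * (1024 ^ C₀) ^ d) ^ (d * D)
  E  = 4 ^ d * K₁ * (2 ^ d * K₀ ^ d) * E₁ * E₂ * E₃ * E₄

  lower-bound : ∀ N → 1 ≤ N → N ^ (pred d * N) ≤ E ^ N * ℓ f N ^ (e * e)
  lower-bound N 1≤N = *-cancelʳ-≤ _ _ (N ^ N) {{m^n≢0 N N {{>-nonZero 1≤N}}}} (begin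
    N ^ (pred d * N) * N ^ N  ≡⟨ ^-distribˡ-+-* N (pred d * N) N ⟨
    N ^ (pred d * N + N)  ≡⟨ cong (N ^_) (trans (+-comm (pred d * N) N) (cong (_* N) (suc-pred d {{>-nonZero 1≤d}}))) ⟩
    N ^ (d * N)  ≤⟨ factorial-bound N 1≤N ⟩
    (4 ^ d * K₁) ^ N * ∏ (oneTo N) h  ≤⟨ *-monoʳ-≤ ((4 ^ d * K₁) ^ N) (values-bound N 1≤N) ⟩
    (4 ^ d * K₁) ^ N * ((2 ^ d * K₀ ^ d * N) ^ N * 16 ^ (2 * (C₀ * N * d)) * (16 ^ (C₀ * N)) ^ d * (16 ^ (2 * (D * N))) ^ (2 * (d * D)) * (V N 1≤N ^ π (C₀ * N)) ^ (d * D) * L)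
      ≤⟨ *-monoʳ-≤ ((4 ^ d * K₁) ^ N) (*-monoˡ-≤ L (*-mono-≤ (*-mono-≤ (*-mono-≤ (*-mono-≤
           (≤-reflexive (^-distribʳ-* N (2 ^ d * K₀ ^ d) N))
           (≤-reflexive (trans (cong (16 ^_) (lemma₁ C₀ N d)) (sym (^-*-assoc 16 (2 * (C₀ * d)) N)))))
           (≤-reflexive (trans (cong (_^ d) (sym (^-*-assoc 16 C₀ N))) (^-swap (16 ^ C₀) N d))))
           (≤-reflexive (trans (cong (_^ (2 * (d * D))) (trans (cong (16 ^_) (sym (*-assoc 2 D N))) (sym (^-*-assoc 16 (2 * D) N)))) (^-swap (16 ^ (2 * D)) N (2 * (d * D))))))
           (≤-trans (^-monoˡ-≤ (d * D) (V^π-bound N 1≤N)) (≤-reflexive (^-swap (K₂ ^ C₀ * (1024 ^ C₀) ^ d) N (d * D)))))) ⟩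
    (4 ^ d * K₁) ^ N * ((2 ^ d * K₀ ^ d) ^ N * N ^ N * E₁ ^ N * E₂ ^ N * E₃ ^ N * E₄ ^ N * L)
      ≡⟨ lemma₂ ((4 ^ d * K₁) ^ N) ((2 ^ d * K₀ ^ d) ^ N) (N ^ N) (E₁ ^ N) (E₂ ^ N) (E₃ ^ N) (E₄ ^ N) L ⟩
    (4 ^ d * K₁) ^ N * (2 ^ d * K₀ ^ d) ^ N * E₁ ^ N * E₂ ^ N * E₃ ^ N * E₄ ^ N * L * N ^ N
      ≡⟨ cong (λ z → z * L * N ^ N) (sym power) ⟩
    E ^ N * L * N ^ N  ∎)
    where
    open ≤-Reasoning
    L = ℓ f N ^ (e * e)
    lemma₁ : ∀ c n d → 2 * (c * n * d) ≡ 2 * (c * d) * n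
    lemma₁ = solve-∀
    lemma₂ : ∀ a b n x y z w l → a * (b * n * x * y * z * w * l) ≡ a * b * x * y * z * w * l * n
    lemma₂ = solve-∀
    power : E ^ N ≡ (4 ^ d * K₁) ^ N * (2 ^ d * K₀ ^ d) ^ N * E₁ ^ N * E₂ ^ N * E₃ ^ N * E₄ ^ N
    power = trans (^-distribʳ-* N _ E₄) (cong (_* E₄ ^ N) (trans (^-distribʳ-* N _ E₃) (cong (_* E₃ ^ N)
      (trans (^-distribʳ-* N _ E₂) (cong (_* E₂ ^ N) (trans (^-distribʳ-* N _ E₁) (cong (_* E₁ ^ N) (^-distribʳ-* N (4 ^ d * K₁) (2 ^ d * K₀ ^ d)))))))))

  conclusion : ∃[ K ] (1 ≤ K × (∀ N → 2 ≤ N → N ^ (8 * (d ∸ 1) * N) ≤ ℓ f N ^ (d * (3 * d ∸ 2)) * K ^ N))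
  -- The eighth power comes from the factor 8 in the claim, and the successor makes the constant
  -- visibly positive.
  conclusion = suc (E ^ 8) , s≤s z≤n , λ N 2≤N → bound N (<⇒≤ 2≤N)
    where
    open ≤-Reasoning
    -- Since d = 2e, the left side is 2d², and 2d ≤ 3d - 2 because d ≥ 2.
    exponent : e * e * 8 ≤ d * (3 * d ∸ 2)
    exponent = begin
      e * e * 8  ≡⟨ lemma e ⟩
      2 * e * (2 * (2 * e))  ≡⟨ cong (λ z → z * (2 * z)) len ⟨
      d * (2 * d)  ≤⟨ *-monoʳ-≤ d (≤-trans (≤-reflexive (sym (m+n∸n≡m (2 * d) 2))) (∸-monoˡ-≤ 2 (≤-trans (+-monoʳ-≤ (2 * d) 2≤d) (≤-reflexive (+-comm (2 * d) d))))) ⟩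
      d * (3 * d ∸ 2)  ∎
      where
      lemma : ∀ e → e * e * 8 ≡ 2 * e * (2 * (2 * e))
      lemma = solve-∀
    bound : ∀ N → 1 ≤ N → N ^ (8 * (d ∸ 1) * N) ≤ ℓ f N ^ (d * (3 * d ∸ 2)) * suc (E ^ 8) ^ N
    bound N 1≤N = begin
      N ^ (8 * (d ∸ 1) * N)  ≡⟨ cong (N ^_) (trans (*-assoc 8 (pred d) N) (*-comm 8 (pred d * N))) ⟩
      N ^ (pred d * N * 8)  ≡⟨ ^-*-assoc N (pred d * N) 8 ⟨
      (N ^ (pred d * N)) ^ 8  ≤⟨ ^-monoˡ-≤ 8 (lower-bound N 1≤N) ⟩
      (E ^ N * ℓ f N ^ (e * e)) ^ 8  ≡⟨ trans (^-distribʳ-* 8 (E ^ N) _) (*-comm ((E ^ N) ^ 8) _) ⟩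
      (ℓ f N ^ (e * e)) ^ 8 * (E ^ N) ^ 8  ≤⟨ *-mono-≤ (≤-trans (≤-reflexive (^-*-assoc (ℓ f N) (e * e) 8)) (^-monoʳ-≤ (ℓ f N) {{>-nonZero (ℓ≥1 N 1≤N)}} exponent))
                                                          (≤-trans (≤-reflexive (^-swap E N 8)) (^-monoˡ-≤ N (n≤1+n (E ^ 8)))) ⟩
      ℓ f N ^ (d * (3 * d ∸ 2)) * suc (E ^ 8) ^ N  ∎

-- Taking logarithms and dividing by d(3d - 2) gives the bound in its additive form, for any
-- positive C ≥ log K / (d(3d - 2)).
theorem1p3 : ∀ (d : ℕ) (f : Poly) → 2 ≤ d → MonicOfDegree f d → Irreducible f → IsEven f →
    ∃[ K ] (1 ≤ K × (∀ (N : ℕ) → 2 ≤ N →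
    N ^ (8 * (d ∸ 1) * N) ≤ ℓ f N ^ (d * (3 * d ∸ 2)) * K ^ N))
theorem1p3 d f 2≤d (len , monic) irreducible even with unsnoc f d len
... | fs , f≡ , len-fs with trans f≡ (cong (snoc fs) monic)
... | refl with half d
-- An odd degree is impossible: the leading coefficient would have odd index and vanish, but it is
-- 1.
... | e , inj₂ refl = contradiction (trans (sym monic) (IsEven⇒odd-coeff≡0 f even e)) (λ ())
... | e , inj₁ refl with evens-snoc e fs (pos 1) len-fs | shift-positive (evens fs)
-- The threshold itself serves as the shift, so that f(n) = g(n²) = G(n² - A) as soon as n² ≥ A.
... | evens≡ , len-evens | A , shifted with shifted A ≤-refl
... | G , len-G , _ , G-spec = subst (λ d → ∃[ K ] (1 ≤ K × (∀ N → 2 ≤ N → N ^ (8 * (d ∸ 1) * N) ≤ ℓ f N ^ (d * (3 * d ∸ 2)) * K ^ N))) len-fs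
    (EvenPolynomial.conclusion fs irreducible e 1≤e (trans len-fs (cong (e +_) (sym (+-identityʳ e)))) A G (trans len-G len-evens) spec)
  where
  1≤e : 1 ≤ e
  1≤e = n≢0⇒n>0 (λ { refl → contradiction 2≤d (λ ()) })
  spec : ∀ n → A ≤ n * n → eval (snoc fs (pos 1)) (pos n) ≡ pos (evalM G (n * n ∸ A))
  spec n A≤n² = begin
    eval f (pos n)  ≡⟨ eval-evens f (IsEven⇒odd-coeff≡0 f even) (pos n) ⟩
    eval (evens f) (pos n ℤ.* pos n)  ≡⟨ cong₂ eval evens≡ (trans (sym (ℤ.pos-* n n)) (cong pos (sym (m∸n+n≡m A≤n²)))) ⟩
    eval (snoc (evens fs) (pos 1)) (pos (n * n ∸ A + A))  ≡⟨ G-spec (n * n ∸ A) ⟩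
    pos (evalM G (n * n ∸ A))  ∎
    where open ≡-Reasoning
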